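{- Let $\epsilon>0$, $c(\epsilon):=\epsilon/\sqrt5$, and $q\ge1$ an integer. If $w_A,w_B:\mathbb{Z}/q\mathbb{Z}\to[0,1]$ satisfy $\sum_{t\in\mathbb{Z}/q\mathbb{Z}}w_A(t)\ge(\tfrac38+\epsilon)q$ and $\sum_{t\in\mathbb{Z}/q\mathbb{Z}}w_B(t)\ge(\tfrac38+\epsilon)q$, then $$\sum_{t\in\mathbb{Z}/q\mathbb{Z}}(w_A*w_B)(t)\,f_q(t)\ \ge\ c(\epsilon)\,q.$$
   Context: For $f,g:\mathbb{Z}/q\mathbb{Z}\to\mathbb{C}$, the convolution is $(f*g)(x):=\frac1q\sum_{a\in\mathbb{Z}/q\mathbb{Z}}f(a)g(x-a)$. The function $f_q:\mathbb{Z}/q\mathbb{Z}\to\mathbb{R}$ is $f_q(t):=\#\{x\in\mathbb{Z}/q\mathbb{Z}:x^2=t\}$. -}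

module Defs where

open import Data.Nat as ℕ using (ℕ; zero; suc; NonZero)
import Data.Nat.Properties as ℕ
import Data.Nat.Tactic.RingSolver as ℕ-Ring
open import Data.Nat.DivMod using (_mod_)
open import Data.Integer as ℤ using (+_)
import Data.Integer.Properties as ℤ
open import Data.Rational as ℚ using (ℚ; mkℚ; 0ℚ; 1ℚ; _/_; ∣_∣; *<*; *≤*)
import Data.Rational.Properties as ℚ
import Data.Rational.Unnormalised as ℚᵘ
import Data.Rational.Unnormalised.Properties as ℚᵘ
open import Data.Rational.Solver using (module +-*-Solver)
open import Data.Fin as Fin using (Fin; toℕ)
open import Data.List using (length; filter; allFin)
open import Data.Vec.Functional using (foldr)
open import Data.Product using (∃; _×_; _,_; proj₁; proj₂)
open import Data.Sum using (inj₁; inj₂)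
open import Relation.Nullary using (yes; no)
open import Relation.Binary.PropositionalEquality using (_≡_; refl; sym; trans; cong; cong₂; subst; subst₂)

private
  abs-≤ : ∀ {p r} → p ℚ.≤ r → ℚ.- p ℚ.≤ r → ∣ p ∣ ℚ.≤ r
  abs-≤ {p} a b with ℚ.∣p∣≡p∨∣p∣≡-p p
  ... | inj₁ e = subst (ℚ._≤ _) (sym e) a
  ... | inj₂ e = subst (ℚ._≤ _) (sym e) b

  *-mono : ∀ {a b c d} → 0ℚ ℚ.≤ b → 0ℚ ℚ.≤ c → a ℚ.≤ c → b ℚ.≤ d → a ℚ.* b ℚ.≤ c ℚ.* d
  *-mono {a} {b} {c} {d} 0≤b 0≤c a≤c b≤d = ℚ.≤-trans
    (ℚ.*-monoʳ-≤-nonNeg b {{ℚ.nonNegative 0≤b}} a≤c)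
    (ℚ.*-monoˡ-≤-nonNeg c {{ℚ.nonNegative 0≤c}} b≤d)

  abs-* : ∀ {p q P Q} → ∣ p ∣ ℚ.≤ P → ∣ q ∣ ℚ.≤ Q → ∣ p ℚ.* q ∣ ℚ.≤ P ℚ.* Q
  abs-* {p} {q} {P} a b = subst (ℚ._≤ _) (sym (ℚ.∣p*q∣≡∣p∣*∣q∣ p q))
    (*-mono (ℚ.0≤∣p∣ q) (ℚ.≤-trans (ℚ.0≤∣p∣ p) a) a b)

  abs-+ : ∀ {p q P Q} → ∣ p ∣ ℚ.≤ P → ∣ q ∣ ℚ.≤ Q → ∣ p ℚ.+ q ∣ ℚ.≤ P ℚ.+ Q
  abs-+ {p} {q} a b = ℚ.≤-trans (ℚ.∣p+q∣≤∣p∣+∣q∣ p q) (ℚ.+-mono-≤ a b)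

  *-pos : ∀ {p q} → 0ℚ ℚ.< p → 0ℚ ℚ.< q → 0ℚ ℚ.< p ℚ.* q
  *-pos {p} {q} a b = ℚ.positive⁻¹ (p ℚ.* q)
    {{ℚ.pos*pos⇒pos p {{ℚ.positive a}} q {{ℚ.positive b}}}}

  0<1 : 0ℚ ℚ.< 1ℚ
  0<1 = *<* (ℤ.+<+ (ℕ.s≤s ℕ.z≤n))

  0<½ : 0ℚ ℚ.< ℚ.½
  0<½ = *<* (ℤ.+<+ (ℕ.s≤s ℕ.z≤n))

inv : (p : ℚ) → 0ℚ ℚ.< p → ℚ
inv p 0<p = ℚ.1/_ p {{ℚ.>-nonZero 0<p}}

inv-pos : ∀ p (0<p : 0ℚ ℚ.< p) → 0ℚ ℚ.< inv p 0<p
inv-pos p 0<p = ℚ.positive⁻¹ _ {{ℚ.1/pos⇒pos p {{ℚ.positive 0<p}}}}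

inv-inverse : ∀ p (0<p : 0ℚ ℚ.< p) → p ℚ.* inv p 0<p ≡ 1ℚ
inv-inverse p 0<p = ℚ.*-inverseʳ p {{ℚ.>-nonZero 0<p}}

-- Cauchy sequences of rationals. The convergence rate is part of the data, as
-- `∃` is a Σ-type; the equality of reals is `_≃_` below, not `_≡_`.

IsCauchy : (ℕ → ℚ) → Set
IsCauchy x = ∀ δ → 0ℚ ℚ.< δ → ∃ λ N → ∀ m n → N ℕ.≤ m → N ℕ.≤ n → ∣ x m ℚ.- x n ∣ ℚ.≤ δ

record ℝ : Set where
  constructor mkℝ
  field
    seq      : ℕ → ℚ
    isCauchy : IsCauchy seq
open ℝ public

infix 4 _≤_ _<_ _≃_

_≤_ : ℝ → ℝ → Set
x ≤ y = ∀ δ → 0ℚ ℚ.< δ → ∃ λ N → ∀ n → N ℕ.≤ n → seq x n ℚ.≤ seq y n ℚ.+ δ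

_<_ : ℝ → ℝ → Set
x < y = ∃ λ δ → 0ℚ ℚ.< δ × ∃ λ N → ∀ n → N ℕ.≤ n → seq x n ℚ.+ δ ℚ.≤ seq y n

_≃_ : ℝ → ℝ → Set
x ≃ y = x ≤ y × y ≤ x

fromℚ : ℚ → ℝ
fromℚ p = mkℝ (λ _ → p) λ δ 0<δ → 0 , λ _ _ _ _ →
  subst (ℚ._≤ δ) (sym (cong ∣_∣ (ℚ.+-inverseʳ p))) (ℚ.<⇒≤ 0<δ)

fromℕ : ℕ → ℝ
fromℕ n = fromℚ (+ n / 1)

0ℝ 1ℝ : ℝ
0ℝ = fromℕ 0
1ℝ = fromℕ 1

private
  +-cauchy : ∀ x y → IsCauchy (λ n → seq x n ℚ.+ seq y n)
  +-cauchy x y δ 0<δ = Nx ℕ.⊔ Ny , λ m n N≤m N≤n →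
    subst₂ (λ a b → ∣ a ∣ ℚ.≤ b) (rearrange (seq x m) (seq x n) (seq y m) (seq y n)) halves
      (abs-+ (hx m n (ℕ.m⊔n≤o⇒m≤o Nx Ny N≤m) (ℕ.m⊔n≤o⇒m≤o Nx Ny N≤n))
             (hy m n (ℕ.m⊔n≤o⇒n≤o Nx Ny N≤m) (ℕ.m⊔n≤o⇒n≤o Nx Ny N≤n)))
    where
    h = ℚ.½ ℚ.* δ
    0<h = *-pos 0<½ 0<δ
    Nx = proj₁ (isCauchy x h 0<h)
    hx = proj₂ (isCauchy x h 0<h)
    Ny = proj₁ (isCauchy y h 0<h)
    hy = proj₂ (isCauchy y h 0<h)
    open +-*-Solver
    rearrange : ∀ a b c d → (a ℚ.- b) ℚ.+ (c ℚ.- d) ≡ (a ℚ.+ c) ℚ.- (b ℚ.+ d)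
    rearrange = solve 4 (λ a b c d → (a :- b) :+ (c :- d) := (a :+ c) :- (b :+ d)) refl
    halves : h ℚ.+ h ≡ δ
    halves = trans (sym (ℚ.*-distribʳ-+ δ ℚ.½ ℚ.½)) (ℚ.*-identityˡ δ)

  bounded : ∀ x → ∃ λ B → 0ℚ ℚ.< B × ∃ λ N → ∀ n → N ℕ.≤ n → ∣ seq x n ∣ ℚ.≤ B
  bounded x with isCauchy x 1ℚ 0<1
  ... | N , h = 1ℚ ℚ.+ ∣ seq x N ∣
    , ℚ.+-mono-<-≤ 0<1 (ℚ.0≤∣p∣ (seq x N))
    , N , λ n N≤n → subst (λ a → ∣ a ∣ ℚ.≤ 1ℚ ℚ.+ ∣ seq x N ∣) (cancel (seq x n) (seq x N))
        (abs-+ (h n N N≤n ℕ.≤-refl) ℚ.≤-refl)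
    where
    open +-*-Solver
    cancel : ∀ a b → (a ℚ.- b) ℚ.+ b ≡ a
    cancel = solve 2 (λ a b → (a :- b) :+ b := a) refl

  mul-diff : ∀ {X Y e} a b c d → ∣ a ∣ ℚ.≤ X → ∣ d ∣ ℚ.≤ Y → ∣ a ℚ.- b ∣ ℚ.≤ e → ∣ c ℚ.- d ∣ ℚ.≤ e →
    ∣ a ℚ.* c ℚ.- b ℚ.* d ∣ ℚ.≤ X ℚ.* e ℚ.+ e ℚ.* Y
  mul-diff {X} {Y} {e} a b c d a≤X d≤Y ab≤e cd≤e =
    subst (λ u → ∣ u ∣ ℚ.≤ X ℚ.* e ℚ.+ e ℚ.* Y) (rearrange a b c d)
      (abs-+ (abs-* a≤X cd≤e) (abs-* ab≤e d≤Y))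
    where
    open +-*-Solver
    rearrange : ∀ a b c d → a ℚ.* (c ℚ.- d) ℚ.+ (a ℚ.- b) ℚ.* d ≡ a ℚ.* c ℚ.- b ℚ.* d
    rearrange = solve 4 (λ a b c d → a :* (c :- d) :+ (a :- b) :* d := a :* c :- b :* d) refl

  share : ∀ X Y δ → 0ℚ ℚ.< X → 0ℚ ℚ.< Y → 0ℚ ℚ.< δ → ∃ λ e → 0ℚ ℚ.< e × X ℚ.* e ℚ.+ e ℚ.* Y ≡ δ
  share X Y δ 0<X 0<Y 0<δ = δ ℚ.* i , *-pos 0<δ (inv-pos (X ℚ.+ Y) 0<X+Y) ,
    trans (collect X Y δ i)
      (trans (cong (δ ℚ.*_) (inv-inverse (X ℚ.+ Y) 0<X+Y)) (ℚ.*-identityʳ δ))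
    where
    open +-*-Solver
    0<X+Y : 0ℚ ℚ.< X ℚ.+ Y
    0<X+Y = ℚ.+-mono-< 0<X 0<Y
    i = inv (X ℚ.+ Y) 0<X+Y
    collect : ∀ X Y δ i → X ℚ.* (δ ℚ.* i) ℚ.+ (δ ℚ.* i) ℚ.* Y ≡ δ ℚ.* ((X ℚ.+ Y) ℚ.* i)
    collect = solve 4 (λ X Y δ i → X :* (δ :* i) :+ (δ :* i) :* Y := δ :* ((X :+ Y) :* i)) refl

  *-cauchy : ∀ x y → IsCauchy (λ n → seq x n ℚ.* seq y n)
  *-cauchy x y δ 0<δ =
    let X , 0<X , bx = bounded x
        Y , 0<Y , by = bounded y
        e , 0<e , total = share X Y δ 0<X 0<Y 0<δ
    in go X Y e total bx by (isCauchy x e 0<e) (isCauchy y e 0<e)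
    where
    go : ∀ X Y e → X ℚ.* e ℚ.+ e ℚ.* Y ≡ δ →
      (∃ λ N → ∀ n → N ℕ.≤ n → ∣ seq x n ∣ ℚ.≤ X) →
      (∃ λ N → ∀ n → N ℕ.≤ n → ∣ seq y n ∣ ℚ.≤ Y) →
      (∃ λ N → ∀ m n → N ℕ.≤ m → N ℕ.≤ n → ∣ seq x m ℚ.- seq x n ∣ ℚ.≤ e) →
      (∃ λ N → ∀ m n → N ℕ.≤ m → N ℕ.≤ n → ∣ seq y m ℚ.- seq y n ∣ ℚ.≤ e) →
      ∃ λ N → ∀ m n → N ℕ.≤ m → N ℕ.≤ n → ∣ seq x m ℚ.* seq y m ℚ.- seq x n ℚ.* seq y n ∣ ℚ.≤ δ
    go X Y e total (Bx , bx) (By , by) (Nx , hx) (Ny , hy) = B ℕ.⊔ M , λ m n N≤m N≤n →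
      subst (∣ seq x m ℚ.* seq y m ℚ.- seq x n ℚ.* seq y n ∣ ℚ.≤_) total
        (mul-diff {X} {Y} {e} (seq x m) (seq x n) (seq y m) (seq y n)
          (bx m (ℕ.m⊔n≤o⇒m≤o Bx By (ℕ.m⊔n≤o⇒m≤o B M N≤m)))
          (by n (ℕ.m⊔n≤o⇒n≤o Bx By (ℕ.m⊔n≤o⇒m≤o B M N≤n)))
          (hx m n (ℕ.m⊔n≤o⇒m≤o Nx Ny (ℕ.m⊔n≤o⇒n≤o B M N≤m))
                  (ℕ.m⊔n≤o⇒m≤o Nx Ny (ℕ.m⊔n≤o⇒n≤o B M N≤n)))
          (hy m n (ℕ.m⊔n≤o⇒n≤o Nx Ny (ℕ.m⊔n≤o⇒n≤o B M N≤m))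
                  (ℕ.m⊔n≤o⇒n≤o Nx Ny (ℕ.m⊔n≤o⇒n≤o B M N≤n))))
      where
      B = Bx ℕ.⊔ By
      M = Nx ℕ.⊔ Ny

infixl 6 _+_
infixl 7 _*_

_+_ : ℝ → ℝ → ℝ
x + y = mkℝ (λ n → seq x n ℚ.+ seq y n) (+-cauchy x y)

_*_ : ℝ → ℝ → ℝ
x * y = mkℝ (λ n → seq x n ℚ.* seq y n) (*-cauchy x y)

0<⊔ : ∀ p {δ} → 0ℚ ℚ.< δ → 0ℚ ℚ.< p ℚ.⊔ δ
0<⊔ p {δ} 0<δ = ℚ.<-≤-trans 0<δ (ℚ.p≤q⊔p p δ)

private
  recip-cauchy : ∀ x (0<x : 0ℝ < x) → IsCauchy (λ n → inv (seq x n ℚ.⊔ proj₁ 0<x) (0<⊔ (seq x n) (proj₁ (proj₂ 0<x))))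
  recip-cauchy x (δ , 0<δ , K , x≥δ) η 0<η = K ℕ.⊔ M , bound
    where
    d = inv δ 0<δ
    e = η ℚ.* (δ ℚ.* δ)
    0<e = *-pos 0<η (*-pos 0<δ 0<δ)
    M = proj₁ (isCauchy x e 0<e)
    hx = proj₂ (isCauchy x e 0<e)
    open +-*-Solver
    a : ℕ → ℚ
    a n = seq x n ℚ.⊔ δ
    i : ℕ → ℚ
    i n = inv (a n) (0<⊔ (seq x n) 0<δ)
    0<i : ∀ n → 0ℚ ℚ.< i n
    0<i n = inv-pos (a n) (0<⊔ (seq x n) 0<δ)
    a*i : ∀ n → a n ℚ.* i n ≡ 1ℚ
    a*i n = inv-inverse (a n) (0<⊔ (seq x n) 0<δ)
    i≤d : ∀ n → ∣ i n ∣ ℚ.≤ d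
    i≤d n = subst (ℚ._≤ d) (sym (ℚ.0≤p⇒∣p∣≡p (ℚ.<⇒≤ (0<i n))))
      (subst₂ ℚ._≤_
        (trans (cong (ℚ._* i n) (inv-inverse δ 0<δ)) (ℚ.*-identityˡ (i n)))
        (trans (swap (a n) d (i n)) (trans (cong (ℚ._* d) (a*i n)) (ℚ.*-identityˡ d)))
        (ℚ.*-monoʳ-≤-nonNeg (i n) {{ℚ.nonNegative (ℚ.<⇒≤ (0<i n))}}
          (ℚ.*-monoʳ-≤-nonNeg d {{ℚ.nonNegative (ℚ.<⇒≤ (inv-pos δ 0<δ))}} (ℚ.p≤q⊔p (seq x n) δ))))
      where
      swap : ∀ a d i → a ℚ.* d ℚ.* i ≡ a ℚ.* i ℚ.* d
      swap = solve 3 (λ a d i → a :* d :* i := a :* i :* d) refl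
    a≡x : ∀ n → K ℕ.≤ n → seq x n ≡ a n
    a≡x n K≤n = sym (ℚ.p≥q⇒p⊔q≡p (subst (ℚ._≤ seq x n) (ℚ.+-identityˡ δ) (x≥δ n K≤n)))
    diff : ∀ m n → (a n ℚ.- a m) ℚ.* (i m ℚ.* i n) ≡ i m ℚ.- i n
    diff m n = trans (expand (a m) (a n) (i m) (i n))
      (cong₂ ℚ._-_ (trans (cong (ℚ._* i m) (a*i n)) (ℚ.*-identityˡ (i m)))
                   (trans (cong (ℚ._* i n) (a*i m)) (ℚ.*-identityˡ (i n))))
      where
      expand : ∀ a b i j → (b ℚ.- a) ℚ.* (i ℚ.* j) ≡ b ℚ.* j ℚ.* i ℚ.- a ℚ.* i ℚ.* j
      expand = solve 4 (λ a b i j → (b :- a) :* (i :* j) := b :* j :* i :- a :* i :* j) refl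
    total : e ℚ.* (d ℚ.* d) ≡ η
    total = trans (regroup η δ d)
      (trans (cong₂ (λ u v → η ℚ.* (u ℚ.* v)) (inv-inverse δ 0<δ) (inv-inverse δ 0<δ)) (ℚ.*-identityʳ η))
      where
      regroup : ∀ η δ d → η ℚ.* (δ ℚ.* δ) ℚ.* (d ℚ.* d) ≡ η ℚ.* (δ ℚ.* d ℚ.* (δ ℚ.* d))
      regroup = solve 3 (λ η δ d → η :* (δ :* δ) :* (d :* d) := η :* (δ :* d :* (δ :* d))) refl
    bound : ∀ m n → K ℕ.⊔ M ℕ.≤ m → K ℕ.⊔ M ℕ.≤ n → ∣ i m ℚ.- i n ∣ ℚ.≤ η
    bound m n N≤m N≤n = subst₂ (λ u v → ∣ u ∣ ℚ.≤ v) (diff m n) total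
      (abs-* (subst₂ (λ u v → ∣ u ℚ.- v ∣ ℚ.≤ e)
                (a≡x n (ℕ.m⊔n≤o⇒m≤o K M N≤n)) (a≡x m (ℕ.m⊔n≤o⇒m≤o K M N≤m))
                (hx n m (ℕ.m⊔n≤o⇒n≤o K M N≤n) (ℕ.m⊔n≤o⇒n≤o K M N≤m)))
             (abs-* (i≤d m) (i≤d n)))

-- The rational δ > 0 supplied by `0 < x` bounds all but finitely many terms of x
-- from below, so the truncation by δ changes only finitely many terms.

recip : (x : ℝ) → 0ℝ < x → ℝ
recip x 0<x = mkℝ (λ n → inv (seq x n ℚ.⊔ proj₁ 0<x) (0<⊔ (seq x n) (proj₁ (proj₂ 0<x))))
                  (recip-cauchy x 0<x)

recip-inverse : ∀ x (0<x : 0ℝ < x) → x * recip x 0<x ≃ 1ℝ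
recip-inverse x 0<x@(δ , 0<δ , K , x≥δ) =
    (λ η 0<η → K , λ n K≤n → subst (ℚ._≤ 1ℚ ℚ.+ η) (sym (eq n K≤n)) (grow 0<η))
  , (λ η 0<η → K , λ n K≤n → subst (λ u → 1ℚ ℚ.≤ u ℚ.+ η) (sym (eq n K≤n)) (grow 0<η))
  where
  grow : ∀ {η} → 0ℚ ℚ.< η → 1ℚ ℚ.≤ 1ℚ ℚ.+ η
  grow 0<η = ℚ.+-monoʳ-≤ 1ℚ (ℚ.<⇒≤ 0<η)
  eq : ∀ n → K ℕ.≤ n → seq x n ℚ.* seq (recip x 0<x) n ≡ 1ℚ
  eq n K≤n = trans
    (cong (ℚ._* seq (recip x 0<x) n)
      (sym (ℚ.p≥q⇒p⊔q≡p (subst (ℚ._≤ seq x n) (ℚ.+-identityˡ δ) (x≥δ n K≤n)))))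
    (inv-inverse (seq x n ℚ.⊔ δ) (0<⊔ (seq x n) 0<δ))

⌊√_⌋ : ℕ → ℕ
⌊√ zero ⌋ = 0
⌊√ suc n ⌋ with suc ⌊√ n ⌋ ℕ.* suc ⌊√ n ⌋ ℕ.≤? suc n
... | yes _ = suc ⌊√ n ⌋
... | no  _ = ⌊√ n ⌋

⌊√⌋-lower : ∀ n → ⌊√ n ⌋ ℕ.* ⌊√ n ⌋ ℕ.≤ n
⌊√⌋-lower zero = ℕ.z≤n
⌊√⌋-lower (suc n) with suc ⌊√ n ⌋ ℕ.* suc ⌊√ n ⌋ ℕ.≤? suc n
... | yes p = p
... | no  _ = ℕ.m≤n⇒m≤1+n (⌊√⌋-lower n)

private
  square-mono-< : ∀ k → k ℕ.* k ℕ.< suc k ℕ.* suc k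
  square-mono-< k = ℕ.*-mono-< {k} {suc k} {k} {suc k} (ℕ.n<1+n k) (ℕ.n<1+n k)

⌊√⌋-upper : ∀ n → n ℕ.< suc ⌊√ n ⌋ ℕ.* suc ⌊√ n ⌋
⌊√⌋-upper zero = ℕ.s≤s ℕ.z≤n
⌊√⌋-upper (suc n) with suc ⌊√ n ⌋ ℕ.* suc ⌊√ n ⌋ ℕ.≤? suc n
... | yes _ = ℕ.≤-<-trans (⌊√⌋-upper n) (square-mono-< (suc ⌊√ n ⌋))
... | no ¬p = ℕ.≰⇒> ¬p

private
  frac-≤ : ∀ a b c d → a ℕ.* suc d ℕ.≤ c ℕ.* suc b → + a / suc b ℚ.≤ + c / suc d
  frac-≤ a b c d h = ℚ.toℚᵘ-cancel-≤
    (ℚᵘ.≤-respˡ-≃ (ℚᵘ.≃-sym (ℚ.toℚᵘ-fromℚᵘ (ℚᵘ.mkℚᵘ (+ a) b)))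
      (ℚᵘ.≤-respʳ-≃ (ℚᵘ.≃-sym (ℚ.toℚᵘ-fromℚᵘ (ℚᵘ.mkℚᵘ (+ c) d)))
        (ℚᵘ.*≤* (subst₂ ℤ._≤_ (ℤ.pos-* a (suc d)) (ℤ.pos-* c (suc b)) (ℤ.+≤+ h)))))

  frac-+ : ∀ a c d → + (a ℕ.+ c) / suc d ≡ + a / suc d ℚ.+ + c / suc d
  frac-+ a c d = ℚ.toℚᵘ-injective
    (ℚᵘ.≃-trans (ℚ.toℚᵘ-fromℚᵘ (ℚᵘ.mkℚᵘ (+ (a ℕ.+ c)) d))
    (ℚᵘ.≃-trans (ℚᵘ.*≡* eq)
    (ℚᵘ.≃-sym (ℚᵘ.≃-trans (ℚ.toℚᵘ-homo-+ (+ a / suc d) (+ c / suc d))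
      (ℚᵘ.+-cong (ℚ.toℚᵘ-fromℚᵘ (ℚᵘ.mkℚᵘ (+ a) d)) (ℚ.toℚᵘ-fromℚᵘ (ℚᵘ.mkℚᵘ (+ c) d)))))))
    where
    D = suc d
    arith : ∀ a c D → (a ℕ.+ c) ℕ.* (D ℕ.* D) ≡ (a ℕ.* D ℕ.+ c ℕ.* D) ℕ.* D
    arith = ℕ-Ring.solve-∀
    eq : + (a ℕ.+ c) ℤ.* + (D ℕ.* D) ≡ (+ a ℤ.* + D ℤ.+ + c ℤ.* + D) ℤ.* + D
    eq = trans (sym (ℤ.pos-* (a ℕ.+ c) (D ℕ.* D)))
      (trans (cong +_ (arith a c D))
      (trans (ℤ.pos-* (a ℕ.* D ℕ.+ c ℕ.* D) D)
        (cong (ℤ._* + D) (trans (ℤ.pos-+ (a ℕ.* D) (c ℕ.* D)) (cong₂ ℤ._+_ (ℤ.pos-* a D) (ℤ.pos-* c D))))))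

  frac-* : ∀ a b c d → + (a ℕ.* c) / (suc b ℕ.* suc d) ≡ (+ a / suc b) ℚ.* (+ c / suc d)
  frac-* a b c d = ℚ.toℚᵘ-injective
    (ℚᵘ.≃-trans (ℚ.toℚᵘ-fromℚᵘ (ℚᵘ.mkℚᵘ (+ (a ℕ.* c)) (d ℕ.+ b ℕ.* suc d)))
    (ℚᵘ.≃-trans (ℚᵘ.*≡* (cong (ℤ._* + (suc b ℕ.* suc d)) (ℤ.pos-* a c)))
    (ℚᵘ.≃-sym (ℚᵘ.≃-trans (ℚ.toℚᵘ-homo-* (+ a / suc b) (+ c / suc d))
      (ℚᵘ.*-cong (ℚ.toℚᵘ-fromℚᵘ (ℚᵘ.mkℚᵘ (+ a) b)) (ℚ.toℚᵘ-fromℚᵘ (ℚᵘ.mkℚᵘ (+ c) d)))))))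

  archimedean : ∀ c δ → 0ℚ ℚ.< δ → ∃ λ N → ∀ n → N ℕ.≤ n → + c / suc n ℚ.≤ δ
  archimedean c (mkℚ (+ zero) _ _) (*<* (ℤ.+<+ ()))
  archimedean c δ@(mkℚ (+ suc p) d _) _ = c ℕ.* suc d , λ n N≤n →
    subst (+ c / suc n ℚ.≤_) (ℚ.↥p/↧p≡p δ)
      (frac-≤ c n (suc p) d (ℕ.≤-trans N≤n (ℕ.≤-trans (ℕ.n≤1+n n) (ℕ.m≤m+n (suc n) (p ℕ.* suc n)))))

  sqrt-num : ℕ → ℕ → ℕ
  sqrt-num a n = ⌊√ a ℕ.* (suc n ℕ.* suc n) ⌋

  *-self-cancel-< : ∀ a b → a ℕ.* a ℕ.< b ℕ.* b → a ℕ.< b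
  *-self-cancel-< a b h with a ℕ.<? b
  ... | yes p = p
  ... | no ¬p with () ← ℕ.<⇒≱ h (ℕ.*-mono-≤ (ℕ.≮⇒≥ ¬p) (ℕ.≮⇒≥ ¬p))

  cross : ∀ a m n → sqrt-num a m ℕ.* suc n ℕ.< suc (sqrt-num a n) ℕ.* suc m
  cross a m n = *-self-cancel-< _ _ (begin-strict
    k ℕ.* N ℕ.* (k ℕ.* N)           ≡⟨ sq-* k N ⟩
    k ℕ.* k ℕ.* (N ℕ.* N)           ≤⟨ ℕ.*-monoˡ-≤ (N ℕ.* N) (⌊√⌋-lower (a ℕ.* (M ℕ.* M))) ⟩
    a ℕ.* (M ℕ.* M) ℕ.* (N ℕ.* N)   ≡⟨ swap a (M ℕ.* M) (N ℕ.* N) ⟩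
    a ℕ.* (N ℕ.* N) ℕ.* (M ℕ.* M)   <⟨ ℕ.*-monoˡ-< (M ℕ.* M) (⌊√⌋-upper (a ℕ.* (N ℕ.* N))) ⟩
    l ℕ.* l ℕ.* (M ℕ.* M)           ≡⟨ sym (sq-* l M) ⟩
    l ℕ.* M ℕ.* (l ℕ.* M)           ∎)
    where
    open ℕ.≤-Reasoning
    M = suc m
    N = suc n
    k = sqrt-num a m
    l = suc (sqrt-num a n)
    sq-* : ∀ k N → k ℕ.* N ℕ.* (k ℕ.* N) ≡ k ℕ.* k ℕ.* (N ℕ.* N)
    sq-* = ℕ-Ring.solve-∀
    swap : ∀ a b c → a ℕ.* b ℕ.* c ≡ a ℕ.* c ℕ.* b
    swap = ℕ-Ring.solve-∀

  sqrt-cauchy : ∀ a → IsCauchy (λ n → + sqrt-num a n / suc n)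
  sqrt-cauchy a δ 0<δ = N , λ m n N≤m N≤n → abs-≤ (half m n N≤n)
                  (subst (ℚ._≤ δ) (flip (s n) (s m)) (half n m N≤m))
    where
    N = proj₁ (archimedean 1 δ 0<δ)
    h = proj₂ (archimedean 1 δ 0<δ)
    s : ℕ → ℚ
    s n = + sqrt-num a n / suc n
    open +-*-Solver
    flip : ∀ p q → p ℚ.- q ≡ ℚ.- (q ℚ.- p)
    flip = solve 2 (λ p q → p :- q := :- (q :- p)) refl
    drop : ∀ p q → p ℚ.+ q ℚ.- q ≡ p
    drop = solve 2 (λ p q → p :+ q :- q := p) refl
    half : ∀ m n → N ℕ.≤ n → s m ℚ.- s n ℚ.≤ δ
    half m n N≤n = ℚ.≤-trans
      (ℚ.+-monoˡ-≤ (ℚ.- s n) (subst (s m ℚ.≤_) (frac-+ 1 (sqrt-num a n) n)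
        (frac-≤ (sqrt-num a m) m (suc (sqrt-num a n)) n (ℕ.<⇒≤ (cross a m n)))))
      (subst (ℚ._≤ δ) (sym (drop (+ 1 / suc n) (s n))) (h n N≤n))

√_ : ℕ → ℝ
√ a = mkℝ (λ n → + ⌊√ a ℕ.* (suc n ℕ.* suc n) ⌋ / suc n) (sqrt-cauchy a)

√-pos : ∀ a .{{_ : NonZero a}} → 0ℝ < √ a
√-pos a = 1ℚ , 0<1 , 0 , λ n _ →
  frac-≤ 1 0 (sqrt-num a n) n
    (subst₂ ℕ._≤_ (sym (ℕ.*-identityˡ (suc n))) (sym (ℕ.*-identityʳ _)) (ℕ.s≤s⁻¹ (root n)))
  where
  root : ∀ n → suc n ℕ.< suc (sqrt-num a n)
  root n = *-self-cancel-< (suc n) (suc (sqrt-num a n))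
    (ℕ.≤-<-trans (ℕ.m≤n*m (suc n ℕ.* suc n) a) (⌊√⌋-upper (a ℕ.* (suc n ℕ.* suc n))))

√-square : ∀ a → √ a * √ a ≃ fromℕ a
√-square a = below , above
  where
  k : ℕ → ℕ
  k = sqrt-num a
  below : √ a * √ a ≤ fromℕ a
  below δ 0<δ = 0 , λ n _ → ℚ.≤-trans
    (subst (ℚ._≤ + a / 1) (frac-* (k n) n (k n) n)
      (frac-≤ (k n ℕ.* k n) (n ℕ.+ n ℕ.* suc n) a 0
        (subst (ℕ._≤ a ℕ.* (suc n ℕ.* suc n)) (sym (ℕ.*-identityʳ _)) (⌊√⌋-lower (a ℕ.* (suc n ℕ.* suc n))))))
    (subst (ℚ._≤ + a / 1 ℚ.+ δ) (ℚ.+-identityʳ (+ a / 1)) (ℚ.+-monoʳ-≤ (+ a / 1) (ℚ.<⇒≤ 0<δ)))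
  k≤ : ∀ n → k n ℕ.≤ a ℕ.* suc n
  k≤ n = ℕ.s≤s⁻¹ (*-self-cancel-< (k n) (suc (a ℕ.* suc n)) (begin-strict
    k n ℕ.* k n                               ≤⟨ ⌊√⌋-lower (a ℕ.* (suc n ℕ.* suc n)) ⟩
    a ℕ.* (suc n ℕ.* suc n)                   ≤⟨ scale a ⟩
    a ℕ.* a ℕ.* (suc n ℕ.* suc n)             ≡⟨ regroup a (suc n) ⟩
    a ℕ.* suc n ℕ.* (a ℕ.* suc n)             <⟨ square-mono-< (a ℕ.* suc n) ⟩
    suc (a ℕ.* suc n) ℕ.* suc (a ℕ.* suc n)   ∎))
    where
    open ℕ.≤-Reasoning
    scale : ∀ a → a ℕ.* (suc n ℕ.* suc n) ℕ.≤ a ℕ.* a ℕ.* (suc n ℕ.* suc n)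
    scale zero = ℕ.z≤n
    scale a@(suc _) = ℕ.*-monoˡ-≤ (suc n ℕ.* suc n) (ℕ.m≤m*n a a)
    regroup : ∀ a N → a ℕ.* a ℕ.* (N ℕ.* N) ≡ a ℕ.* N ℕ.* (a ℕ.* N)
    regroup = ℕ-Ring.solve-∀
  c = a ℕ.+ a
  gap : ∀ n → a ℕ.* (suc n ℕ.* suc n) ℕ.≤ k n ℕ.* k n ℕ.+ c ℕ.* suc n
  gap n = begin
    a ℕ.* (suc n ℕ.* suc n)                           ≤⟨ ℕ.s≤s⁻¹ (subst (a ℕ.* (suc n ℕ.* suc n) ℕ.<_) (expand (k n)) (⌊√⌋-upper _)) ⟩
    k n ℕ.* k n ℕ.+ (k n ℕ.+ k n)                     ≤⟨ ℕ.+-monoʳ-≤ (k n ℕ.* k n) (ℕ.+-mono-≤ (k≤ n) (k≤ n)) ⟩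
    k n ℕ.* k n ℕ.+ (a ℕ.* suc n ℕ.+ a ℕ.* suc n)     ≡⟨ cong (k n ℕ.* k n ℕ.+_) (sym (ℕ.*-distribʳ-+ (suc n) a a)) ⟩
    k n ℕ.* k n ℕ.+ c ℕ.* suc n                       ∎
    where
    open ℕ.≤-Reasoning
    expand : ∀ k → suc k ℕ.* suc k ≡ suc (k ℕ.* k ℕ.+ (k ℕ.+ k))
    expand = ℕ-Ring.solve-∀
  above : fromℕ a ≤ √ a * √ a
  above δ 0<δ = let N , h = archimedean c δ 0<δ in N , λ n N≤n → ℚ.≤-trans
    (frac-≤ a 0 (k n ℕ.* k n ℕ.+ c ℕ.* suc n) (n ℕ.+ n ℕ.* suc n)
      (subst (a ℕ.* (suc n ℕ.* suc n) ℕ.≤_) (sym (ℕ.*-identityʳ _)) (gap n)))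
    (subst (ℚ._≤ seq (√ a) n ℚ.* seq (√ a) n ℚ.+ δ)
      (sym (trans (frac-+ (k n ℕ.* k n) (c ℕ.* suc n) (n ℕ.+ n ℕ.* suc n))
             (cong (ℚ._+ + (c ℕ.* suc n) / (suc n ℕ.* suc n)) (frac-* (k n) n (k n) n))))
      (ℚ.+-monoʳ-≤ (seq (√ a) n ℚ.* seq (√ a) n)
        (ℚ.≤-trans (frac-≤ (c ℕ.* suc n) (n ℕ.+ n ℕ.* suc n) c n
                      (ℕ.≤-reflexive (ℕ.*-assoc c (suc n) (suc n))))
                   (h n N≤n))))

-- ℤ/qℤ as the residues 0, …, q-1.

ℤ/_ : ℕ → Set
ℤ/ q = Fin q

∑ : ∀ {q} → (ℤ/ q → ℝ) → ℝ
∑ = foldr _+_ 0ℝ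

module _ {q : ℕ} .{{_ : NonZero q}} where

  infixl 6 _⊖_

  _⊖_ : ℤ/ q → ℤ/ q → ℤ/ q
  x ⊖ a = (toℕ x ℕ.+ (q ℕ.∸ toℕ a)) mod q

  square : ℤ/ q → ℤ/ q
  square x = (toℕ x ℕ.* toℕ x) mod q

  infixl 7 _⋆_

  _⋆_ : (ℤ/ q → ℝ) → (ℤ/ q → ℝ) → ℤ/ q → ℝ
  (f ⋆ g) x = fromℚ (+ 1 / q) * ∑ λ a → f a * g (x ⊖ a)

squareRootCount : ∀ q .{{_ : NonZero q}} → ℤ/ q → ℝ
squareRootCount q t = fromℕ (length (filter (λ x → square x Fin.≟ t) (allFin q)))

c : ℝ → ℝ
c ε = ε * recip (√ 5) (√-pos 5)

{-# OPTIONS --safe #-}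
-- Put A n = wA (-n), B = wB, and let TB a be the mean of B (a + x²) over x, so that the sum in question is
-- q times the mean of A · TB; the claim is proved with ε/2 in place of ε/√5.
--
-- Write B = u + g with u the part of B that depends only on the class modulo 12. The mean of (Tg)² is the
-- mean over h of correlations of averages of g along progressions of step 2h. For four consecutive h these
-- averages are orthogonal, so Bessel's inequality gives 4 ‖Tg‖² ≤ ‖g‖².
--
-- After scaling both densities to exactly 3/8, completing the square pointwise in A and 2 TB leaves the
-- inequality  4 ‖Tu‖² - ‖u‖² ≤ 1/2 + mean of η²  for functions u : ℤ/12 → [0,1] of mean 3/8, where η is the
-- positive part of (mean of 2 Tu on the class modulo 4) - 1. It yields  2 E(A · TB) ≥ 3/8 - (E A² + E B²)/2,
-- and undoing the scaling turns this into E(A · TB) ≥ ε/2.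
module Submission where

open import Data.Nat as ℕ using (ℕ; zero; suc; NonZero)
import Data.Nat.Properties as ℕ
import Data.Nat.Tactic.RingSolver as ℕ-Ring
open import Data.Nat.DivMod using (_mod_; _%_; m%n<n; m<n⇒m%n≡m; [m+n]%n≡m%n; [m+kn]%n≡m%n; %-distribˡ-+; m%n%n≡m%n)
open import Data.Integer as ℤ using (+_)
import Data.Integer.Properties as ℤ
open import Data.Rational as ℚ using (ℚ; 0ℚ; 1ℚ; ½; _/_)
import Data.Rational.Properties as ℚ
import Data.Rational.Unnormalised as ℚᵘ
import Data.Rational.Unnormalised.Properties as ℚᵘ
open import Data.Rational.Solver using (module +-*-Solver)
open import Data.Bool using (true; false; if_then_else_)
open import Data.Fin as Fin using (Fin; toℕ)
import Data.Fin.Properties as Fin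
open import Data.List as List using (List; []; _∷_; length; filter; allFin)
open import Data.Product using (∃; _×_; _,_; proj₁; proj₂)
open import Data.Sum using (_⊎_; inj₁; inj₂; [_,_]′)
open import Data.Vec.Functional using (foldr)
open import Relation.Nullary using (yes; no; does)
open import Relation.Nullary.Decidable using (toWitness)
open import Relation.Binary.PropositionalEquality using (_≡_; refl; sym; trans; cong; cong₂; subst; subst₂; module ≡-Reasoning)
open +-*-Solver using (solve; _:+_; _:*_; _:-_; :-_; con; _:=_; Polynomial)

-- Completing the square costs 2 (TB)² and the budget on the side of B is B²/2, so Tg has to gain a
-- factor 4, which takes four orthogonal averages. Their steps 2h, 2h + 2, 2h + 4, 2h + 6 differ by
-- 2, 4 or 6, and 12 is the least common multiple of these differences.
--
-- The correction η is forced. If u is 1, 1/2, 0, 0 on the classes 0, 1, 2, 3 modulo 4, its mean is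
-- 3/8 and 4 ‖Tu‖² - ‖u‖² = 9/16 exceeds 1/2; the mean of η² is 1/16 there, so the inequality on
-- ℤ/12 holds with equality.
--
-- No gcd is ever taken: a function on ℤ/q is a function on ℕ with period q, and an average along
-- step s has both periods q and s. In this way u is a function on ℤ/12 for every q.
--
-- The inequalities live over ℚ. Representing sequences are compared index by index, where the
-- hypotheses hold only up to a small rational error; this is why the rational bound is stated for
-- weights in [0, M] with M near 1.

module RationalCorrelation where

  open import Data.Rational hiding (NonZero)
  open import Data.Rational.Properties hiding (_≟_)

  -- Ordered arithmetic of the rationals.

  2ℚ 3ℚ 4ℚ : ℚ
  2ℚ = + 2 / 1
  3ℚ = + 3 / 1
  4ℚ = + 4 / 1

  -- The form in which most polynomial inequalities below are certified: an explicit slack `d`,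
  -- visibly nonnegative, and a ring identity for the solver.
  ≤-by : ∀ {x y} d → 0ℚ ≤ d → x + d ≡ y → x ≤ y
  ≤-by {x} d 0≤d eq = subst₂ _≤_ (+-identityʳ x) eq (+-monoʳ-≤ x 0≤d)

  0≤-diff : ∀ {x y} → x ≤ y → 0ℚ ≤ y - x
  0≤-diff {x} {y} x≤y = subst (_≤ y - x) (+-inverseʳ x) (+-monoˡ-≤ (- x) x≤y)

  0≤-+ : ∀ {x y} → 0ℚ ≤ x → 0ℚ ≤ y → 0ℚ ≤ x + y
  0≤-+ = +-mono-≤

  0≤-* : ∀ {x y} → 0ℚ ≤ x → 0ℚ ≤ y → 0ℚ ≤ x * y
  0≤-* {x} {y} 0≤x 0≤y = subst (_≤ x * y) (*-zeroˡ y) (*-monoʳ-≤-nonNeg y {{nonNegative 0≤y}} 0≤x)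

  0≤-square : ∀ x → 0ℚ ≤ x * x
  0≤-square x with ≤-total 0ℚ x
  ... | inj₁ 0≤x = 0≤-* 0≤x 0≤x
  ... | inj₂ x≤0 = subst (0ℚ ≤_) (neg-square x) (0≤-* (neg-antimono-≤ x≤0) (neg-antimono-≤ x≤0))
    where
    neg-square : ∀ x → - x * - x ≡ x * x
    neg-square = solve 1 (λ x → :- x :* :- x := x :* x) refl

  suc/1 : ∀ n → + suc n / 1 ≡ 1ℚ + + n / 1
  suc/1 n = toℚᵘ-injective
    (ℚᵘ.≃-trans (toℚᵘ-fromℚᵘ (ℚᵘ.mkℚᵘ (+ suc n) 0))
    (ℚᵘ.≃-trans (ℚᵘ.*≡* (cong (ℤ._* + 1) (cong (ℤ._+_ (+ 1)) (sym (ℤ.*-identityʳ (+ n))))))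
    (ℚᵘ.≃-sym (ℚᵘ.≃-trans (toℚᵘ-homo-+ 1ℚ (+ n / 1))
      (ℚᵘ.+-congʳ ℚᵘ.1ℚᵘ (toℚᵘ-fromℚᵘ (ℚᵘ.mkℚᵘ (+ n) 0)))))))

  1/q*q : ∀ q .{{_ : NonZero q}} → + 1 / q * (+ q / 1) ≡ 1ℚ
  1/q*q (suc p) = toℚᵘ-injective
    (ℚᵘ.≃-trans (toℚᵘ-homo-* (+ 1 / suc p) (+ suc p / 1))
    (ℚᵘ.≃-trans (ℚᵘ.*-cong (toℚᵘ-fromℚᵘ (ℚᵘ.mkℚᵘ (+ 1) p)) (toℚᵘ-fromℚᵘ (ℚᵘ.mkℚᵘ (+ suc p) 0)))
    (ℚᵘ.*≡* (trans (ℤ.*-identityʳ _) (cong (ℤ._*_ (+ 1)) (sym (cong +_ (ℕ.*-identityʳ (suc p)))))))))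

  0≤1/ : ∀ q .{{_ : NonZero q}} → 0ℚ ≤ + 1 / q
  0≤1/ q = nonNegative⁻¹ (+ 1 / q) {{normalize-nonNeg 1 q}}

  0≤n/1 : ∀ n → 0ℚ ≤ + n / 1
  0≤n/1 n = nonNegative⁻¹ (+ n / 1) {{normalize-nonNeg n 1}}

  -- Finite sums, periodic functions and their means.

  sum : ℕ → (ℕ → ℚ) → ℚ
  sum zero    f = 0ℚ
  sum (suc n) f = f 0 + sum n (λ i → f (suc i))

  sum-cong : ∀ n {f g : ℕ → ℚ} → (∀ i → f i ≡ g i) → sum n f ≡ sum n g
  sum-cong zero    f≡g = refl
  sum-cong (suc n) f≡g = cong₂ _+_ (f≡g 0) (sum-cong n (λ i → f≡g (suc i)))

  sum-+ : ∀ n f g → sum n (λ i → f i + g i) ≡ sum n f + sum n g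
  sum-+ zero    f g = refl
  sum-+ (suc n) f g = trans (cong (λ s → f 0 + g 0 + s) (sum-+ n _ _)) (interchange (f 0) (g 0) _ _)
    where
    interchange : ∀ a b c d → a + b + (c + d) ≡ a + c + (b + d)
    interchange = solve 4 (λ a b c d → a :+ b :+ (c :+ d) := a :+ c :+ (b :+ d)) refl

  sum-* : ∀ n k f → sum n (λ i → k * f i) ≡ k * sum n f
  sum-* zero    k f = sym (*-zeroʳ k)
  sum-* (suc n) k f = trans (cong (λ s → k * f 0 + s) (sum-* n k _)) (sym (*-distribˡ-+ k _ _))

  sum-const : ∀ n k → sum n (λ _ → k) ≡ (+ n / 1) * k
  sum-const zero    k = sym (*-zeroˡ k)
  sum-const (suc n) k = begin
    k + sum n (λ _ → k)      ≡⟨ cong (λ s → k + s) (sum-const n k) ⟩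
    k + (+ n / 1) * k        ≡⟨ collect k (+ n / 1) ⟩
    (1ℚ + + n / 1) * k       ≡⟨ cong (_* k) (sym (suc/1 n)) ⟩
    (+ suc n / 1) * k        ∎
    where
    open ≡-Reasoning
    collect : ∀ k m → k + m * k ≡ (1ℚ + m) * k
    collect = solve 2 (λ k m → k :+ m :* k := (con 1ℚ :+ m) :* k) refl

  sum-mono : ∀ n {f g : ℕ → ℚ} → (∀ i → f i ≤ g i) → sum n f ≤ sum n g
  sum-mono zero    f≤g = ≤-refl
  sum-mono (suc n) f≤g = +-mono-≤ (f≤g 0) (sum-mono n (λ i → f≤g (suc i)))

  sum-snoc : ∀ n f → sum (suc n) f ≡ sum n f + f n
  sum-snoc zero    f = +-comm (f 0) 0ℚ
  sum-snoc (suc n) f = trans (cong (λ s → f 0 + s) (sum-snoc n _)) (sym (+-assoc (f 0) _ _))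

  sum-swap : ∀ m n (f : ℕ → ℕ → ℚ) → sum m (λ i → sum n (f i)) ≡ sum n (λ j → sum m (λ i → f i j))
  sum-swap zero    n f = sym (trans (sum-const n 0ℚ) (*-zeroʳ (+ n / 1)))
  sum-swap (suc m) n f = trans (cong (λ s → sum n (f 0) + s) (sum-swap m n _)) (sym (sum-+ n _ _))

  -- The indices `n ∸ i` run through n, ..., 1 and not n - 1, ..., 0; for a periodic `f` the shift
  -- by one is undone by `sum-rotate`.
  sum-reverse : ∀ n (f : ℕ → ℚ) → sum n (λ i → f (n ℕ.∸ i)) ≡ sum n (λ i → f (suc i))
  sum-reverse zero    f = refl
  sum-reverse (suc n) f = begin
    f (suc n) + sum n (λ i → f (n ℕ.∸ i))   ≡⟨ cong (λ s → f (suc n) + s) (sum-reverse n f) ⟩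
    f (suc n) + sum n (λ i → f (suc i))     ≡⟨ +-comm (f (suc n)) _ ⟩
    sum n (λ i → f (suc i)) + f (suc n)     ≡⟨ sym (sum-snoc n (λ i → f (suc i))) ⟩
    sum (suc n) (λ i → f (suc i))           ∎
    where open ≡-Reasoning

  -- One function may carry several periods at once, which stands in for periodicity modulo their
  -- gcd. Period 0 is allowed and says nothing; it occurs for h = 0 in the correlation of squares.
  Periodic : ℕ → (ℕ → ℚ) → Set
  Periodic p f = ∀ n → f (n ℕ.+ p) ≡ f n

  periodic-* : ∀ {p f} → Periodic p f → ∀ k n → f (n ℕ.+ k ℕ.* p) ≡ f n
  periodic-* {p} {f} per zero    n = cong f (ℕ.+-identityʳ n)
  periodic-* {p} {f} per (suc k) n =
    trans (cong f (sym (ℕ.+-assoc n p (k ℕ.* p)))) (trans (periodic-* {p} {f} per k (n ℕ.+ p)) (per n))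

  sum-rotate : ∀ n {f} → Periodic n f → sum n (λ i → f (suc i)) ≡ sum n f
  sum-rotate zero        per = refl
  sum-rotate (suc n) {f} per = trans (sum-snoc n (λ i → f (suc i)))
    (trans (cong (λ s → sum n (λ i → f (suc i)) + s) (per 0)) (+-comm _ (f 0)))

  mean : (q : ℕ) .{{_ : NonZero q}} → (ℕ → ℚ) → ℚ
  mean q f = + 1 / q * sum q f

  module _ (q : ℕ) .{{_ : NonZero q}} where

    mean-cong : ∀ {f g : ℕ → ℚ} → (∀ i → f i ≡ g i) → mean q f ≡ mean q g
    mean-cong f≡g = cong ((+ 1 / q) *_) (sum-cong q f≡g)

    mean-+ : ∀ f g → mean q (λ i → f i + g i) ≡ mean q f + mean q g
    mean-+ f g = trans (cong ((+ 1 / q) *_) (sum-+ q f g)) (*-distribˡ-+ (+ 1 / q) _ _)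

    mean-* : ∀ k f → mean q (λ i → k * f i) ≡ k * mean q f
    mean-* k f = trans (cong ((+ 1 / q) *_) (sum-* q k f)) (swap (+ 1 / q) k (sum q f))
      where
      swap : ∀ a b c → a * (b * c) ≡ b * (a * c)
      swap = solve 3 (λ a b c → a :* (b :* c) := b :* (a :* c)) refl

    mean-*ʳ : ∀ k f → mean q (λ i → f i * k) ≡ mean q f * k
    mean-*ʳ k f = trans (mean-cong (λ i → *-comm (f i) k)) (trans (mean-* k f) (*-comm k _))

    mean-const : ∀ k → mean q (λ _ → k) ≡ k
    mean-const k = begin
      + 1 / q * sum q (λ _ → k)       ≡⟨ cong ((+ 1 / q) *_) (sum-const q k) ⟩
      + 1 / q * ((+ q / 1) * k)       ≡⟨ sym (*-assoc (+ 1 / q) (+ q / 1) k) ⟩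
      + 1 / q * (+ q / 1) * k         ≡⟨ cong (_* k) (1/q*q q) ⟩
      1ℚ * k                          ≡⟨ *-identityˡ k ⟩
      k                               ∎
      where open ≡-Reasoning

    mean-mono : ∀ {f g : ℕ → ℚ} → (∀ i → f i ≤ g i) → mean q f ≤ mean q g
    mean-mono f≤g = *-monoˡ-≤-nonNeg (+ 1 / q) {{nonNegative (0≤1/ q)}} (sum-mono q f≤g)

    mean-nonNeg : ∀ {f : ℕ → ℚ} → (∀ i → 0ℚ ≤ f i) → 0ℚ ≤ mean q f
    mean-nonNeg {f} 0≤f = subst (_≤ mean q f) (mean-const 0ℚ) (mean-mono 0≤f)

    mean-shift : ∀ {f} → Periodic q f → ∀ s → mean q (λ i → f (i ℕ.+ s)) ≡ mean q f
    mean-shift {f} per zero    = mean-cong (λ i → cong f (ℕ.+-identityʳ i))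
    mean-shift {f} per (suc s) = trans (mean-cong (λ i → cong f (ℕ.+-suc i s)))
      (trans (cong ((+ 1 / q) *_) (sum-rotate q (λ n → trans (cong f (move n q s)) (per (n ℕ.+ s)))))
             (mean-shift per s))
      where
      move : ∀ n q s → n ℕ.+ q ℕ.+ s ≡ n ℕ.+ s ℕ.+ q
      move = ℕ-Ring.solve-∀

  mean-swap : ∀ p q .{{_ : NonZero p}} .{{_ : NonZero q}} (f : ℕ → ℕ → ℚ) →
    mean p (λ i → mean q (f i)) ≡ mean q (λ j → mean p (λ i → f i j))
  mean-swap p q f = begin
    + 1 / p * sum p (λ i → + 1 / q * sum q (f i))        ≡⟨ cong ((+ 1 / p) *_) (sum-* p (+ 1 / q) _) ⟩
    + 1 / p * (+ 1 / q * sum p (λ i → sum q (f i)))      ≡⟨ cong (λ s → + 1 / p * (+ 1 / q * s)) (sum-swap p q f) ⟩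
    + 1 / p * (+ 1 / q * sum q (λ j → sum p (λ i → f i j)))  ≡⟨ swap (+ 1 / p) (+ 1 / q) _ ⟩
    + 1 / q * (+ 1 / p * sum q (λ j → sum p (λ i → f i j)))  ≡⟨ cong ((+ 1 / q) *_) (sym (sum-* q (+ 1 / p) _)) ⟩
    + 1 / q * sum q (λ j → + 1 / p * sum p (λ i → f i j))  ∎
    where
    open ≡-Reasoning
    swap : ∀ a b c → a * (b * c) ≡ b * (a * c)
    swap = solve 3 (λ a b c → a :* (b :* c) := b :* (a :* c)) refl

  periodic-shift : ∀ {p} {f : ℕ → ℚ} → Periodic p f → ∀ s → Periodic p (λ n → f (n ℕ.+ s))
  periodic-shift {p} {f} per s n = trans (cong f (move n p s)) (per (n ℕ.+ s))
    where
    move : ∀ n p s → n ℕ.+ p ℕ.+ s ≡ n ℕ.+ s ℕ.+ p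
    move = ℕ-Ring.solve-∀

  periodic-multiple : ∀ {p} {f : ℕ → ℚ} → Periodic p f → ∀ c s → Periodic p (λ n → f (c ℕ.+ n ℕ.* s))
  periodic-multiple {p} {f} per c s n = trans (cong f (move c n p s)) (periodic-* {f = f} per s (c ℕ.+ n ℕ.* s))
    where
    move : ∀ c n p s → c ℕ.+ (n ℕ.+ p) ℕ.* s ≡ c ℕ.+ n ℕ.* s ℕ.+ s ℕ.* p
    move = ℕ-Ring.solve-∀

  periodic-square : ∀ {p} {f : ℕ → ℚ} → Periodic p f → ∀ c → Periodic p (λ n → f (c ℕ.+ n ℕ.* n))
  periodic-square {p} {f} per c n =
    trans (cong f (move c n p)) (periodic-* {f = f} per (2 ℕ.* n ℕ.+ p) (c ℕ.+ n ℕ.* n))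
    where
    move : ∀ c n p → c ℕ.+ (n ℕ.+ p) ℕ.* (n ℕ.+ p) ≡ c ℕ.+ n ℕ.* n ℕ.+ (2 ℕ.* n ℕ.+ p) ℕ.* p
    move = ℕ-Ring.solve-∀

  periodic-product : ∀ {p} {f g : ℕ → ℚ} → Periodic p f → Periodic p g → Periodic p (λ n → f n * g n)
  periodic-product per-f per-g n = cong₂ _*_ (per-f n) (per-g n)

  -- Averages along progressions and along squares.

  module Progressions (q : ℕ) .{{_ : NonZero q}} where

    𝔼 : (ℕ → ℚ) → ℚ
    𝔼 = mean q

    -- As `x` runs through a full period q, every element of the coset of the subgroup of ℤ/q
    -- generated by `s` is met equally often, whatever the order of `s`. For `s` = 0 this is `f`
    -- itself.
    progressionMean : ℕ → (ℕ → ℚ) → ℕ → ℚ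
    progressionMean s f c = 𝔼 λ x → f (c ℕ.+ x ℕ.* s)

    squareMean : (ℕ → ℚ) → ℕ → ℚ
    squareMean f a = 𝔼 λ x → f (a ℕ.+ x ℕ.* x)

    periodic-𝔼 : ∀ {p} {f : ℕ → ℕ → ℚ} → (∀ x → Periodic p (f x)) → Periodic p (λ n → 𝔼 λ x → f x n)
    periodic-𝔼 per n = mean-cong q (λ x → per x n)

    progressionMean-periodic : ∀ {p f} → Periodic p f → ∀ s → Periodic p (progressionMean s f)
    progressionMean-periodic {f = f} per s = periodic-𝔼 {f = λ x n → f (n ℕ.+ x ℕ.* s)} (λ x → periodic-shift per (x ℕ.* s))

    squareMean-periodic : ∀ {p f} → Periodic p f → Periodic p (squareMean f)
    squareMean-periodic {f = f} per = periodic-𝔼 {f = λ x n → f (n ℕ.+ x ℕ.* x)} (λ x → periodic-shift per (x ℕ.* x))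

    -- Moving `c` by `s` moves `x` by one, and the mean over `x` does not see that.
    progressionMean-step : ∀ {f} → Periodic q f → ∀ s → Periodic s (progressionMean s f)
    progressionMean-step {f} per s c = trans
      (mean-cong q (λ x → cong f (move c s x)))
      (mean-shift q {λ x → f (c ℕ.+ x ℕ.* s)} (periodic-multiple per c s) 1)
      where
      move : ∀ c s x → c ℕ.+ s ℕ.+ x ℕ.* s ≡ c ℕ.+ (x ℕ.+ 1) ℕ.* s
      move = ℕ-Ring.solve-∀

    -- `progressionMean s` is the orthogonal projection onto functions of period `s`: translating
    -- both factors by y · s leaves `p` fixed, and averaging over y turns `f` into its mean.
    𝔼-project : ∀ {f p} s → Periodic q f → Periodic q p → Periodic s p →
      𝔼 (λ b → f b * p b) ≡ 𝔼 (λ b → progressionMean s f b * p b)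
    𝔼-project {f} {p} s per-f per-p step = begin
      𝔼 (λ b → f b * p b)
        ≡⟨ sym (mean-const q _) ⟩
      𝔼 (λ y → 𝔼 λ b → f b * p b)
        ≡⟨ mean-cong q (λ y → sym (mean-shift q (periodic-product per-f per-p) (y ℕ.* s))) ⟩
      𝔼 (λ y → 𝔼 λ b → f (b ℕ.+ y ℕ.* s) * p (b ℕ.+ y ℕ.* s))
        ≡⟨ mean-cong q (λ y → mean-cong q (λ b → cong (f (b ℕ.+ y ℕ.* s) *_) (periodic-* {f = p} step y b))) ⟩
      𝔼 (λ y → 𝔼 λ b → f (b ℕ.+ y ℕ.* s) * p b)
        ≡⟨ mean-swap q q _ ⟩
      𝔼 (λ b → 𝔼 λ y → f (b ℕ.+ y ℕ.* s) * p b)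
        ≡⟨ mean-cong q (λ b → mean-*ʳ q (p b) _) ⟩
      𝔼 (λ b → progressionMean s f b * p b) ∎
      where open ≡-Reasoning

    -- The steps s, s + t and the steps s, t generate the same subgroup; the substitution x + y for
    -- x in the double mean makes this explicit.
    progressionMean-compose : ∀ {f} → Periodic q f → ∀ s t b →
      progressionMean (s ℕ.+ t) (progressionMean s f) b ≡ 𝔼 λ x → progressionMean t f (b ℕ.+ x ℕ.* s)
    progressionMean-compose {f} per s t b = trans
      (mean-cong q λ y → trans
        (mean-cong q (λ x → cong f (move b y s t x)))
        (mean-shift q {λ x → f (b ℕ.+ y ℕ.* t ℕ.+ x ℕ.* s)} (periodic-multiple per (b ℕ.+ y ℕ.* t) s) y))
      (trans (mean-swap q q _)
        (mean-cong q λ x → mean-cong q λ y → cong f (exchange b y t x s)))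
      where
      move : ∀ b y s t x → b ℕ.+ y ℕ.* (s ℕ.+ t) ℕ.+ x ℕ.* s ≡ b ℕ.+ y ℕ.* t ℕ.+ (x ℕ.+ y) ℕ.* s
      move = ℕ-Ring.solve-∀
      exchange : ∀ b y t x s → b ℕ.+ y ℕ.* t ℕ.+ x ℕ.* s ≡ b ℕ.+ x ℕ.* s ℕ.+ y ℕ.* t
      exchange = ℕ-Ring.solve-∀

    -- A progression of step s is a union of progressions of step j · s: shifting y by z · j and
    -- averaging over z exposes the inner averages.
    progressionMean-divisor : ∀ {f} → Periodic q f → ∀ j s →
      (∀ c → progressionMean (j ℕ.* s) f c ≡ 0ℚ) → ∀ c → progressionMean s f c ≡ 0ℚ
    progressionMean-divisor {f} per j s vanish c = begin
      𝔼 (λ y → f (c ℕ.+ y ℕ.* s))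
        ≡⟨ sym (mean-const q _) ⟩
      𝔼 (λ z → 𝔼 λ y → f (c ℕ.+ y ℕ.* s))
        ≡⟨ mean-cong q (λ z → sym (mean-shift q {λ y → f (c ℕ.+ y ℕ.* s)} (periodic-multiple per c s) (z ℕ.* j))) ⟩
      𝔼 (λ z → 𝔼 λ y → f (c ℕ.+ (y ℕ.+ z ℕ.* j) ℕ.* s))
        ≡⟨ mean-swap q q _ ⟩
      𝔼 (λ y → 𝔼 λ z → f (c ℕ.+ (y ℕ.+ z ℕ.* j) ℕ.* s))
        ≡⟨ mean-cong q (λ y → trans (mean-cong q (λ z → cong f (move c y z j s))) (vanish (c ℕ.+ y ℕ.* s))) ⟩
      𝔼 (λ y → 0ℚ)
        ≡⟨ mean-const q 0ℚ ⟩
      0ℚ ∎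
      where
      open ≡-Reasoning
      move : ∀ c y z j s → c ℕ.+ (y ℕ.+ z ℕ.* j) ℕ.* s ≡ c ℕ.+ y ℕ.* s ℕ.+ z ℕ.* (j ℕ.* s)
      move = ℕ-Ring.solve-∀

    -- Contraction for functions of mean zero on every class modulo 12.

    module Equidistributed {g : ℕ → ℚ} (per : Periodic q g) (vanish : ∀ c → progressionMean 12 g c ≡ 0ℚ) where

      K : ℕ → ℕ → ℚ
      K s = progressionMean s g

      K-per : ∀ s → Periodic q (K s)
      K-per = progressionMean-periodic per

      K-step : ∀ s → Periodic s (K s)
      K-step = progressionMean-step per

      energy : ℕ → ℚ
      energy s = 𝔼 λ b → K s b * K s b

      g-K : ∀ s → 𝔼 (λ b → g b * K s b) ≡ energy s
      g-K s = 𝔼-project s per (K-per s) (K-step s)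

      -- Projecting `K s` onto period s + t amounts to averaging `g` along both s and t, and the
      -- average along t already vanishes.
      K-orthogonal : ∀ t → (∀ c → K t c ≡ 0ℚ) → ∀ s → 𝔼 (λ b → K s b * K (s ℕ.+ t) b) ≡ 0ℚ
      K-orthogonal t zero-t s = begin
        𝔼 (λ b → K s b * K (s ℕ.+ t) b)
          ≡⟨ 𝔼-project (s ℕ.+ t) (K-per s) (K-per (s ℕ.+ t)) (K-step (s ℕ.+ t)) ⟩
        𝔼 (λ b → progressionMean (s ℕ.+ t) (K s) b * K (s ℕ.+ t) b)
          ≡⟨ mean-cong q (λ b → trans (cong (_* K (s ℕ.+ t) b) (inner b)) (*-zeroˡ (K (s ℕ.+ t) b))) ⟩
        𝔼 (λ b → 0ℚ)
          ≡⟨ mean-const q 0ℚ ⟩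
        0ℚ ∎
        where
        open ≡-Reasoning
        inner : ∀ b → progressionMean (s ℕ.+ t) (K s) b ≡ 0ℚ
        inner b = trans (progressionMean-compose per s t b)
          (trans (mean-cong q (λ x → zero-t (b ℕ.+ x ℕ.* s))) (mean-const q 0ℚ))

      K-orthogonal₂ : ∀ s → 𝔼 (λ b → K s b * K (s ℕ.+ 2) b) ≡ 0ℚ
      K-orthogonal₂ = K-orthogonal 2 (progressionMean-divisor per 6 2 vanish)

      K-orthogonal₄ : ∀ s → 𝔼 (λ b → K s b * K (s ℕ.+ 4) b) ≡ 0ℚ
      K-orthogonal₄ = K-orthogonal 4 (progressionMean-divisor per 3 4 vanish)

      K-orthogonal₆ : ∀ s → 𝔼 (λ b → K s b * K (s ℕ.+ 6) b) ≡ 0ℚ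
      K-orthogonal₆ = K-orthogonal 6 (progressionMean-divisor per 2 6 vanish)

      -- The hypothesis is what makes `K s` the projection of `r` onto its own direction; Bessel's
      -- inequality is obtained by subtracting one `K` at a time and paying its energy.
      residual-energy : ∀ (r : ℕ → ℚ) s → 𝔼 (λ b → r b * K s b) ≡ energy s →
        𝔼 (λ b → (r b - K s b) * (r b - K s b)) ≡ 𝔼 (λ b → r b * r b) - energy s
      residual-energy r s eq = begin
        𝔼 (λ b → (r b - K s b) * (r b - K s b))
          ≡⟨ mean-cong q (λ b → expand (r b) (K s b)) ⟩
        𝔼 (λ b → r b * r b + (- 2ℚ * (r b * K s b) + K s b * K s b))
          ≡⟨ trans (mean-+ q _ _) (cong (λ t → 𝔼 (λ b → r b * r b) + t)
               (trans (mean-+ q _ _) (cong (λ t → t + energy s) (trans (mean-* q (- 2ℚ) _) (cong (- 2ℚ *_) eq))))) ⟩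
        𝔼 (λ b → r b * r b) + (- 2ℚ * energy s + energy s)
          ≡⟨ collect (𝔼 λ b → r b * r b) (energy s) ⟩
        𝔼 (λ b → r b * r b) - energy s ∎
        where
        open ≡-Reasoning
        expand : ∀ r k → (r - k) * (r - k) ≡ r * r + (- 2ℚ * (r * k) + k * k)
        expand = solve 2 (λ r k → (r :- k) :* (r :- k) := r :* r :+ (con (- 2ℚ) :* (r :* k) :+ k :* k)) refl
        collect : ∀ r e → r + (- 2ℚ * e + e) ≡ r - e
        collect = solve 2 (λ r e → r :+ (con (- 2ℚ) :* e :+ e) := r :- e) refl

      -- Carries the hypothesis of `residual-energy` for a later `K t` past the subtraction of an
      -- orthogonal `K s`.
      residual-K : ∀ (r : ℕ → ℚ) s t → 𝔼 (λ b → r b * K t b) ≡ energy t → 𝔼 (λ b → K s b * K t b) ≡ 0ℚ →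
        𝔼 (λ b → (r b - K s b) * K t b) ≡ energy t
      residual-K r s t eq orth = begin
        𝔼 (λ b → (r b - K s b) * K t b)
          ≡⟨ mean-cong q (λ b → expand (r b) (K s b) (K t b)) ⟩
        𝔼 (λ b → r b * K t b + - 1ℚ * (K s b * K t b))
          ≡⟨ trans (mean-+ q _ _) (cong₂ _+_ eq (trans (mean-* q (- 1ℚ) _) (cong (- 1ℚ *_) orth))) ⟩
        energy t + 0ℚ
          ≡⟨ +-identityʳ (energy t) ⟩
        energy t ∎
        where
        open ≡-Reasoning
        expand : ∀ r k l → (r - k) * l ≡ r * l + - 1ℚ * (k * l)
        expand = solve 3 (λ r k l → (r :- k) :* l := r :* l :+ con (- 1ℚ) :* (k :* l)) refl

      -- The means K s, …, K (s + 6) are pairwise orthogonal, because the step 2, 4 or 6 by which two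
      -- of them differ divides 12.
      bessel : ∀ s → energy s + energy (s ℕ.+ 2) + energy (s ℕ.+ 4) + energy (s ℕ.+ 6) ≤ 𝔼 (λ b → g b * g b)
      bessel s = ≤-by (𝔼 λ b → r₄ b * r₄ b) (mean-nonNeg q (λ b → 0≤-square (r₄ b))) (begin
        e₀ + e₂ + e₄ + e₆ + 𝔼 (λ b → r₄ b * r₄ b)
          ≡⟨ cong (λ t → e₀ + e₂ + e₄ + e₆ + t)
               (trans (residual-energy r₃ s₆ r₃-K₆)
               (cong (_- e₆) (trans (residual-energy r₂ s₄ r₂-K₄)
               (cong (_- e₄) (trans (residual-energy r₁ s₂ r₁-K₂)
               (cong (_- e₂) (residual-energy g s (g-K s)))))))) ⟩
        e₀ + e₂ + e₄ + e₆ + (𝔼 (λ b → g b * g b) - e₀ - e₂ - e₄ - e₆)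
          ≡⟨ cancel e₀ e₂ e₄ e₆ (𝔼 λ b → g b * g b) ⟩
        𝔼 (λ b → g b * g b) ∎)
        where
        open ≡-Reasoning
        s₂ = s ℕ.+ 2
        s₄ = s ℕ.+ 4
        s₆ = s ℕ.+ 6
        e₀ = energy s
        e₂ = energy s₂
        e₄ = energy s₄
        e₆ = energy s₆
        r₁ r₂ r₃ r₄ : ℕ → ℚ
        r₁ b = g b - K s b
        r₂ b = r₁ b - K s₂ b
        r₃ b = r₂ b - K s₄ b
        r₄ b = r₃ b - K s₆ b
        K₂-K₄ : 𝔼 (λ b → K s₂ b * K s₄ b) ≡ 0ℚ
        K₂-K₄ = subst (λ t → 𝔼 (λ b → K s₂ b * K t b) ≡ 0ℚ) (ℕ.+-assoc s 2 2) (K-orthogonal₂ s₂)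
        K₂-K₆ : 𝔼 (λ b → K s₂ b * K s₆ b) ≡ 0ℚ
        K₂-K₆ = subst (λ t → 𝔼 (λ b → K s₂ b * K t b) ≡ 0ℚ) (ℕ.+-assoc s 2 4) (K-orthogonal₄ s₂)
        K₄-K₆ : 𝔼 (λ b → K s₄ b * K s₆ b) ≡ 0ℚ
        K₄-K₆ = subst (λ t → 𝔼 (λ b → K s₄ b * K t b) ≡ 0ℚ) (ℕ.+-assoc s 4 2) (K-orthogonal₂ s₄)
        r₁-K₂ = residual-K g s s₂ (g-K s₂) (K-orthogonal₂ s)
        r₂-K₄ = residual-K r₁ s₂ s₄ (residual-K g s s₄ (g-K s₄) (K-orthogonal₄ s)) K₂-K₄
        r₃-K₆ = residual-K r₂ s₄ s₆
          (residual-K r₁ s₂ s₆ (residual-K g s s₆ (g-K s₆) (K-orthogonal₆ s)) K₂-K₆) K₄-K₆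
        cancel : ∀ a b c d e → a + b + c + d + (e - a - b - c - d) ≡ e
        cancel = solve 5 (λ a b c d e → a :+ b :+ c :+ d :+ (e :- a :- b :- c :- d) := e) refl

      double : ℕ → ℕ
      double h = h ℕ.+ h

      -- Since y² - x² = h² + 2hx for y = x + h, the autocorrelation of the squares with fixed h runs
      -- through a progression of step 2h.
      squareMean-energy : 𝔼 (λ a → squareMean g a * squareMean g a) ≤ 𝔼 (λ h → energy (double h))
      squareMean-energy = ≤-trans (≤-reflexive correlation) (mean-mono q bound)
        where
        open ≡-Reasoning
        differ : ∀ a x h → a ℕ.+ (h ℕ.+ x) ℕ.* (h ℕ.+ x) ≡ a ℕ.+ x ℕ.* x ℕ.+ h ℕ.* h ℕ.+ x ℕ.* (h ℕ.+ h)
        differ = ℕ-Ring.solve-∀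
        step₁ : ∀ a x → squareMean g a ≡ 𝔼 λ h → g (a ℕ.+ x ℕ.* x ℕ.+ h ℕ.* h ℕ.+ x ℕ.* double h)
        step₁ a x = trans (sym (mean-shift q {λ y → g (a ℕ.+ y ℕ.* y)} (periodic-square per a) x))
          (mean-cong q (λ h → cong g (differ a x h)))
        correlation : 𝔼 (λ a → squareMean g a * squareMean g a) ≡
          𝔼 λ h → 𝔼 λ b → K (double h) b * K (double h) (b ℕ.+ h ℕ.* h)
        correlation = begin
          𝔼 (λ a → squareMean g a * squareMean g a)
            ≡⟨ mean-cong q (λ a → sym (mean-*ʳ q (squareMean g a) _)) ⟩
          𝔼 (λ a → 𝔼 λ x → g (a ℕ.+ x ℕ.* x) * squareMean g a)
            ≡⟨ mean-cong q (λ a → mean-cong q (λ x →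
                 trans (cong (g (a ℕ.+ x ℕ.* x) *_) (step₁ a x)) (sym (mean-* q (g (a ℕ.+ x ℕ.* x)) _)))) ⟩
          𝔼 (λ a → 𝔼 λ x → 𝔼 λ h → g (a ℕ.+ x ℕ.* x) * g (a ℕ.+ x ℕ.* x ℕ.+ h ℕ.* h ℕ.+ x ℕ.* double h))
            ≡⟨ mean-cong q (λ a → mean-swap q q _) ⟩
          𝔼 (λ a → 𝔼 λ h → 𝔼 λ x → g (a ℕ.+ x ℕ.* x) * g (a ℕ.+ x ℕ.* x ℕ.+ h ℕ.* h ℕ.+ x ℕ.* double h))
            ≡⟨ mean-swap q q _ ⟩
          𝔼 (λ h → 𝔼 λ a → 𝔼 λ x → g (a ℕ.+ x ℕ.* x) * g (a ℕ.+ x ℕ.* x ℕ.+ h ℕ.* h ℕ.+ x ℕ.* double h))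
            ≡⟨ mean-cong q (λ h → mean-swap q q _) ⟩
          𝔼 (λ h → 𝔼 λ x → 𝔼 λ a → g (a ℕ.+ x ℕ.* x) * g (a ℕ.+ x ℕ.* x ℕ.+ h ℕ.* h ℕ.+ x ℕ.* double h))
            ≡⟨ mean-cong q (λ h → mean-cong q (λ x →
                 mean-shift q {λ b → g b * g (b ℕ.+ h ℕ.* h ℕ.+ x ℕ.* double h)}
                   (periodic-product per (periodic-shift (periodic-shift per (x ℕ.* double h)) (h ℕ.* h))) (x ℕ.* x))) ⟩
          𝔼 (λ h → 𝔼 λ x → 𝔼 λ b → g b * g (b ℕ.+ h ℕ.* h ℕ.+ x ℕ.* double h))
            ≡⟨ mean-cong q (λ h → mean-swap q q _) ⟩
          𝔼 (λ h → 𝔼 λ b → 𝔼 λ x → g b * g (b ℕ.+ h ℕ.* h ℕ.+ x ℕ.* double h))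
            ≡⟨ mean-cong q (λ h → mean-cong q (λ b → mean-* q (g b) _)) ⟩
          𝔼 (λ h → 𝔼 λ b → g b * K (double h) (b ℕ.+ h ℕ.* h))
            -- The second factor has period 2h, so the first may be replaced by its average along
            -- step 2h.
            ≡⟨ mean-cong q (λ h → 𝔼-project (double h) per
                 (periodic-shift (K-per (double h)) (h ℕ.* h)) (periodic-shift (K-step (double h)) (h ℕ.* h))) ⟩
          𝔼 (λ h → 𝔼 λ b → K (double h) b * K (double h) (b ℕ.+ h ℕ.* h)) ∎
        am-gm : ∀ x y → x * y ≤ ½ * (x * x) + ½ * (y * y)
        am-gm x y = ≤-by (½ * ((x - y) * (x - y))) (0≤-* (nonNegative⁻¹ ½) (0≤-square (x - y))) (expand x y)
          where
          expand : ∀ x y → x * y + ½ * ((x - y) * (x - y)) ≡ ½ * (x * x) + ½ * (y * y)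
          expand = solve 2 (λ x y → x :* y :+ con ½ :* ((x :- y) :* (x :- y)) := con ½ :* (x :* x) :+ con ½ :* (y :* y)) refl
        -- The two factors are translates of one function and so have equal energy; no sign of the
        -- correlation is needed.
        bound : ∀ h → 𝔼 (λ b → K (double h) b * K (double h) (b ℕ.+ h ℕ.* h)) ≤ energy (double h)
        bound h = ≤-trans (mean-mono q (λ b → am-gm (K (double h) b) (K (double h) (b ℕ.+ h ℕ.* h)))) (≤-reflexive (begin
          𝔼 (λ b → ½ * (k b * k b) + ½ * (k (b ℕ.+ h ℕ.* h) * k (b ℕ.+ h ℕ.* h)))
            ≡⟨ trans (mean-+ q _ _) (cong₂ _+_ (mean-* q ½ _) (mean-* q ½ _)) ⟩
          ½ * energy (double h) + ½ * 𝔼 (λ b → k (b ℕ.+ h ℕ.* h) * k (b ℕ.+ h ℕ.* h))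
            ≡⟨ cong (λ t → ½ * energy (double h) + ½ * t)
                 (mean-shift q (periodic-product (K-per (double h)) (K-per (double h))) (h ℕ.* h)) ⟩
          ½ * energy (double h) + ½ * energy (double h)
            ≡⟨ halves (energy (double h)) ⟩
          energy (double h) ∎))
          where
          k = K (double h)
          halves : ∀ e → ½ * e + ½ * e ≡ e
          halves = solve 1 (λ e → con ½ :* e :+ con ½ :* e := e) refl

      -- Since `energy (double h)` is periodic in h, its mean is unchanged by h ↦ h + 1, h + 2, h +
      -- 3. Four copies of the mean therefore form the mean of the left side of `bessel`.
      squareMean-contracts : 4ℚ * 𝔼 (λ a → squareMean g a * squareMean g a) ≤ 𝔼 (λ b → g b * g b)
      squareMean-contracts = ≤-trans (*-monoˡ-≤-nonNeg 4ℚ squareMean-energy)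
        (≤-trans (≤-reflexive average)
        (≤-trans (mean-mono q (λ h → bessel (double h))) (≤-reflexive (mean-const q _))))
        where
        open ≡-Reasoning
        e : ℕ → ℚ
        e h = energy (double h)
        periodic-energy : Periodic q e
        periodic-energy h = mean-cong q (λ b → cong₂ _*_ (same b) (same b))
          where
          move : ∀ b x h q → b ℕ.+ x ℕ.* (h ℕ.+ q ℕ.+ (h ℕ.+ q)) ≡ b ℕ.+ x ℕ.* (h ℕ.+ h) ℕ.+ 2 ℕ.* x ℕ.* q
          move = ℕ-Ring.solve-∀
          same : ∀ b → K (double (h ℕ.+ q)) b ≡ K (double h) b
          same b = mean-cong q (λ x → trans (cong g (move b x h q)) (periodic-* {f = g} per (2 ℕ.* x) (b ℕ.+ x ℕ.* double h)))
        shifted : ∀ i → 𝔼 e ≡ 𝔼 (λ h → energy (double h ℕ.+ double i))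
        shifted i = trans (sym (mean-shift q periodic-energy i)) (mean-cong q (λ h → cong energy (move h i)))
          where
          move : ∀ h i → h ℕ.+ i ℕ.+ (h ℕ.+ i) ≡ h ℕ.+ h ℕ.+ (i ℕ.+ i)
          move = ℕ-Ring.solve-∀
        split₄ : ∀ t → 4ℚ * t ≡ t + t + t + t
        split₄ = solve 1 (λ t → con 4ℚ :* t := t :+ t :+ t :+ t) refl
        average : 4ℚ * 𝔼 e ≡
          𝔼 (λ h → e h + energy (double h ℕ.+ 2) + energy (double h ℕ.+ 4) + energy (double h ℕ.+ 6))
        average = begin
          4ℚ * 𝔼 e
            ≡⟨ split₄ (𝔼 e) ⟩
          𝔼 e + 𝔼 e + 𝔼 e + 𝔼 e
            ≡⟨ cong₂ _+_ (cong₂ _+_ (cong (λ t → 𝔼 e + t) (shifted 1)) (shifted 2)) (shifted 3) ⟩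
          𝔼 e + 𝔼 (λ h → energy (double h ℕ.+ 2)) + 𝔼 (λ h → energy (double h ℕ.+ 4)) + 𝔼 (λ h → energy (double h ℕ.+ 6))
            ≡⟨ sym (trans (mean-+ q _ _) (cong (λ t → t + 𝔼 (λ h → energy (double h ℕ.+ 6)))
                 (trans (mean-+ q _ _) (cong (λ t → t + 𝔼 (λ h → energy (double h ℕ.+ 4))) (mean-+ q _ _))))) ⟩
          𝔼 (λ h → e h + energy (double h ℕ.+ 2) + energy (double h ℕ.+ 4) + energy (double h ℕ.+ 6)) ∎

  -- The inequality on ℤ/12: reduction to the totals of the four classes modulo 4.

  record Triple : Set where
    constructor ⟨_,_,_⟩
    field x₀ x₁ x₂ : ℚ
  open Triple

  total : Triple → ℚ
  total y = x₀ y + x₁ y + x₂ y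

  infixl 7 _∙_
  _∙_ : Triple → Triple → ℚ
  y ∙ z = x₀ y * x₀ z + x₁ y * x₁ z + x₂ y * x₂ z

  ∙-comm : ∀ y z → y ∙ z ≡ z ∙ y
  ∙-comm y z = cong₂ _+_ (cong₂ _+_ (*-comm (x₀ y) (x₀ z)) (*-comm (x₁ y) (x₁ z))) (*-comm (x₂ y) (x₂ z))

  InUnit : ℚ → Set
  InUnit x = 0ℚ ≤ x × x ≤ 1ℚ

  InCube : Triple → Set
  InCube y = InUnit (x₀ y) × InUnit (x₁ y) × InUnit (x₂ y)

  _⁺ : ℚ → ℚ
  x ⁺ = 0ℚ ⊔ x

  ⁺-square : ∀ {x} → 0ℚ ≤ x → x * x ≤ x ⁺ * x ⁺
  ⁺-square {x} 0≤x = ≤-reflexive (cong₂ _*_ (sym (p≤q⇒p⊔q≡q 0≤x)) (sym (p≤q⇒p⊔q≡q 0≤x)))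

  total-nonNeg : ∀ {y} → InCube y → 0ℚ ≤ total y
  total-nonNeg ((0≤a , _) , (0≤b , _) , (0≤c , _)) = 0≤-+ (0≤-+ 0≤a 0≤b) 0≤c

  cauchy-schwarz : ∀ y → total y * total y ≤ 3ℚ * (y ∙ y)
  cauchy-schwarz ⟨ a , b , c ⟩ = ≤-by
    ((a - b) * (a - b) + (b - c) * (b - c) + (a - c) * (a - c))
    (0≤-+ (0≤-+ (0≤-square (a - b)) (0≤-square (b - c))) (0≤-square (a - c)))
    (expand a b c)
    where
    expand : ∀ a b c → (a + b + c) * (a + b + c) + ((a - b) * (a - b) + (b - c) * (b - c) + (a - c) * (a - c))
      ≡ 3ℚ * (a * a + b * b + c * c)
    expand = solve 3 (λ a b c →
      (a :+ b :+ c) :* (a :+ b :+ c) :+ ((a :- b) :* (a :- b) :+ (b :- c) :* (b :- c) :+ (a :- c) :* (a :- c))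
      := con 3ℚ :* (a :* a :+ b :* b :+ c :* c)) refl

  ⅓ ⅔ : ℚ
  ⅓ = + 1 / 3
  ⅔ = + 2 / 3

  -- The left side is -‖y - z‖², and Cauchy-Schwarz applies to the difference of the triples.
  cauchy-schwarz-diff : ∀ y z →
    2ℚ * (y ∙ z) - y ∙ y - z ∙ z ≤ - (⅓ * ((total y - total z) * (total y - total z)))
  cauchy-schwarz-diff y@(⟨ a , b , c ⟩) z@(⟨ d , e , f ⟩) = ≤-by
    (⅓ * (3ℚ * (w ∙ w) - total w * total w))
    (0≤-* (nonNegative⁻¹ ⅓) (0≤-diff (cauchy-schwarz w)))
    (expand a b c d e f)
    where
    w = ⟨ a - d , b - e , c - f ⟩
    expand : ∀ a b c d e f →
      2ℚ * (a * d + b * e + c * f) - (a * a + b * b + c * c) - (d * d + e * e + f * f)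
        + ⅓ * (3ℚ * ((a - d) * (a - d) + (b - e) * (b - e) + (c - f) * (c - f))
               - ((a - d) + (b - e) + (c - f)) * ((a - d) + (b - e) + (c - f)))
      ≡ - (⅓ * ((a + b + c - (d + e + f)) * (a + b + c - (d + e + f))))
    expand = solve 6 (λ a b c d e f →
      con 2ℚ :* (a :* d :+ b :* e :+ c :* f) :- (a :* a :+ b :* b :+ c :* c) :- (d :* d :+ e :* e :+ f :* f)
        :+ con ⅓ :* (con 3ℚ :* ((a :- d) :* (a :- d) :+ (b :- e) :* (b :- e) :+ (c :- f) :* (c :- f))
               :- ((a :- d) :+ (b :- e) :+ (c :- f)) :* ((a :- d) :+ (b :- e) :+ (c :- f)))
      := :- (con ⅓ :* ((a :+ b :+ c :- (d :+ e :+ f)) :* (a :+ b :+ c :- (d :+ e :+ f))))) refl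

  ∙-≤-total : ∀ {y z} → InCube y → InCube z → y ∙ z ≤ total z
  ∙-≤-total {y} {z} ((_ , a≤1) , (_ , b≤1) , (_ , c≤1)) ((0≤d , _) , (0≤e , _) , (0≤f , _)) =
    +-mono-≤ (+-mono-≤ (coordinate a≤1 0≤d) (coordinate b≤1 0≤e)) (coordinate c≤1 0≤f)
    where
    coordinate : ∀ {s t} → s ≤ 1ℚ → 0ℚ ≤ t → s * t ≤ t
    coordinate {s} {t} s≤1 0≤t = subst (s * t ≤_) (*-identityˡ t) (*-monoʳ-≤-nonNeg t {{nonNegative 0≤t}} s≤1)

  norm-≤-total² : ∀ {y} → InCube y → y ∙ y ≤ total y * total y
  norm-≤-total² {⟨ a , b , c ⟩} ((0≤a , _) , (0≤b , _) , (0≤c , _)) = ≤-by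
    (2ℚ * (a * b + b * c + a * c))
    (0≤-* (nonNegative⁻¹ 2ℚ) (0≤-+ (0≤-+ (0≤-* 0≤a 0≤b) (0≤-* 0≤b 0≤c)) (0≤-* 0≤a 0≤c)))
    (expand a b c)
    where
    expand : ∀ a b c → a * a + b * b + c * c + 2ℚ * (a * b + b * c + a * c) ≡ (a + b + c) * (a + b + c)
    expand = solve 3 (λ a b c → a :* a :+ b :* b :+ c :* c :+ con 2ℚ :* (a :* b :+ b :* c :+ a :* c)
      := (a :+ b :+ c) :* (a :+ b :+ c)) refl

  -- This is `norm-≤-total²` for the complementary triple 1 - y, whose squared norm is 3 - 2 ·
  -- `total y` + ‖y‖².
  norm-≤-cototal² : ∀ {y} → InCube y → y ∙ y ≤ (3ℚ - total y) * (3ℚ - total y) - 3ℚ + 2ℚ * total y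
  norm-≤-cototal² {⟨ a , b , c ⟩} ((_ , a≤1) , (_ , b≤1) , (_ , c≤1)) = ≤-by
    (2ℚ * ((1ℚ - a) * (1ℚ - b) + (1ℚ - b) * (1ℚ - c) + (1ℚ - a) * (1ℚ - c)))
    (0≤-* (nonNegative⁻¹ 2ℚ) (0≤-+ (0≤-+ (0≤-* 0≤a′ 0≤b′) (0≤-* 0≤b′ 0≤c′)) (0≤-* 0≤a′ 0≤c′)))
    (expand a b c)
    where
    expand : ∀ a b c → a * a + b * b + c * c
        + 2ℚ * ((1ℚ - a) * (1ℚ - b) + (1ℚ - b) * (1ℚ - c) + (1ℚ - a) * (1ℚ - c))
      ≡ (3ℚ - (a + b + c)) * (3ℚ - (a + b + c)) - 3ℚ + 2ℚ * (a + b + c)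
    expand = solve 3 (λ a b c → a :* a :+ b :* b :+ c :* c
        :+ con 2ℚ :* ((con 1ℚ :- a) :* (con 1ℚ :- b) :+ (con 1ℚ :- b) :* (con 1ℚ :- c) :+ (con 1ℚ :- a) :* (con 1ℚ :- c))
      := (con 3ℚ :- (a :+ b :+ c)) :* (con 3ℚ :- (a :+ b :+ c)) :- con 3ℚ :+ con 2ℚ :* (a :+ b :+ c)) refl
    0≤a′ = 0≤-diff a≤1
    0≤b′ = 0≤-diff b≤1
    0≤c′ = 0≤-diff c≤1

  cyclic : (Y₀ Y₁ Y₂ Y₃ : ℚ) → ℚ
  cyclic Y₀ Y₁ Y₂ Y₃ = (Y₀ + Y₁) * (Y₀ + Y₁) + (Y₁ + Y₂) * (Y₁ + Y₂) + (Y₂ + Y₃) * (Y₂ + Y₃) + (Y₃ + Y₀) * (Y₃ + Y₀)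

  -- The triples are the values of a function on ℤ/12 = ℤ/4 × ℤ/3 on the four classes modulo 4, and
  -- adjacent classes are those joined by the squares 0 and 1 modulo 4.
  excess : Triple → Triple → Triple → Triple → ℚ
  excess y₀ y₁ y₂ y₃ = ⅔ * cyclic (total y₀) (total y₁) (total y₂) (total y₃)
    + 2ℚ * (y₀ ∙ y₁ + y₁ ∙ y₂ + y₂ ∙ y₃ + y₃ ∙ y₀) - (y₀ ∙ y₀ + y₁ ∙ y₁ + y₂ ∙ y₂ + y₃ ∙ y₃)

  18ℚ : ℚ
  18ℚ = + 18 / 1

  overflow : ℚ → ℚ → ℚ
  overflow Y Z = (Y + Z - 3ℚ) ⁺ * (Y + Z - 3ℚ) ⁺

  allowance : (Y₀ Y₁ Y₂ Y₃ : ℚ) → ℚ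
  allowance Y₀ Y₁ Y₂ Y₃ = 18ℚ + (overflow Y₀ Y₁ + overflow Y₁ Y₂ + overflow Y₂ Y₃ + overflow Y₃ Y₀)

  -- Drops the correlation of y₀, y₁ and of y₂, y₃ beyond what their totals force.
  β-bound : (Y₀ Y₁ Y₂ Y₃ : ℚ) → ℚ
  β-bound Y₀ Y₁ Y₂ Y₃ = ⅔ * cyclic Y₀ Y₁ Y₂ Y₃ + 2ℚ * (Y₂ + Y₃)
    + (- (⅓ * ((Y₀ - Y₁) * (Y₀ - Y₁))) + - (⅓ * ((Y₂ - Y₃) * (Y₂ - Y₃))))

  -- The edges y₀y₁ and y₂y₃ absorb all the squared norms as -‖y₀ - y₁‖² - ‖y₂ - y₃‖²; the other two
  -- edges are bounded by the totals of y₂ and y₃, in the sorted case the pair with the smaller sum.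
  excess-≤-β : ∀ {y₀ y₁ y₂ y₃} → InCube y₀ → InCube y₁ → InCube y₂ → InCube y₃ →
    excess y₀ y₁ y₂ y₃ ≤ β-bound (total y₀) (total y₁) (total y₂) (total y₃)
  excess-≤-β {y₀} {y₁} {y₂} {y₃} c₀ c₁ c₂ c₃ = ≤-trans (≤-reflexive regroup)
    (+-mono-≤ (+-monoʳ-≤ C (*-monoˡ-≤-nonNeg 2ℚ (+-mono-≤ (∙-≤-total c₁ c₂)
        (subst (_≤ total y₃) (∙-comm y₀ y₃) (∙-≤-total c₀ c₃)))))
      (+-mono-≤ (cauchy-schwarz-diff y₀ y₁) (cauchy-schwarz-diff y₂ y₃)))
    where
    C = ⅔ * cyclic (total y₀) (total y₁) (total y₂) (total y₃)
    regroup : excess y₀ y₁ y₂ y₃ ≡ C + 2ℚ * (y₁ ∙ y₂ + y₃ ∙ y₀)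
      + ((2ℚ * (y₀ ∙ y₁) - y₀ ∙ y₀ - y₁ ∙ y₁) + (2ℚ * (y₂ ∙ y₃) - y₂ ∙ y₂ - y₃ ∙ y₃))
    regroup = split C (y₀ ∙ y₁) (y₁ ∙ y₂) (y₂ ∙ y₃) (y₃ ∙ y₀) (y₀ ∙ y₀) (y₁ ∙ y₁) (y₂ ∙ y₂) (y₃ ∙ y₃)
      where
      split : ∀ C a b c d e f g h → C + 2ℚ * (a + b + c + d) - (e + f + g + h)
        ≡ C + 2ℚ * (b + d) + ((2ℚ * a - e - f) + (2ℚ * c - g - h))
      split = solve 9 (λ C a b c d e f g h → C :+ con 2ℚ :* (a :+ b :+ c :+ d) :- (e :+ f :+ g :+ h)
        := C :+ con 2ℚ :* (b :+ d) :+ ((con 2ℚ :* a :- e :- f) :+ (con 2ℚ :* c :- g :- h))) refl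

  -- Completes the square at y₁ and y₃ around y₀ ⊕ y₂; sharp when y₀ is nearly full and y₂ nearly empty.
  α-bound : (Y₀ Y₁ Y₂ Y₃ : ℚ) → ℚ
  α-bound Y₀ Y₁ Y₂ Y₃ = ⅔ * cyclic Y₀ Y₁ Y₂ Y₃
    + (- (⅓ * ((Y₀ + Y₂ - Y₁) * (Y₀ + Y₂ - Y₁))) + - (⅓ * ((Y₀ + Y₂ - Y₃) * (Y₀ + Y₂ - Y₃))))
    + ((3ℚ - Y₀) * (3ℚ - Y₀) - 3ℚ + 2ℚ * Y₀ + Y₂ * Y₂ + 4ℚ * Y₂)

  infixl 6 _⊕_
  _⊕_ : Triple → Triple → Triple
  ⟨ a , b , c ⟩ ⊕ ⟨ d , e , f ⟩ = ⟨ a + d , b + e , c + f ⟩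

  -- With s = y₀ ⊕ y₂, each of y₁ and y₃ contributes 2 s · y - ‖y‖² = ‖s‖² - ‖s - y‖². After the
  -- norms of y₀ and y₂ are subtracted from 2 ‖s‖², what remains is ‖y₀‖² + ‖y₂‖² + 4 y₀ · y₂.
  excess-≤-α : ∀ {y₀ y₁ y₂ y₃} → InCube y₀ → InCube y₁ → InCube y₂ → InCube y₃ →
    excess y₀ y₁ y₂ y₃ ≤ α-bound (total y₀) (total y₁) (total y₂) (total y₃)
  excess-≤-α {y₀} {y₁} {y₂} {y₃} c₀ c₁ c₂ c₃ = ≤-trans (≤-reflexive regroup)
    (+-mono-≤ (+-monoʳ-≤ C (+-mono-≤ (centred y₁) (centred y₃)))
      (+-mono-≤ (+-mono-≤ (norm-≤-cototal² c₀) (norm-≤-total² c₂)) (*-monoˡ-≤-nonNeg 4ℚ (∙-≤-total c₀ c₂))))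
    where
    C = ⅔ * cyclic (total y₀) (total y₁) (total y₂) (total y₃)
    s = y₀ ⊕ y₂
    total-⊕ : ∀ y z → total (y ⊕ z) ≡ total y + total z
    total-⊕ ⟨ a , b , c ⟩ ⟨ d , e , f ⟩ = expand a b c d e f
      where
      expand : ∀ a b c d e f → (a + d) + (b + e) + (c + f) ≡ a + b + c + (d + e + f)
      expand = solve 6 (λ a b c d e f → (a :+ d) :+ (b :+ e) :+ (c :+ f) := a :+ b :+ c :+ (d :+ e :+ f)) refl
    centred : ∀ y → 2ℚ * (s ∙ y) - s ∙ s - y ∙ y
      ≤ - (⅓ * ((total y₀ + total y₂ - total y) * (total y₀ + total y₂ - total y)))
    centred y = subst (λ t → 2ℚ * (s ∙ y) - s ∙ s - y ∙ y ≤ - (⅓ * ((t - total y) * (t - total y))))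
      (total-⊕ y₀ y₂) (cauchy-schwarz-diff s y)
    ⊕-∙ : ∀ y z w → (y ⊕ z) ∙ w ≡ y ∙ w + z ∙ w
    ⊕-∙ ⟨ a , b , c ⟩ ⟨ d , e , f ⟩ ⟨ g , h , i ⟩ = expand a b c d e f g h i
      where
      expand : ∀ a b c d e f g h i → (a + d) * g + (b + e) * h + (c + f) * i
        ≡ a * g + b * h + c * i + (d * g + e * h + f * i)
      expand = solve 9 (λ a b c d e f g h i → (a :+ d) :* g :+ (b :+ e) :* h :+ (c :+ f) :* i
        := a :* g :+ b :* h :+ c :* i :+ (d :* g :+ e :* h :+ f :* i)) refl
    ⊕-norm : ∀ y z → (y ⊕ z) ∙ (y ⊕ z) ≡ y ∙ y + z ∙ z + 2ℚ * (y ∙ z)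
    ⊕-norm ⟨ a , b , c ⟩ ⟨ d , e , f ⟩ = expand a b c d e f
      where
      expand : ∀ a b c d e f → (a + d) * (a + d) + (b + e) * (b + e) + (c + f) * (c + f)
        ≡ a * a + b * b + c * c + (d * d + e * e + f * f) + 2ℚ * (a * d + b * e + c * f)
      expand = solve 6 (λ a b c d e f →
        (a :+ d) :* (a :+ d) :+ (b :+ e) :* (b :+ e) :+ (c :+ f) :* (c :+ f)
        := a :* a :+ b :* b :+ c :* c :+ (d :* d :+ e :* e :+ f :* f) :+ con 2ℚ :* (a :* d :+ b :* e :+ c :* f)) refl
    split : ∀ C a b c d e f g h x → C + 2ℚ * (a + b + c + d) - (e + f + g + h)
      ≡ C + ((2ℚ * (a + b) - (e + g + 2ℚ * x) - f) + (2ℚ * (d + c) - (e + g + 2ℚ * x) - h)) + (e + g + 4ℚ * x)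
    split = solve 10 (λ C a b c d e f g h x → C :+ con 2ℚ :* (a :+ b :+ c :+ d) :- (e :+ f :+ g :+ h)
      := C :+ ((con 2ℚ :* (a :+ b) :- (e :+ g :+ con 2ℚ :* x) :- f)
            :+ (con 2ℚ :* (d :+ c) :- (e :+ g :+ con 2ℚ :* x) :- h)) :+ (e :+ g :+ con 4ℚ :* x)) refl
    s∙y₁ : s ∙ y₁ ≡ y₀ ∙ y₁ + y₁ ∙ y₂
    s∙y₁ = trans (⊕-∙ y₀ y₂ y₁) (cong (λ t → y₀ ∙ y₁ + t) (∙-comm y₂ y₁))
    s∙y₃ : s ∙ y₃ ≡ y₃ ∙ y₀ + y₂ ∙ y₃
    s∙y₃ = trans (⊕-∙ y₀ y₂ y₃) (cong (λ t → t + y₂ ∙ y₃) (∙-comm y₀ y₃))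
    centres : ∀ {p p′ r r′ t t′} → p ≡ p′ → r ≡ r′ → t ≡ t′ →
      C + ((2ℚ * p - t - y₁ ∙ y₁) + (2ℚ * r - t - y₃ ∙ y₃)) + (y₀ ∙ y₀ + y₂ ∙ y₂ + 4ℚ * (y₀ ∙ y₂))
      ≡ C + ((2ℚ * p′ - t′ - y₁ ∙ y₁) + (2ℚ * r′ - t′ - y₃ ∙ y₃)) + (y₀ ∙ y₀ + y₂ ∙ y₂ + 4ℚ * (y₀ ∙ y₂))
    centres refl refl refl = refl
    regroup : excess y₀ y₁ y₂ y₃ ≡ C
      + ((2ℚ * (s ∙ y₁) - s ∙ s - y₁ ∙ y₁) + (2ℚ * (s ∙ y₃) - s ∙ s - y₃ ∙ y₃))
      + (y₀ ∙ y₀ + y₂ ∙ y₂ + 4ℚ * (y₀ ∙ y₂))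
    regroup = trans
      (split C (y₀ ∙ y₁) (y₁ ∙ y₂) (y₂ ∙ y₃) (y₃ ∙ y₀) (y₀ ∙ y₀) (y₁ ∙ y₁) (y₂ ∙ y₂) (y₃ ∙ y₃) (y₀ ∙ y₂))
      (centres (sym s∙y₁) (sym s∙y₃) (sym (⊕-norm y₀ y₂)))

  -- The inequality in the class totals: slack certificates region by region.

  ¼ ¾ : ℚ
  ¼ = + 1 / 4
  ¾ = + 3 / 4

  -- Four class totals with sum 9/2: A and B are the imbalances of the two pairs of opposite edges of
  -- the 4-cycle, k that of its diagonals.
  Y₀ Y₁ Y₂ Y₃ : (A B k : ℚ) → ℚ
  Y₀ A B k = + 3 / 2 * (¾ + k + A + B)
  Y₁ A B k = + 3 / 2 * (¾ - k - A + B)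
  Y₂ A B k = + 3 / 2 * (¾ + k - A - B)
  Y₃ A B k = + 3 / 2 * (¾ - k + A - B)

  β-at α-at allowance-at : (A B k : ℚ) → ℚ
  β-at A B k = β-bound (Y₀ A B k) (Y₁ A B k) (Y₂ A B k) (Y₃ A B k)
  α-at A B k = α-bound (Y₀ A B k) (Y₁ A B k) (Y₂ A B k) (Y₃ A B k)
  allowance-at A B k = allowance (Y₀ A B k) (Y₁ A B k) (Y₂ A B k) (Y₃ A B k)

  private
    :Y₀ :Y₁ :Y₂ :Y₃ : (A B k : Polynomial 3) → Polynomial 3
    :Y₀ A B k = con (+ 3 / 2) :* (con ¾ :+ k :+ A :+ B)
    :Y₁ A B k = con (+ 3 / 2) :* (con ¾ :- k :- A :+ B)
    :Y₂ A B k = con (+ 3 / 2) :* (con ¾ :+ k :- A :- B)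
    :Y₃ A B k = con (+ 3 / 2) :* (con ¾ :- k :+ A :- B)

    :cyclic :β :α : (Y₀ Y₁ Y₂ Y₃ : Polynomial 3) → Polynomial 3
    :cyclic Y₀ Y₁ Y₂ Y₃ =
      (Y₀ :+ Y₁) :* (Y₀ :+ Y₁) :+ (Y₁ :+ Y₂) :* (Y₁ :+ Y₂) :+ (Y₂ :+ Y₃) :* (Y₂ :+ Y₃) :+ (Y₃ :+ Y₀) :* (Y₃ :+ Y₀)
    :β Y₀ Y₁ Y₂ Y₃ = con ⅔ :* :cyclic Y₀ Y₁ Y₂ Y₃ :+ con 2ℚ :* (Y₂ :+ Y₃)
      :+ (:- (con ⅓ :* ((Y₀ :- Y₁) :* (Y₀ :- Y₁))) :+ :- (con ⅓ :* ((Y₂ :- Y₃) :* (Y₂ :- Y₃))))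
    :α Y₀ Y₁ Y₂ Y₃ = con ⅔ :* :cyclic Y₀ Y₁ Y₂ Y₃
      :+ (:- (con ⅓ :* ((Y₀ :+ Y₂ :- Y₁) :* (Y₀ :+ Y₂ :- Y₁))) :+ :- (con ⅓ :* ((Y₀ :+ Y₂ :- Y₃) :* (Y₀ :+ Y₂ :- Y₃))))
      :+ ((con 3ℚ :- Y₀) :* (con 3ℚ :- Y₀) :- con 3ℚ :+ con 2ℚ :* Y₀ :+ Y₂ :* Y₂ :+ con 4ℚ :* Y₂)

    :at : ((Y₀ Y₁ Y₂ Y₃ : Polynomial 3) → Polynomial 3) → (A B k : Polynomial 3) → Polynomial 3
    :at P A B k = P (:Y₀ A B k) (:Y₁ A B k) (:Y₂ A B k) (:Y₃ A B k)

  6ℚ 9ℚ : ℚ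
  6ℚ = + 6 / 1
  9ℚ = + 9 / 1

  -- Since Y₀ + Y₁ - 3 = 3 (B - ¼) and Y₃ + Y₀ - 3 = 3 (A - ¼), the edge 01 overflows for B > ¼ and
  -- the edge 30 for A > ¼. Each of the five identities serves one region and counts the squares of
  -- just these overflows; here there are none.
  β-slack₁ : ∀ A B k → β-at A B k + 6ℚ * (k * k + (B - A) * (B + A) + B * (1ℚ - 3ℚ * B)) ≡ 18ℚ
  β-slack₁ = solve 3 (λ A B k → :at :β A B k
    :+ con 6ℚ :* (k :* k :+ (B :- A) :* (B :+ A) :+ B :* (con 1ℚ :- con 3ℚ :* B)) := con 18ℚ) refl

  β-slack₂ : ∀ A B k → let u = ¾ - B in
    β-at A B k + 3ℚ * (u * (½ - u) + ½ * (u - A) + 2ℚ * A * (¼ - A) + 2ℚ * (k * k))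
    ≡ 18ℚ + (Y₀ A B k + Y₁ A B k - 3ℚ) * (Y₀ A B k + Y₁ A B k - 3ℚ)
  β-slack₂ = solve 3 (λ A B k → let u = con ¾ :- B in :at :β A B k
    :+ con 3ℚ :* (u :* (con ½ :- u) :+ con ½ :* (u :- A) :+ con 2ℚ :* A :* (con ¼ :- A) :+ con 2ℚ :* (k :* k))
    := con 18ℚ :+ (:Y₀ A B k :+ :Y₁ A B k :- con 3ℚ) :* (:Y₀ A B k :+ :Y₁ A B k :- con 3ℚ)) refl

  -- For u ≤ A the term ½ (u - A) of `β-slack₂` is nonpositive. The constraint Y₂ ≥ 0, which reads k
  -- ≥ v, makes up for it through k² ≥ v².
  β-slack₂′ : ∀ A B k → let u = ¾ - B; v = A - u in
    β-at A B k + 3ℚ * (u * (4ℚ * (¼ - A) + u) + 2ℚ * ((k - v) * (k + v)))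
    ≡ 18ℚ + (Y₀ A B k + Y₁ A B k - 3ℚ) * (Y₀ A B k + Y₁ A B k - 3ℚ)
  β-slack₂′ = solve 3 (λ A B k → let u = con ¾ :- B; v = A :- u in :at :β A B k
    :+ con 3ℚ :* (u :* (con 4ℚ :* (con ¼ :- A) :+ u) :+ con 2ℚ :* ((k :- v) :* (k :+ v)))
    := con 18ℚ :+ (:Y₀ A B k :+ :Y₁ A B k :- con 3ℚ) :* (:Y₀ A B k :+ :Y₁ A B k :- con 3ℚ)) refl

  β-slack₃ : ∀ A B k → let u = ¾ - B in
    β-at A B k + 3ℚ * ((u - A) * (¼ + (B - A)) + ¼ * ((u - A) + (B - A)) + 2ℚ * (k * k))
    ≡ 18ℚ + ((Y₀ A B k + Y₁ A B k - 3ℚ) * (Y₀ A B k + Y₁ A B k - 3ℚ) + (Y₃ A B k + Y₀ A B k - 3ℚ) * (Y₃ A B k + Y₀ A B k - 3ℚ))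
  β-slack₃ = solve 3 (λ A B k → let u = con ¾ :- B in :at :β A B k
    :+ con 3ℚ :* ((u :- A) :* (con ¼ :+ (B :- A)) :+ con ¼ :* ((u :- A) :+ (B :- A)) :+ con 2ℚ :* (k :* k))
    := con 18ℚ :+ ((:Y₀ A B k :+ :Y₁ A B k :- con 3ℚ) :* (:Y₀ A B k :+ :Y₁ A B k :- con 3ℚ)
      :+ (:Y₃ A B k :+ :Y₀ A B k :- con 3ℚ) :* (:Y₃ A B k :+ :Y₀ A B k :- con 3ℚ))) refl

  -- Serves ¼ ≤ A and u ≤ A, where the β-bound can exceed the allowance, for instance at A = B =
  -- 7/16, k = 1/8. The slack vanishes for A + B = 1, k = ¼, that is Y₀ = 3 and Y₂ = 0: one class
  -- full and the opposite one empty.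
  α-slack : ∀ A B k → let v = A - (¾ - B) in
    α-at A B k + 9ℚ * ((k - v) * (k + v) + ⅓ * ((1ℚ - A - B) * (1ℚ - A - B)))
    ≡ 18ℚ + ((Y₀ A B k + Y₁ A B k - 3ℚ) * (Y₀ A B k + Y₁ A B k - 3ℚ) + (Y₃ A B k + Y₀ A B k - 3ℚ) * (Y₃ A B k + Y₀ A B k - 3ℚ))
  α-slack = solve 3 (λ A B k → let v = A :- (con ¾ :- B) in :at :α A B k
    :+ con 9ℚ :* ((k :- v) :* (k :+ v) :+ con ⅓ :* ((con 1ℚ :- A :- B) :* (con 1ℚ :- A :- B)))
    := con 18ℚ :+ ((:Y₀ A B k :+ :Y₁ A B k :- con 3ℚ) :* (:Y₀ A B k :+ :Y₁ A B k :- con 3ℚ)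
      :+ (:Y₃ A B k :+ :Y₀ A B k :- con 3ℚ) :* (:Y₃ A B k :+ :Y₀ A B k :- con 3ℚ))) refl

  overflow-nonNeg : ∀ Y Z → 0ℚ ≤ overflow Y Z
  overflow-nonNeg Y Z = 0≤-square ((Y + Z - 3ℚ) ⁺)

  0≤½ : 0ℚ ≤ ½
  0≤½ = nonNegative⁻¹ ½

  module Sorted (A B k : ℚ) (0≤A : 0ℚ ≤ A) (A≤B : A ≤ B) (B≤¾ : B ≤ ¾) (v≤k : A - (¾ - B) ≤ k) where

    private
      u = ¾ - B
      v = A - u
      Z₀₁ = Y₀ A B k + Y₁ A B k - 3ℚ
      Z₃₀ = Y₃ A B k + Y₀ A B k - 3ℚ

      0≤u : 0ℚ ≤ u
      0≤u = 0≤-diff B≤¾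

      0≤B : 0ℚ ≤ B
      0≤B = ≤-trans 0≤A A≤B

      0≤k² : 0ℚ ≤ k * k
      0≤k² = 0≤-square k

      0≤k²-v² : u ≤ A → 0ℚ ≤ (k - v) * (k + v)
      0≤k²-v² u≤A = 0≤-* (0≤-diff v≤k) (0≤-+ (≤-trans (0≤-diff u≤A) v≤k) (0≤-diff u≤A))

      0≤Z₀₁ : ¼ ≤ B → 0ℚ ≤ Z₀₁
      0≤Z₀₁ ¼≤B = subst (0ℚ ≤_) (value A B k) (0≤-* (nonNegative⁻¹ 3ℚ) (0≤-diff ¼≤B))
        where
        value : ∀ A B k → 3ℚ * (B - ¼) ≡ Y₀ A B k + Y₁ A B k - 3ℚ
        value = solve 3 (λ A B k → con 3ℚ :* (B :- con ¼) := :Y₀ A B k :+ :Y₁ A B k :- con 3ℚ) refl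

      0≤Z₃₀ : ¼ ≤ A → 0ℚ ≤ Z₃₀
      0≤Z₃₀ ¼≤A = subst (0ℚ ≤_) (value A B k) (0≤-* (nonNegative⁻¹ 3ℚ) (0≤-diff ¼≤A))
        where
        value : ∀ A B k → 3ℚ * (A - ¼) ≡ Y₃ A B k + Y₀ A B k - 3ℚ
        value = solve 3 (λ A B k → con 3ℚ :* (A :- con ¼) := :Y₃ A B k :+ :Y₀ A B k :- con 3ℚ) refl

      allowed : ∀ p q r s → 0ℚ ≤ q → 0ℚ ≤ r → p + s ≤ p + q + r + s
      allowed p q r s 0≤q 0≤r = ≤-by (q + r) (0≤-+ 0≤q 0≤r) (move p q r s)
        where
        move : ∀ p q r s → p + s + (q + r) ≡ p + q + r + s
        move = solve 4 (λ p q r s → p :+ s :+ (q :+ r) := p :+ q :+ r :+ s) refl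

      ov₀₁ = overflow (Y₀ A B k) (Y₁ A B k)
      ov₁₂ = overflow (Y₁ A B k) (Y₂ A B k)
      ov₂₃ = overflow (Y₂ A B k) (Y₃ A B k)
      ov₃₀ = overflow (Y₃ A B k) (Y₀ A B k)
      0≤ov₀₁ = overflow-nonNeg (Y₀ A B k) (Y₁ A B k)
      0≤ov₁₂ = overflow-nonNeg (Y₁ A B k) (Y₂ A B k)
      0≤ov₂₃ = overflow-nonNeg (Y₂ A B k) (Y₃ A B k)
      0≤ov₃₀ = overflow-nonNeg (Y₃ A B k) (Y₀ A B k)

      allow₂ : ∀ {s t} → s ≤ ov₀₁ → t ≤ ov₃₀ → 18ℚ + (s + t) ≤ allowance-at A B k
      allow₂ s≤ t≤ = +-monoʳ-≤ 18ℚ (≤-trans (+-mono-≤ s≤ t≤) (allowed ov₀₁ ov₁₂ ov₂₃ ov₃₀ 0≤ov₁₂ 0≤ov₂₃))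

      allow₁ : ∀ {s} → s ≤ ov₀₁ → 18ℚ + s ≤ allowance-at A B k
      allow₁ {s} s≤ = subst (λ t → 18ℚ + t ≤ allowance-at A B k) (+-identityʳ s) (allow₂ s≤ 0≤ov₃₀)

      allow₀ : 18ℚ ≤ allowance-at A B k
      allow₀ = subst (_≤ allowance-at A B k) (+-identityʳ 18ℚ) (allow₁ 0≤ov₀₁)

      u≤½ : ¼ ≤ B → 0ℚ ≤ ½ - u
      u≤½ ¼≤B = subst (0ℚ ≤_) (value B) (0≤-diff ¼≤B)
        where
        value : ∀ B → B - ¼ ≡ ½ - (¾ - B)
        value = solve 1 (λ B → B :- con ¼ := con ½ :- (con ¾ :- B)) refl

      scaled : ∀ n {{_ : ℚ.NonNegative n}} {x} → 0ℚ ≤ x → 0ℚ ≤ n * x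
      scaled n 0≤x = 0≤-* (nonNegative⁻¹ n) 0≤x

    -- The thresholds ¼ tell which edges overflow. The comparison of A with u tells whether Y₂ ≥ 0
    -- keeps k away from 0: v is nonnegative exactly when u ≤ A.
    bounded : β-at A B k ≤ allowance-at A B k ⊎ α-at A B k ≤ allowance-at A B k
    bounded with ≤-total B ¼ | ≤-total A ¼ | ≤-total A u
    ... | inj₁ B≤¼ | _ | _ = inj₁ (≤-trans (≤-by (6ℚ * (k * k + (B - A) * (B + A) + B * (1ℚ - 3ℚ * B)))
            (scaled 6ℚ (0≤-+ (0≤-+ 0≤k² (0≤-* (0≤-diff A≤B) (0≤-+ 0≤B 0≤A)))
              (0≤-* 0≤B (0≤-diff (≤-trans (*-monoˡ-≤-nonNeg 3ℚ B≤¼) (toWitness {a? = 3ℚ * ¼ ≤? 1ℚ} _))))))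
            (β-slack₁ A B k)) allow₀)
    ... | inj₂ ¼≤B | inj₁ A≤¼ | inj₁ A≤u = inj₁ (≤-trans
            (≤-by (3ℚ * (u * (½ - u) + ½ * (u - A) + 2ℚ * A * (¼ - A) + 2ℚ * (k * k)))
              (scaled 3ℚ (0≤-+ (0≤-+ (0≤-+ (0≤-* 0≤u (u≤½ ¼≤B)) (scaled ½ (0≤-diff A≤u)))
                (0≤-* (scaled 2ℚ 0≤A) (0≤-diff A≤¼))) (scaled 2ℚ 0≤k²)))
              (β-slack₂ A B k))
            (allow₁ (⁺-square (0≤Z₀₁ ¼≤B))))
    ... | inj₂ ¼≤B | inj₁ A≤¼ | inj₂ u≤A = inj₁ (≤-trans
            (≤-by (3ℚ * (u * (4ℚ * (¼ - A) + u) + 2ℚ * ((k - v) * (k + v))))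
              (scaled 3ℚ (0≤-+ (0≤-* 0≤u (0≤-+ (scaled 4ℚ (0≤-diff A≤¼)) 0≤u)) (scaled 2ℚ (0≤k²-v² u≤A))))
              (β-slack₂′ A B k))
            (allow₁ (⁺-square (0≤Z₀₁ ¼≤B))))
    ... | inj₂ ¼≤B | inj₂ ¼≤A | inj₁ A≤u = inj₁ (≤-trans
            (≤-by (3ℚ * ((u - A) * (¼ + (B - A)) + ¼ * ((u - A) + (B - A)) + 2ℚ * (k * k)))
              (scaled 3ℚ (0≤-+ (0≤-+ (0≤-* (0≤-diff A≤u) (0≤-+ (nonNegative⁻¹ ¼) (0≤-diff A≤B)))
                (scaled ¼ (0≤-+ (0≤-diff A≤u) (0≤-diff A≤B)))) (scaled 2ℚ 0≤k²)))
              (β-slack₃ A B k))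
            (allow₂ (⁺-square (0≤Z₀₁ ¼≤B)) (⁺-square (0≤Z₃₀ ¼≤A))))
    ... | inj₂ ¼≤B | inj₂ ¼≤A | inj₂ u≤A = inj₂ (≤-trans
            (≤-by (9ℚ * ((k - v) * (k + v) + ⅓ * ((1ℚ - A - B) * (1ℚ - A - B))))
              (scaled 9ℚ (0≤-+ (0≤k²-v² u≤A) (scaled ⅓ (0≤-square (1ℚ - A - B)))))
              (α-slack A B k))
            (allow₂ (⁺-square (0≤Z₀₁ ¼≤B)) (⁺-square (0≤Z₃₀ ¼≤A))))

  -- The inequality for arbitrary triples, by the symmetries of the 4-cycle.

  Claim : Triple → Triple → Triple → Triple → Set
  Claim y₀ y₁ y₂ y₃ = excess y₀ y₁ y₂ y₃ ≤ allowance (total y₀) (total y₁) (total y₂) (total y₃)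

  9/2 1/6 : ℚ
  9/2 = + 9 / 2
  1/6 = + 1 / 6

  module _ {y₀ y₁ y₂ y₃ : Triple} (c₀ : InCube y₀) (c₁ : InCube y₁) (c₂ : InCube y₂) (c₃ : InCube y₃)
    (density : total y₀ + total y₁ + total y₂ + total y₃ ≡ 9/2) where

    private
      t₀ = total y₀
      t₁ = total y₁
      t₂ = total y₂
      t₃ = total y₃

    private
      A = 1/6 * (t₀ + t₃ - t₁ - t₂)
      B = 1/6 * (t₀ + t₁ - t₂ - t₃)
      k = 1/6 * (t₀ + t₂ - t₁ - t₃)

      Y₀≡t₀ : Y₀ A B k ≡ t₀
      Y₀≡t₀ = trans (cong (λ s → + 3 / 2 * (1/6 * s + k + A + B)) (sym density)) (value t₀ t₁ t₂ t₃)
        where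
        value : ∀ t₀ t₁ t₂ t₃ → + 3 / 2 * (1/6 * (t₀ + t₁ + t₂ + t₃) + 1/6 * (t₀ + t₂ - t₁ - t₃)
          + 1/6 * (t₀ + t₃ - t₁ - t₂) + 1/6 * (t₀ + t₁ - t₂ - t₃)) ≡ t₀
        value = solve 4 (λ t₀ t₁ t₂ t₃ → con (+ 3 / 2) :* (con 1/6 :* (t₀ :+ t₁ :+ t₂ :+ t₃) :+ con 1/6 :* (t₀ :+ t₂ :- t₁ :- t₃)
          :+ con 1/6 :* (t₀ :+ t₃ :- t₁ :- t₂) :+ con 1/6 :* (t₀ :+ t₁ :- t₂ :- t₃)) := t₀) refl

      Y₁≡t₁ : Y₁ A B k ≡ t₁
      Y₁≡t₁ = trans (cong (λ s → + 3 / 2 * (1/6 * s - k - A + B)) (sym density)) (value t₀ t₁ t₂ t₃)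
        where
        value : ∀ t₀ t₁ t₂ t₃ → + 3 / 2 * (1/6 * (t₀ + t₁ + t₂ + t₃) - 1/6 * (t₀ + t₂ - t₁ - t₃)
          - 1/6 * (t₀ + t₃ - t₁ - t₂) + 1/6 * (t₀ + t₁ - t₂ - t₃)) ≡ t₁
        value = solve 4 (λ t₀ t₁ t₂ t₃ → con (+ 3 / 2) :* (con 1/6 :* (t₀ :+ t₁ :+ t₂ :+ t₃) :- con 1/6 :* (t₀ :+ t₂ :- t₁ :- t₃)
          :- con 1/6 :* (t₀ :+ t₃ :- t₁ :- t₂) :+ con 1/6 :* (t₀ :+ t₁ :- t₂ :- t₃)) := t₁) refl

      Y₂≡t₂ : Y₂ A B k ≡ t₂
      Y₂≡t₂ = trans (cong (λ s → + 3 / 2 * (1/6 * s + k - A - B)) (sym density)) (value t₀ t₁ t₂ t₃)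
        where
        value : ∀ t₀ t₁ t₂ t₃ → + 3 / 2 * (1/6 * (t₀ + t₁ + t₂ + t₃) + 1/6 * (t₀ + t₂ - t₁ - t₃)
          - 1/6 * (t₀ + t₃ - t₁ - t₂) - 1/6 * (t₀ + t₁ - t₂ - t₃)) ≡ t₂
        value = solve 4 (λ t₀ t₁ t₂ t₃ → con (+ 3 / 2) :* (con 1/6 :* (t₀ :+ t₁ :+ t₂ :+ t₃) :+ con 1/6 :* (t₀ :+ t₂ :- t₁ :- t₃)
          :- con 1/6 :* (t₀ :+ t₃ :- t₁ :- t₂) :- con 1/6 :* (t₀ :+ t₁ :- t₂ :- t₃)) := t₂) refl

      Y₃≡t₃ : Y₃ A B k ≡ t₃
      Y₃≡t₃ = trans (cong (λ s → + 3 / 2 * (1/6 * s - k + A - B)) (sym density)) (value t₀ t₁ t₂ t₃)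
        where
        value : ∀ t₀ t₁ t₂ t₃ → + 3 / 2 * (1/6 * (t₀ + t₁ + t₂ + t₃) - 1/6 * (t₀ + t₂ - t₁ - t₃)
          + 1/6 * (t₀ + t₃ - t₁ - t₂) - 1/6 * (t₀ + t₁ - t₂ - t₃)) ≡ t₃
        value = solve 4 (λ t₀ t₁ t₂ t₃ → con (+ 3 / 2) :* (con 1/6 :* (t₀ :+ t₁ :+ t₂ :+ t₃) :- con 1/6 :* (t₀ :+ t₂ :- t₁ :- t₃)
          :+ con 1/6 :* (t₀ :+ t₃ :- t₁ :- t₂) :- con 1/6 :* (t₀ :+ t₁ :- t₂ :- t₃)) := t₃) refl

      at-totals : (P : ℚ → ℚ → ℚ → ℚ → Set) →
        P (Y₀ A B k) (Y₁ A B k) (Y₂ A B k) (Y₃ A B k) → P t₀ t₁ t₂ t₃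
      at-totals P p = subst (λ t → P t t₁ t₂ t₃) Y₀≡t₀ (subst (λ t → P (Y₀ A B k) t t₂ t₃) Y₁≡t₁
        (subst (λ t → P (Y₀ A B k) (Y₁ A B k) t t₃) Y₂≡t₂ (subst (P (Y₀ A B k) (Y₁ A B k) (Y₂ A B k)) Y₃≡t₃ p)))

      B≤¾ : B ≤ ¾
      B≤¾ = ≤-by (⅓ * (t₂ + t₃)) (0≤-* (nonNegative⁻¹ ⅓) (0≤-+ (total-nonNeg c₂) (total-nonNeg c₃)))
        (trans (value t₀ t₁ t₂ t₃) (cong (1/6 *_) density))
        where
        value : ∀ t₀ t₁ t₂ t₃ → 1/6 * (t₀ + t₁ - t₂ - t₃) + ⅓ * (t₂ + t₃) ≡ 1/6 * (t₀ + t₁ + t₂ + t₃)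
        value = solve 4 (λ t₀ t₁ t₂ t₃ → con 1/6 :* (t₀ :+ t₁ :- t₂ :- t₃) :+ con ⅓ :* (t₂ :+ t₃)
          := con 1/6 :* (t₀ :+ t₁ :+ t₂ :+ t₃)) refl

      -- This is Y₂ ≥ 0, rescaled.
      v≤k : A - (¾ - B) ≤ k
      v≤k = ≤-by (⅔ * Y₂ A B k) (0≤-* (nonNegative⁻¹ ⅔) (subst (0ℚ ≤_) (sym Y₂≡t₂) (total-nonNeg c₂))) (value A B k)
        where
        value : ∀ A B k → A - (¾ - B) + ⅔ * (+ 3 / 2 * (¾ + k - A - B)) ≡ k
        value = solve 3 (λ A B k → A :- (con ¾ :- B) :+ con ⅔ :* (con (+ 3 / 2) :* (con ¾ :+ k :- A :- B)) := k) refl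

    -- In the coordinates of the 4-cycle the two hypotheses are A ≤ B and 0 ≤ A.
    sorted-claim : t₃ ≤ t₁ → t₁ - t₃ ≤ t₀ - t₂ → Claim y₀ y₁ y₂ y₃
    sorted-claim t₃≤t₁ gap = [ via-β , via-α ]′ (Sorted.bounded A B k 0≤A A≤B B≤¾ v≤k)
      where
      0≤A : 0ℚ ≤ A
      0≤A = ≤-by (1/6 * ((t₀ - t₂) - (t₁ - t₃))) (0≤-* (nonNegative⁻¹ 1/6) (0≤-diff gap)) (value t₀ t₁ t₂ t₃)
        where
        value : ∀ t₀ t₁ t₂ t₃ → 0ℚ + 1/6 * ((t₀ - t₂) - (t₁ - t₃)) ≡ 1/6 * (t₀ + t₃ - t₁ - t₂)
        value = solve 4 (λ t₀ t₁ t₂ t₃ → con 0ℚ :+ con 1/6 :* ((t₀ :- t₂) :- (t₁ :- t₃))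
          := con 1/6 :* (t₀ :+ t₃ :- t₁ :- t₂)) refl
      A≤B : A ≤ B
      A≤B = ≤-by (⅓ * (t₁ - t₃)) (0≤-* (nonNegative⁻¹ ⅓) (0≤-diff t₃≤t₁)) (value t₀ t₁ t₂ t₃)
        where
        value : ∀ t₀ t₁ t₂ t₃ → 1/6 * (t₀ + t₃ - t₁ - t₂) + ⅓ * (t₁ - t₃) ≡ 1/6 * (t₀ + t₁ - t₂ - t₃)
        value = solve 4 (λ t₀ t₁ t₂ t₃ → con 1/6 :* (t₀ :+ t₃ :- t₁ :- t₂) :+ con ⅓ :* (t₁ :- t₃)
          := con 1/6 :* (t₀ :+ t₁ :- t₂ :- t₃)) refl
      via-β : β-at A B k ≤ allowance-at A B k → Claim y₀ y₁ y₂ y₃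
      via-β β≤ = ≤-trans (excess-≤-β c₀ c₁ c₂ c₃)
        (at-totals (λ a b c d → β-bound a b c d ≤ allowance a b c d) β≤)
      via-α : α-at A B k ≤ allowance-at A B k → Claim y₀ y₁ y₂ y₃
      via-α α≤ = ≤-trans (excess-≤-α c₀ c₁ c₂ c₃)
        (at-totals (λ a b c d → α-bound a b c d ≤ allowance a b c d) α≤)

  private
    transport : ∀ {S S′ P P′ N N′ R R′ : ℚ} → S ≡ S′ → P ≡ P′ → N ≡ N′ → R ≡ R′ →
      ⅔ * S + 2ℚ * P - N ≤ 18ℚ + R → ⅔ * S′ + 2ℚ * P′ - N′ ≤ 18ℚ + R′
    transport refl refl refl refl le = le

    overflow-comm : ∀ Y Z → overflow Y Z ≡ overflow Z Y
    overflow-comm Y Z = cong (λ s → (s - 3ℚ) ⁺ * (s - 3ℚ) ⁺) (+-comm Y Z)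

    rotate : ∀ a b c d → a + b + c + d ≡ b + a + d + c
    rotate = solve 4 (λ a b c d → a :+ b :+ c :+ d := b :+ a :+ d :+ c) refl

    flip : ∀ a b c d → a + b + c + d ≡ d + c + b + a
    flip = solve 4 (λ a b c d → a :+ b :+ c :+ d := d :+ c :+ b :+ a) refl

    swap₀₂ : ∀ a b c d → a + b + c + d ≡ c + b + a + d
    swap₀₂ = solve 4 (λ a b c d → a :+ b :+ c :+ d := c :+ b :+ a :+ d) refl

    swap₁₃ : ∀ a b c d → a + b + c + d ≡ a + d + c + b
    swap₁₃ = solve 4 (λ a b c d → a :+ b :+ c :+ d := a :+ d :+ c :+ b) refl

    square-comm : ∀ Y Z → (Y + Z) * (Y + Z) ≡ (Z + Y) * (Z + Y)
    square-comm Y Z = cong (λ s → s * s) (+-comm Y Z)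

    sum₄-cong : ∀ {a b c d a′ b′ c′ d′ : ℚ} → a ≡ a′ → b ≡ b′ → c ≡ c′ → d ≡ d′ → a + b + c + d ≡ a′ + b′ + c′ + d′
    sum₄-cong refl refl refl refl = refl

  -- Every sum in the claim runs over the vertices or the edges of the 4-cycle. This reflection,
  -- `claim-swap₁₃` and `claim-exchange` generate its eight symmetries, enough to reach the sorted
  -- case.
  claim-swap₀₂ : ∀ y₀ y₁ y₂ y₃ → Claim y₂ y₁ y₀ y₃ → Claim y₀ y₁ y₂ y₃
  claim-swap₀₂ y₀ y₁ y₂ y₃ = transport
    (edges (λ y z → (total y + total z) * (total y + total z)) (λ y z → square-comm (total y) (total z)))
    (edges _∙_ ∙-comm)
    (swap₀₂ (y₂ ∙ y₂) (y₁ ∙ y₁) (y₀ ∙ y₀) (y₃ ∙ y₃))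
    (edges (λ y z → overflow (total y) (total z)) (λ y z → overflow-comm (total y) (total z)))
    where
    edges : (e : Triple → Triple → ℚ) → (∀ y z → e y z ≡ e z y) →
      e y₂ y₁ + e y₁ y₀ + e y₀ y₃ + e y₃ y₂ ≡ e y₀ y₁ + e y₁ y₂ + e y₂ y₃ + e y₃ y₀
    edges e comm = trans (rotate (e y₂ y₁) (e y₁ y₀) (e y₀ y₃) (e y₃ y₂))
      (sum₄-cong (comm y₁ y₀) (comm y₂ y₁) (comm y₃ y₂) (comm y₀ y₃))

  claim-swap₁₃ : ∀ y₀ y₁ y₂ y₃ → Claim y₀ y₃ y₂ y₁ → Claim y₀ y₁ y₂ y₃
  claim-swap₁₃ y₀ y₁ y₂ y₃ = transport
    (edges (λ y z → (total y + total z) * (total y + total z)) (λ y z → square-comm (total y) (total z)))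
    (edges _∙_ ∙-comm)
    (swap₁₃ (y₀ ∙ y₀) (y₃ ∙ y₃) (y₂ ∙ y₂) (y₁ ∙ y₁))
    (edges (λ y z → overflow (total y) (total z)) (λ y z → overflow-comm (total y) (total z)))
    where
    edges : (e : Triple → Triple → ℚ) → (∀ y z → e y z ≡ e z y) →
      e y₀ y₃ + e y₃ y₂ + e y₂ y₁ + e y₁ y₀ ≡ e y₀ y₁ + e y₁ y₂ + e y₂ y₃ + e y₃ y₀
    edges e comm = trans (flip (e y₀ y₃) (e y₃ y₂) (e y₂ y₁) (e y₁ y₀))
      (sum₄-cong (comm y₁ y₀) (comm y₂ y₁) (comm y₃ y₂) (comm y₀ y₃))

  claim-exchange : ∀ y₀ y₁ y₂ y₃ → Claim y₁ y₀ y₃ y₂ → Claim y₀ y₁ y₂ y₃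
  claim-exchange y₀ y₁ y₂ y₃ = transport
    (edges (λ y z → (total y + total z) * (total y + total z)) (λ y z → square-comm (total y) (total z)))
    (edges _∙_ ∙-comm)
    (rotate (y₁ ∙ y₁) (y₀ ∙ y₀) (y₃ ∙ y₃) (y₂ ∙ y₂))
    (edges (λ y z → overflow (total y) (total z)) (λ y z → overflow-comm (total y) (total z)))
    where
    edges : (e : Triple → Triple → ℚ) → (∀ y z → e y z ≡ e z y) →
      e y₁ y₀ + e y₀ y₃ + e y₃ y₂ + e y₂ y₁ ≡ e y₀ y₁ + e y₁ y₂ + e y₂ y₃ + e y₃ y₀
    edges e comm = trans (swap₁₃ (e y₁ y₀) (e y₀ y₃) (e y₃ y₂) (e y₂ y₁))
      (sum₄-cong (comm y₁ y₀) (comm y₂ y₁) (comm y₃ y₂) (comm y₀ y₃))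

  -- Opposite vertices are swapped until each diagonal decreases from y₀ to y₂ and from y₁ to y₃;
  -- then the diagonal with the larger gap is placed at y₀, y₂. Equality holds for triples constant
  -- with values 1, c, 0, ½ - c, where 0 ≤ c ≤ ½.
  excess-≤-allowance : ∀ {y₀ y₁ y₂ y₃} → InCube y₀ → InCube y₁ → InCube y₂ → InCube y₃ →
    total y₀ + total y₁ + total y₂ + total y₃ ≡ 9/2 → Claim y₀ y₁ y₂ y₃
  excess-≤-allowance = arrange₀₂
    where
    arrange : ∀ {y₀ y₁ y₂ y₃} → InCube y₀ → InCube y₁ → InCube y₂ → InCube y₃ →
      total y₀ + total y₁ + total y₂ + total y₃ ≡ 9/2 → total y₂ ≤ total y₀ → total y₃ ≤ total y₁ → Claim y₀ y₁ y₂ y₃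
    arrange {y₀} {y₁} {y₂} {y₃} c₀ c₁ c₂ c₃ density t₂≤t₀ t₃≤t₁ =
      [ sorted-claim c₀ c₁ c₂ c₃ density t₃≤t₁
      , (λ gap → claim-exchange y₀ y₁ y₂ y₃ (sorted-claim c₁ c₀ c₃ c₂
          (trans (rotate (total y₁) (total y₀) (total y₃) (total y₂)) density) t₂≤t₀ gap))
      ]′ (≤-total (total y₁ - total y₃) (total y₀ - total y₂))
    arrange₁₃ : ∀ {y₀ y₁ y₂ y₃} → InCube y₀ → InCube y₁ → InCube y₂ → InCube y₃ →
      total y₀ + total y₁ + total y₂ + total y₃ ≡ 9/2 → total y₂ ≤ total y₀ → Claim y₀ y₁ y₂ y₃
    arrange₁₃ {y₀} {y₁} {y₂} {y₃} c₀ c₁ c₂ c₃ density t₂≤t₀ =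
      [ arrange c₀ c₁ c₂ c₃ density t₂≤t₀
      , (λ t₁≤t₃ → claim-swap₁₃ y₀ y₁ y₂ y₃ (arrange c₀ c₃ c₂ c₁
          (trans (swap₁₃ (total y₀) (total y₃) (total y₂) (total y₁)) density) t₂≤t₀ t₁≤t₃))
      ]′ (≤-total (total y₃) (total y₁))
    arrange₀₂ : ∀ {y₀ y₁ y₂ y₃} → InCube y₀ → InCube y₁ → InCube y₂ → InCube y₃ →
      total y₀ + total y₁ + total y₂ + total y₃ ≡ 9/2 → Claim y₀ y₁ y₂ y₃
    arrange₀₂ {y₀} {y₁} {y₂} {y₃} c₀ c₁ c₂ c₃ density =
      [ arrange₁₃ c₀ c₁ c₂ c₃ density
      , (λ t₀≤t₂ → claim-swap₀₂ y₀ y₁ y₂ y₃ (arrange₁₃ c₂ c₁ c₀ c₃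
          (trans (swap₀₂ (total y₂) (total y₁) (total y₀) (total y₃)) density) t₀≤t₂))
      ]′ (≤-total (total y₂) (total y₀))

  -- From means over ℤ/q to the grid ℤ/4 × ℤ/3.

  -- Both sides equal the double mean of f (i + j), with i over one period and j over the other.
  mean-periods : ∀ p r .{{_ : NonZero p}} .{{_ : NonZero r}} {f} → Periodic p f → Periodic r f → mean p f ≡ mean r f
  mean-periods p r {f} per-p per-r = begin
    mean p f                                        ≡⟨ sym (mean-const r _) ⟩
    mean r (λ j → mean p f)                         ≡⟨ mean-cong r (λ j → sym (mean-shift p per-p j)) ⟩
    mean r (λ j → mean p (λ i → f (i ℕ.+ j)))       ≡⟨ mean-swap r p _ ⟩
    mean p (λ i → mean r (λ j → f (i ℕ.+ j)))       ≡⟨ mean-cong p (λ i → mean-cong r (λ j → cong f (ℕ.+-comm i j))) ⟩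
    mean p (λ i → mean r (λ j → f (j ℕ.+ i)))       ≡⟨ mean-cong p (λ i → mean-shift r per-r i) ⟩
    mean p (λ i → mean r f)                         ≡⟨ mean-const p _ ⟩
    mean r f                                        ∎
    where open ≡-Reasoning

  -- A formal linear combination of functions, so that `mean-combine` takes the mean of a long
  -- expression in one step.
  Combination : Set
  Combination = List (ℚ × (ℕ → ℚ))

  combine : Combination → ℕ → ℚ
  combine []            i = 0ℚ
  combine ((k , f) ∷ l) i = k * f i + combine l i

  module _ (q : ℕ) .{{_ : NonZero q}} where

    combine-means : Combination → ℚ
    combine-means []            = 0ℚ
    combine-means ((k , f) ∷ l) = k * mean q f + combine-means l

    mean-combine : ∀ l → mean q (combine l) ≡ combine-means l
    mean-combine []            = mean-const q 0ℚ
    mean-combine ((k , f) ∷ l) = trans (mean-+ q _ _) (cong₂ _+_ (mean-* q k f) (mean-combine l))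

    -- The mean over the grid translated by n is unchanged by n ↦ n + a, n + b and n + c, hence by n
    -- ↦ n + 1 as a + b = c + 1, and is constant. This replaces a Chinese remainder bijection; it is
    -- applied with 9 + 4 = 12 + 1.
    mean-grid : ∀ r s .{{_ : NonZero r}} .{{_ : NonZero s}} a b c → a ℕ.+ b ≡ suc c → ∀ {f} →
      Periodic q f → Periodic (r ℕ.* a) f → Periodic (s ℕ.* b) f → Periodic c f →
      mean q f ≡ mean r (λ j → mean s λ m → f (j ℕ.* a ℕ.+ m ℕ.* b))
    mean-grid r s a b c a+b≡1+c {f} per per-a per-b per-c = begin
      mean q f
        ≡⟨ sym (trans (mean-cong r (λ j → mean-const s _)) (mean-const r _)) ⟩
      mean r (λ j → mean s λ m → mean q f)
        ≡⟨ mean-cong r (λ j → mean-cong s (λ m → sym (mean-shift q per (j ℕ.* a ℕ.+ m ℕ.* b)))) ⟩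
      mean r (λ j → mean s λ m → mean q λ n → f (n ℕ.+ (j ℕ.* a ℕ.+ m ℕ.* b)))
        ≡⟨ mean-cong r (λ j → mean-swap s q _) ⟩
      mean r (λ j → mean q λ n → mean s λ m → f (n ℕ.+ (j ℕ.* a ℕ.+ m ℕ.* b)))
        ≡⟨ mean-swap r q _ ⟩
      mean q grid
        ≡⟨ mean-cong q grid-constant ⟩
      mean q (λ n → grid 0)
        ≡⟨ mean-const q (grid 0) ⟩
      grid 0 ∎
      where
      open ≡-Reasoning
      grid : ℕ → ℚ
      grid n = mean r (λ j → mean s λ m → f (n ℕ.+ (j ℕ.* a ℕ.+ m ℕ.* b)))
      grid+a : ∀ n → grid (n ℕ.+ a) ≡ grid n
      grid+a n = trans (mean-cong r (λ j → mean-cong s (λ m → cong f (move n a j (m ℕ.* b)))))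
        (mean-shift r {λ j → mean s λ m → f (n ℕ.+ (j ℕ.* a ℕ.+ m ℕ.* b))}
          (λ j → mean-cong s (λ m → trans (cong f (wrap n a j (m ℕ.* b) r)) (per-a (n ℕ.+ (j ℕ.* a ℕ.+ m ℕ.* b))))) 1)
        where
        move : ∀ n a j x → n ℕ.+ a ℕ.+ (j ℕ.* a ℕ.+ x) ≡ n ℕ.+ ((j ℕ.+ 1) ℕ.* a ℕ.+ x)
        move = ℕ-Ring.solve-∀
        wrap : ∀ n a j x r → n ℕ.+ ((j ℕ.+ r) ℕ.* a ℕ.+ x) ≡ n ℕ.+ (j ℕ.* a ℕ.+ x) ℕ.+ r ℕ.* a
        wrap = ℕ-Ring.solve-∀
      grid+b : ∀ n → grid (n ℕ.+ b) ≡ grid n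
      grid+b n = mean-cong r (λ j → trans (mean-cong s (λ m → cong f (move n b m (j ℕ.* a))))
        (mean-shift s {λ m → f (n ℕ.+ (j ℕ.* a ℕ.+ m ℕ.* b))}
          (λ m → trans (cong f (wrap n b m (j ℕ.* a) s)) (per-b (n ℕ.+ (j ℕ.* a ℕ.+ m ℕ.* b)))) 1))
        where
        move : ∀ n b m x → n ℕ.+ b ℕ.+ (x ℕ.+ m ℕ.* b) ≡ n ℕ.+ (x ℕ.+ (m ℕ.+ 1) ℕ.* b)
        move = ℕ-Ring.solve-∀
        wrap : ∀ n b m x s → n ℕ.+ (x ℕ.+ (m ℕ.+ s) ℕ.* b) ≡ n ℕ.+ (x ℕ.+ m ℕ.* b) ℕ.+ s ℕ.* b
        wrap = ℕ-Ring.solve-∀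
      grid+c : ∀ n → grid (n ℕ.+ c) ≡ grid n
      grid+c n = mean-cong r (λ j → mean-cong s (λ m → periodic-shift {f = f} per-c (j ℕ.* a ℕ.+ m ℕ.* b) n))
      grid-constant : ∀ n → grid n ≡ grid 0
      grid-constant zero    = refl
      grid-constant (suc n) = trans (sym (grid+c (suc n))) (trans (cong grid around)
        (trans (grid+b (n ℕ.+ a)) (trans (grid+a n) (grid-constant n))))
        where
        around : suc n ℕ.+ c ≡ n ℕ.+ a ℕ.+ b
        around = trans (sym (ℕ.+-suc n c)) (trans (cong (n ℕ.+_) (sym a+b≡1+c)) (sym (ℕ.+-assoc n a b)))

  ⁺-absorb : ∀ x → x ⁺ * x ≡ x ⁺ * x ⁺
  ⁺-absorb x = [ (λ 0≤x → cong (x ⁺ *_) (sym (p≤q⇒p⊔q≡q 0≤x)))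
               , (λ x≤0 → trans (cong (_* x) (p≥q⇒p⊔q≡p x≤0)) (trans (*-zeroˡ x)
                   (sym (trans (cong (_* x ⁺) (p≥q⇒p⊔q≡p x≤0)) (*-zeroˡ (x ⁺)))))) ]′ (≤-total 0ℚ x)

  ⁺-nonNeg : ∀ x → 0ℚ ≤ x ⁺
  ⁺-nonNeg x = p≤p⊔q 0ℚ x

  -- `deficit` in grid coordinates: 1/6 · (z + 2 z′) is the value of Tu and ⅓ · P that of η.
  deficit-at : (y₀ P z z′ : ℚ) → ℚ
  deficit-at y₀ P z z′ = 4ℚ * (1/6 * (z + 2ℚ * z′) * (1/6 * (z + 2ℚ * z′))) - y₀ * y₀
    - 4ℚ * (⅓ * P * (1/6 * (z + 2ℚ * z′))) + 2ℚ * (⅓ * P) + ⅓ * P * (⅓ * P)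

  -- The mean of `deficit` over a class modulo 4, up to the factor ⅓. The coefficients 1 and -2 of
  -- the squared norms combine to -1 only in the sum around the 4-cycle.
  class-deficit : Triple → Triple → ℚ
  class-deficit t t′ = ⅓ * (⅔ * ((total t + total t′) * (total t + total t′)) + (t′ ∙ t′ - 2ℚ * (t ∙ t) + 2ℚ * (t ∙ t′))
    - overflow (total t) (total t′))

  -- On the class η is constant, equal to x⁺/3, while 2 Tu - 1 averages to x/3. As x⁺ x = (x⁺)², the
  -- terms -2 η (2 Tu - 1) + η² average to -η².
  class-deficit-expand : ∀ a b c d e f → let P = (a + b + c + (d + e + f) - 3ℚ) ⁺ in
    deficit-at a P (a + d) (b + e) + (deficit-at b P (b + e) (c + f) + (deficit-at c P (c + f) (a + d) + 0ℚ))
    ≡ class-deficit ⟨ a , b , c ⟩ ⟨ d , e , f ⟩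
  class-deficit-expand a b c d e f = trans (expand a b c d e f P) (trans
    (cong (λ t → ⅓ * (S + N + (P * P - 2ℚ * t))) (⁺-absorb (a + b + c + (d + e + f) - 3ℚ)))
    (finish S N (P * P)))
    where
    P = (a + b + c + (d + e + f) - 3ℚ) ⁺
    S = ⅔ * ((a + b + c + (d + e + f)) * (a + b + c + (d + e + f)))
    N = d * d + e * e + f * f - 2ℚ * (a * a + b * b + c * c) + 2ℚ * (a * d + b * e + c * f)
    finish : ∀ s n p → ⅓ * (s + n + (p - 2ℚ * p)) ≡ ⅓ * (s + n - p)
    finish = solve 3 (λ s n p → con ⅓ :* (s :+ n :+ (p :- con 2ℚ :* p)) := con ⅓ :* (s :+ n :- p)) refl
    expand : ∀ a b c d e f P →
      deficit-at a P (a + d) (b + e) + (deficit-at b P (b + e) (c + f) + (deficit-at c P (c + f) (a + d) + 0ℚ))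
      ≡ ⅓ * (⅔ * ((a + b + c + (d + e + f)) * (a + b + c + (d + e + f)))
        + (d * d + e * e + f * f - 2ℚ * (a * a + b * b + c * c) + 2ℚ * (a * d + b * e + c * f))
        + (P * P - 2ℚ * (P * (a + b + c + (d + e + f) - 3ℚ))))
    expand = solve 7 (λ a b c d e f P →
      :deficit-at a P (a :+ d) (b :+ e) :+ (:deficit-at b P (b :+ e) (c :+ f) :+ (:deficit-at c P (c :+ f) (a :+ d) :+ con 0ℚ))
      := con ⅓ :* (con ⅔ :* ((a :+ b :+ c :+ (d :+ e :+ f)) :* (a :+ b :+ c :+ (d :+ e :+ f)))
        :+ (d :* d :+ e :* e :+ f :* f :- con 2ℚ :* (a :* a :+ b :* b :+ c :* c) :+ con 2ℚ :* (a :* d :+ b :* e :+ c :* f))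
        :+ (P :* P :- con 2ℚ :* (P :* (a :+ b :+ c :+ (d :+ e :+ f) :- con 3ℚ))))) refl
      where
      :deficit-at : (y₀ P z z′ : Polynomial 7) → Polynomial 7
      :deficit-at y₀ P z z′ = con 4ℚ :* (con 1/6 :* (z :+ con 2ℚ :* z′) :* (con 1/6 :* (z :+ con 2ℚ :* z′))) :- y₀ :* y₀
        :- con 4ℚ :* (con ⅓ :* P :* (con 1/6 :* (z :+ con 2ℚ :* z′))) :+ con 2ℚ :* (con ⅓ :* P) :+ con ⅓ :* P :* (con ⅓ :* P)

  -- The left side is the excess minus the overflows, divided by 36, and ½ is 18/36.
  class-deficit-≤ : ∀ {t₀ t₁ t₂ t₃} → InCube t₀ → InCube t₁ → InCube t₂ → InCube t₃ →
    total t₀ + total t₁ + total t₂ + total t₃ ≡ 9/2 →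
    + 1 / 4 * (⅓ * class-deficit t₀ t₁ + (⅓ * class-deficit t₁ t₂ + (⅓ * class-deficit t₂ t₃ + (⅓ * class-deficit t₃ t₀ + 0ℚ)))) ≤ ½
  class-deficit-≤ {t₀} {t₁} {t₂} {t₃} c₀ c₁ c₂ c₃ density = ≤-trans
    (≤-reflexive (collect (sq t₀ t₁) (sq t₁ t₂) (sq t₂ t₃) (sq t₃ t₀) (t₀ ∙ t₀) (t₁ ∙ t₁) (t₂ ∙ t₂) (t₃ ∙ t₃)
      (t₀ ∙ t₁) (t₁ ∙ t₂) (t₂ ∙ t₃) (t₃ ∙ t₀) (ov t₀ t₁) (ov t₁ t₂) (ov t₂ t₃) (ov t₃ t₀)))
    (≤-by (+ 1 / 36 * (allowance (total t₀) (total t₁) (total t₂) (total t₃) - excess t₀ t₁ t₂ t₃))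
      (0≤-* (nonNegative⁻¹ (+ 1 / 36)) (0≤-diff (excess-≤-allowance c₀ c₁ c₂ c₃ density)))
      (finish (excess t₀ t₁ t₂ t₃) (ov t₀ t₁ + ov t₁ t₂ + ov t₂ t₃ + ov t₃ t₀)))
    where
    sq ov : Triple → Triple → ℚ
    sq t t′ = (total t + total t′) * (total t + total t′)
    ov t t′ = overflow (total t) (total t′)
    finish : ∀ x o → + 1 / 36 * (x - o) + + 1 / 36 * (18ℚ + o - x) ≡ ½
    finish = solve 2 (λ x o → con (+ 1 / 36) :* (x :- o) :+ con (+ 1 / 36) :* (con 18ℚ :+ o :- x) := con ½) refl
    collect : ∀ s₀ s₁ s₂ s₃ n₀ n₁ n₂ n₃ x₀ x₁ x₂ x₃ o₀ o₁ o₂ o₃ →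
      + 1 / 4 * (⅓ * (⅓ * (⅔ * s₀ + (n₁ - 2ℚ * n₀ + 2ℚ * x₀) - o₀)) + (⅓ * (⅓ * (⅔ * s₁ + (n₂ - 2ℚ * n₁ + 2ℚ * x₁) - o₁))
        + (⅓ * (⅓ * (⅔ * s₂ + (n₃ - 2ℚ * n₂ + 2ℚ * x₂) - o₂)) + (⅓ * (⅓ * (⅔ * s₃ + (n₀ - 2ℚ * n₃ + 2ℚ * x₃) - o₃)) + 0ℚ))))
      ≡ + 1 / 36 * (⅔ * (s₀ + s₁ + s₂ + s₃) + 2ℚ * (x₀ + x₁ + x₂ + x₃) - (n₀ + n₁ + n₂ + n₃) - (o₀ + o₁ + o₂ + o₃))
    collect = solve 16 (λ s₀ s₁ s₂ s₃ n₀ n₁ n₂ n₃ x₀ x₁ x₂ x₃ o₀ o₁ o₂ o₃ →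
      con (+ 1 / 4) :* (con ⅓ :* (con ⅓ :* (con ⅔ :* s₀ :+ (n₁ :- con 2ℚ :* n₀ :+ con 2ℚ :* x₀) :- o₀))
        :+ (con ⅓ :* (con ⅓ :* (con ⅔ :* s₁ :+ (n₂ :- con 2ℚ :* n₁ :+ con 2ℚ :* x₁) :- o₁))
        :+ (con ⅓ :* (con ⅓ :* (con ⅔ :* s₂ :+ (n₃ :- con 2ℚ :* n₂ :+ con 2ℚ :* x₂) :- o₂))
        :+ (con ⅓ :* (con ⅓ :* (con ⅔ :* s₃ :+ (n₀ :- con 2ℚ :* n₃ :+ con 2ℚ :* x₃) :- o₃)) :+ con 0ℚ))))
      := con (+ 1 / 36) :* (con ⅔ :* (s₀ :+ s₁ :+ s₂ :+ s₃) :+ con 2ℚ :* (x₀ :+ x₁ :+ x₂ :+ x₃)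
        :- (n₀ :+ n₁ :+ n₂ :+ n₃) :- (o₀ :+ o₁ :+ o₂ :+ o₃))) refl

  -- Coordinates of ℤ/12 by the Chinese remainder theorem: 9j + 4m is j modulo 4 and m modulo 3.
  module Grid (u : ℕ → ℚ) (per-12 : Periodic 12 u) (unit : ∀ n → InUnit (u n)) where

    -- Six times the mean of Tu over the class of `a` modulo 4: squares fall into the classes 0 and
    -- 1 equally often, and 9, 13, 17 are 1 modulo 4.
    level : ℕ → ℚ
    level a = u a + u (a ℕ.+ 4) + u (a ℕ.+ 8) + (u (a ℕ.+ 9) + u (a ℕ.+ 13) + u (a ℕ.+ 17))

    η : ℕ → ℚ
    η a = ⅓ * (level a - 3ℚ) ⁺

    η-nonNeg : ∀ a → 0ℚ ≤ η a
    η-nonNeg a = 0≤-* (nonNegative⁻¹ ⅓) (⁺-nonNeg (level a - 3ℚ))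

    η-cong : ∀ {a b} → level a ≡ level b → η a ≡ η b
    η-cong eq = cong (λ s → ⅓ * (s - 3ℚ) ⁺) eq

    level-periodic : ∀ {p} → Periodic p u → Periodic p level
    level-periodic per a = cong₂ _+_ (cong₂ _+_ (cong₂ _+_ (per a) (periodic-shift per 4 a)) (periodic-shift per 8 a))
      (cong₂ _+_ (cong₂ _+_ (periodic-shift per 9 a) (periodic-shift per 13 a)) (periodic-shift per 17 a))

    η-periodic : ∀ {p} → Periodic p u → Periodic p η
    η-periodic per a = η-cong (level-periodic per a)

    η-periodic₄ : Periodic 4 η
    η-periodic₄ a = η-cong {a ℕ.+ 4} {a} (begin
      u (a ℕ.+ 4) + u (a ℕ.+ 4 ℕ.+ 4) + u (a ℕ.+ 4 ℕ.+ 8) + (u (a ℕ.+ 4 ℕ.+ 9) + u (a ℕ.+ 4 ℕ.+ 13) + u (a ℕ.+ 4 ℕ.+ 17))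
        ≡⟨ cong₂ _+_ (cong₂ _+_ (cong (λ t → u (a ℕ.+ 4) + t) (at a 4 4)) (trans (at a 4 8) (per-12 a)))
             (cong₂ _+_ (cong₂ _+_ (at a 4 9) (at a 4 13)) (trans (at a 4 17) (trans (cong u (sym (ℕ.+-assoc a 9 12))) (per-12 (a ℕ.+ 9))))) ⟩
      u (a ℕ.+ 4) + u (a ℕ.+ 8) + u a + (u (a ℕ.+ 13) + u (a ℕ.+ 17) + u (a ℕ.+ 9))
        ≡⟨ rotate₃ (u a) (u (a ℕ.+ 4)) (u (a ℕ.+ 8)) (u (a ℕ.+ 9)) (u (a ℕ.+ 13)) (u (a ℕ.+ 17)) ⟩
      level a ∎)
      where
      open ≡-Reasoning
      at : ∀ a m n → u (a ℕ.+ m ℕ.+ n) ≡ u (a ℕ.+ (m ℕ.+ n))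
      at a m n = cong u (ℕ.+-assoc a m n)
      rotate₃ : ∀ a b c d e f → b + c + a + (e + f + d) ≡ a + b + c + (d + e + f)
      rotate₃ = solve 6 (λ a b c d e f → b :+ c :+ a :+ (e :+ f :+ d) := a :+ b :+ c :+ (d :+ e :+ f)) refl

    y : ℕ → ℕ → ℚ
    y j m = u (j ℕ.* 9 ℕ.+ m ℕ.* 4)

    y₃ : ∀ j → y j 3 ≡ y j 0
    y₃ j = trans (per-12 (j ℕ.* 9)) (cong u (sym (ℕ.+-identityʳ (j ℕ.* 9))))

    triple : ℕ → Triple
    triple j = ⟨ y j 0 , y j 1 , y j 2 ⟩

    triple-InCube : ∀ j → InCube (triple j)
    triple-InCube j = unit _ , unit _ , unit _

    triple₄ : triple 4 ≡ triple 0
    triple₄ = triple-cong (wrap 0) (wrap 4) (wrap 8)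
      where
      triple-cong : ∀ {a b c a′ b′ c′} → a ≡ a′ → b ≡ b′ → c ≡ c′ → ⟨ a , b , c ⟩ ≡ ⟨ a′ , b′ , c′ ⟩
      triple-cong refl refl refl = refl
      wrap : ∀ n → u (36 ℕ.+ n) ≡ u n
      wrap n = trans (cong u (ℕ.+-comm 36 n)) (periodic-* {f = u} per-12 3 n)

    spread : ℕ → ℚ
    spread a = 1/6 * (u a + u (a ℕ.+ 9) + 2ℚ * (u (a ℕ.+ 4) + u (a ℕ.+ 1)))

    -- Chosen so that -½ · `deficit` consists of the terms in Tu and η of the completed square,
    -- together with the ½ u² taken from ½ B².
    deficit : ℕ → ℚ
    deficit a = 4ℚ * (spread a * spread a) - u a * u a - 4ℚ * (η a * spread a) + 2ℚ * η a + η a * η a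

    Z : ℕ → ℚ
    Z j = total (triple j) + total (triple (suc j))

    overshoot : ℕ → ℚ
    overshoot j = (Z j - 3ℚ) ⁺

    spread-y : ∀ j m → spread (j ℕ.* 9 ℕ.+ m ℕ.* 4) ≡
      1/6 * (y j m + y (suc j) m + 2ℚ * (y j (suc m) + y (suc j) (suc m)))
    spread-y j m = cong₂ (λ s t → 1/6 * (y j m + s + 2ℚ * t)) (cong u (east j m))
      -- The shift by 1 is the shift by 13 = 9 + 4 modulo 12, one step in each coordinate.
      (cong₂ _+_ (cong u (north j m)) (trans (sym (per-12 _)) (cong u (northeast j m))))
      where
      east : ∀ j m → j ℕ.* 9 ℕ.+ m ℕ.* 4 ℕ.+ 9 ≡ suc j ℕ.* 9 ℕ.+ m ℕ.* 4
      east = ℕ-Ring.solve-∀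
      north : ∀ j m → j ℕ.* 9 ℕ.+ m ℕ.* 4 ℕ.+ 4 ≡ j ℕ.* 9 ℕ.+ suc m ℕ.* 4
      north = ℕ-Ring.solve-∀
      northeast : ∀ j m → j ℕ.* 9 ℕ.+ m ℕ.* 4 ℕ.+ 1 ℕ.+ 12 ≡ suc j ℕ.* 9 ℕ.+ suc m ℕ.* 4
      northeast = ℕ-Ring.solve-∀

    η-y : ∀ j m → η (j ℕ.* 9 ℕ.+ m ℕ.* 4) ≡ ⅓ * overshoot j
    η-y j m = trans (periodic-* {f = η} η-periodic₄ m (j ℕ.* 9)) (cong (λ s → ⅓ * (s - 3ℚ) ⁺)
      (cong₂ _+_ (cong (λ s → s + u (j ℕ.* 9 ℕ.+ 4) + u (j ℕ.* 9 ℕ.+ 8)) (cong u (sym (ℕ.+-identityʳ (j ℕ.* 9)))))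
        (cong₂ _+_ (cong₂ _+_ (cong u (e₀ j)) (cong u (e₁ j))) (cong u (e₂ j)))))
      where
      e₀ : ∀ j → j ℕ.* 9 ℕ.+ 9 ≡ suc j ℕ.* 9 ℕ.+ 0
      e₀ = ℕ-Ring.solve-∀
      e₁ : ∀ j → j ℕ.* 9 ℕ.+ 13 ≡ suc j ℕ.* 9 ℕ.+ 4
      e₁ = ℕ-Ring.solve-∀
      e₂ : ∀ j → j ℕ.* 9 ℕ.+ 17 ≡ suc j ℕ.* 9 ℕ.+ 8
      e₂ = ℕ-Ring.solve-∀

    deficit-y : ∀ j m {z z′} → y j m + y (suc j) m ≡ z → y j (suc m) + y (suc j) (suc m) ≡ z′ →
      deficit (j ℕ.* 9 ℕ.+ m ℕ.* 4) ≡ deficit-at (y j m) (overshoot j) z z′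
    deficit-y j m refl refl =
      cong₂ (λ s h → 4ℚ * (s * s) - y j m * y j m - 4ℚ * (h * s) + 2ℚ * h + h * h) (spread-y j m) (η-y j m)

    deficit-class : ∀ j → deficit (j ℕ.* 9 ℕ.+ 0) + (deficit (j ℕ.* 9 ℕ.+ 4) + (deficit (j ℕ.* 9 ℕ.+ 8) + 0ℚ))
      ≡ class-deficit (triple j) (triple (suc j))
    deficit-class j = trans
      (cong₂ _+_ (deficit-y j 0 refl refl) (cong₂ _+_ (deficit-y j 1 refl refl)
        (cong (λ t → t + 0ℚ) (deficit-y j 2 refl (cong₂ _+_ (y₃ j) (y₃ (suc j)))))))
      (class-deficit-expand (y j 0) (y j 1) (y j 2) (y (suc j) 0) (y (suc j) 1) (y (suc j) 2))

    deficit-mean : mean 4 (λ j → mean 3 λ m → deficit (j ℕ.* 9 ℕ.+ m ℕ.* 4)) ≡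
      + 1 / 4 * (⅓ * class-deficit (triple 0) (triple 1) + (⅓ * class-deficit (triple 1) (triple 2)
        + (⅓ * class-deficit (triple 2) (triple 3) + (⅓ * class-deficit (triple 3) (triple 0) + 0ℚ))))
    deficit-mean = cong (λ s → + 1 / 4 * s) (cong₂ _+_ (cong (⅓ *_) (deficit-class 0)) (cong₂ _+_ (cong (⅓ *_) (deficit-class 1))
      (cong₂ _+_ (cong (⅓ *_) (deficit-class 2)) (cong (λ t → t + 0ℚ) (cong (⅓ *_)
        (trans (deficit-class 3) (cong (class-deficit (triple 3)) triple₄)))))))

    deficit-mean-≤ : total (triple 0) + total (triple 1) + total (triple 2) + total (triple 3) ≡ 9/2 →
      mean 4 (λ j → mean 3 λ m → deficit (j ℕ.* 9 ℕ.+ m ℕ.* 4)) ≤ ½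
    deficit-mean-≤ density = subst (_≤ ½) (sym deficit-mean)
      (class-deficit-≤ (triple-InCube 0) (triple-InCube 1) (triple-InCube 2) (triple-InCube 3) density)

  -- The correlation bound at mean exactly 3/8.

  ⅜ : ℚ
  ⅜ = + 3 / 8

  module Core (q : ℕ) .{{_ : NonZero q}} {A B : ℕ → ℚ} (per-A : Periodic q A) (per-B : Periodic q B)
    (A-nonNeg : ∀ n → 0ℚ ≤ A n) (B-unit : ∀ n → InUnit (B n))
    (mean-A : mean q A ≡ ⅜) (mean-B : mean q B ≡ ⅜) where

    open Progressions q

    u g : ℕ → ℚ
    u = progressionMean 12 B
    g n = B n - u n

    u-per : Periodic q u
    u-per = progressionMean-periodic per-B 12

    u-per-12 : Periodic 12 u
    u-per-12 = progressionMean-step per-B 12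

    u-unit : ∀ n → InUnit (u n)
    u-unit n = mean-nonNeg q (λ x → proj₁ (B-unit (n ℕ.+ x ℕ.* 12)))
      , subst (u n ≤_) (mean-const q 1ℚ) (mean-mono q (λ x → proj₂ (B-unit (n ℕ.+ x ℕ.* 12))))

    g-per : Periodic q g
    g-per n = cong₂ _-_ (per-B n) (u-per n)

    𝔼-difference : ∀ f h → 𝔼 (λ i → f i - h i) ≡ 𝔼 f - 𝔼 h
    𝔼-difference f h = trans (mean-cong q (λ i → cong (λ t → f i + t) (negate (h i))))
      (trans (mean-+ q f _) (cong (λ t → 𝔼 f + t) (trans (mean-* q (- 1ℚ) h) (sym (negate (𝔼 h))))))
      where
      negate : ∀ x → - x ≡ - 1ℚ * x
      negate = solve 1 (λ x → :- x := con (- 1ℚ) :* x) refl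

    g-vanish : ∀ c → progressionMean 12 g c ≡ 0ℚ
    g-vanish c = trans (𝔼-difference (λ x → B (c ℕ.+ x ℕ.* 12)) (λ x → u (c ℕ.+ x ℕ.* 12)))
      (trans (cong (λ t → u c - t) (trans (mean-cong q (λ x → periodic-* {f = u} u-per-12 x c)) (mean-const q (u c))))
        (+-inverseʳ (u c)))

    open Equidistributed g-per g-vanish using (squareMean-contracts)
    open Grid u u-per-12 u-unit

    private
      TB Tu Tg : ℕ → ℚ
      TB = squareMean B
      Tu = squareMean u
      Tg = squareMean g

    split : ∀ a → B a ≡ u a + g a
    split a = parts (B a) (u a)
      where
      parts : ∀ b u → b ≡ u + (b - u)
      parts = solve 2 (λ b u → b := u :+ (b :- u)) refl

    T-split : ∀ a → TB a ≡ Tu a + Tg a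
    T-split a = trans (mean-cong q (λ x → split (a ℕ.+ x ℕ.* x))) (mean-+ q _ _)

    orthogonal : ∀ {p} → Periodic q p → Periodic 12 p → ∀ s → 𝔼 (λ a → g (a ℕ.+ s) * p a) ≡ 0ℚ
    orthogonal {p} per step s = trans (𝔼-project 12 (periodic-shift g-per s) per step)
      (trans (mean-cong q (λ a → trans (cong (_* p a) (vanish a)) (*-zeroˡ (p a)))) (mean-const q 0ℚ))
      where
      move : ∀ a x s → a ℕ.+ x ℕ.* 12 ℕ.+ s ≡ a ℕ.+ s ℕ.+ x ℕ.* 12
      move = ℕ-Ring.solve-∀
      vanish : ∀ a → 𝔼 (λ x → g (a ℕ.+ x ℕ.* 12 ℕ.+ s)) ≡ 0ℚ
      vanish a = trans (mean-cong q (λ x → cong g (move a x s))) (g-vanish (a ℕ.+ s))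

    -- Tg is a mean of translates of g, and each translate still has mean zero on every class modulo
    -- 12.
    T-orthogonal : ∀ {p} → Periodic q p → Periodic 12 p → 𝔼 (λ a → Tg a * p a) ≡ 0ℚ
    T-orthogonal {p} per step = trans (mean-cong q (λ a → sym (mean-*ʳ q (p a) _)))
      (trans (mean-swap q q _) (trans (mean-cong q (λ x → orthogonal per step (x ℕ.* x))) (mean-const q 0ℚ)))

    mean-T : 𝔼 TB ≡ ⅜
    mean-T = trans (mean-swap q q _)
      (trans (mean-cong q (λ x → mean-shift q per-B (x ℕ.* x))) (trans (mean-const q (𝔼 B)) mean-B))

    mean-u : 𝔼 u ≡ ⅜
    mean-u = trans (mean-swap q q _)
      (trans (mean-cong q (λ x → mean-shift q per-B (x ℕ.* 12))) (trans (mean-const q (𝔼 B)) mean-B))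

    -- Modulo 12 the squares are 0, 1, 4, 9, hit with frequencies 1 : 2 : 2 : 1.
    Tu≡spread : ∀ a → Tu a ≡ spread a
    Tu≡spread a = trans (mean-periods q 6 {λ x → u (a ℕ.+ x ℕ.* x)} (periodic-square u-per a) per-6)
      (trans (cong (λ s → 1/6 * (s + (u (a ℕ.+ 1) + (u (a ℕ.+ 4) + (u (a ℕ.+ 9) + (u (a ℕ.+ 16) + (u (a ℕ.+ 25) + 0ℚ)))))))
          (cong u (ℕ.+-identityʳ a)))
      (trans (cong₂ (λ s t → 1/6 * (u a + (u (a ℕ.+ 1) + (u (a ℕ.+ 4) + (u (a ℕ.+ 9) + (s + (t + 0ℚ)))))))
          (reduce 1 4) (reduce 2 1))
        (collect (u a) (u (a ℕ.+ 1)) (u (a ℕ.+ 4)) (u (a ℕ.+ 9)))))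
      where
      reduce : ∀ k r → u (a ℕ.+ (r ℕ.+ k ℕ.* 12)) ≡ u (a ℕ.+ r)
      reduce k r = trans (cong u (sym (ℕ.+-assoc a r (k ℕ.* 12)))) (periodic-* {f = u} u-per-12 k (a ℕ.+ r))
      per-6 : Periodic 6 (λ x → u (a ℕ.+ x ℕ.* x))
      per-6 x = trans (cong u (move a x)) (periodic-* {f = u} u-per-12 (x ℕ.+ 3) (a ℕ.+ x ℕ.* x))
        where
        move : ∀ a x → a ℕ.+ (x ℕ.+ 6) ℕ.* (x ℕ.+ 6) ≡ a ℕ.+ x ℕ.* x ℕ.+ (x ℕ.+ 3) ℕ.* 12
        move = ℕ-Ring.solve-∀
      collect : ∀ u₀ u₁ u₄ u₉ → 1/6 * (u₀ + (u₁ + (u₄ + (u₉ + (u₄ + (u₁ + 0ℚ)))))) ≡ 1/6 * (u₀ + u₉ + 2ℚ * (u₄ + u₁))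
      collect = solve 4 (λ u₀ u₁ u₄ u₉ → con 1/6 :* (u₀ :+ (u₁ :+ (u₄ :+ (u₉ :+ (u₄ :+ (u₁ :+ con 0ℚ))))))
        := con 1/6 :* (u₀ :+ u₉ :+ con 2ℚ :* (u₄ :+ u₁))) refl

    grid-mean : ∀ {f} → Periodic q f → Periodic 12 f → 𝔼 f ≡ mean 4 (λ j → mean 3 λ m → f (j ℕ.* 9 ℕ.+ m ℕ.* 4))
    grid-mean {f} per per-12 = mean-grid q 4 3 9 4 12 refl per (periodic-* {f = f} per-12 3) per-12 per-12

    -- The twelve values of u add up to 12 · 3/8.
    density : total (triple 0) + total (triple 1) + total (triple 2) + total (triple 3) ≡ 9/2
    density = trans
      (collect (u 0) (u 4) (u 8) (u 9) (u 13) (u 17) (u 18) (u 22) (u 26) (u 27) (u 31) (u 35))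
      (cong (+ 12 / 1 *_) (trans (sym (grid-mean u-per u-per-12)) mean-u))
      where
      collect : ∀ a b c d e f g h i j k l → a + b + c + (d + e + f) + (g + h + i) + (j + k + l) ≡
        + 12 / 1 * (¼ * (⅓ * (a + (b + (c + 0ℚ))) + (⅓ * (d + (e + (f + 0ℚ))) + (⅓ * (g + (h + (i + 0ℚ))) + (⅓ * (j + (k + (l + 0ℚ))) + 0ℚ)))))
      collect = solve 12 (λ a b c d e f g h i j k l →
        a :+ b :+ c :+ (d :+ e :+ f) :+ (g :+ h :+ i) :+ (j :+ k :+ l) :=
        con (+ 12 / 1) :* (con ¼ :* (con ⅓ :* (a :+ (b :+ (c :+ con 0ℚ))) :+ (con ⅓ :* (d :+ (e :+ (f :+ con 0ℚ)))
          :+ (con ⅓ :* (g :+ (h :+ (i :+ con 0ℚ))) :+ (con ⅓ :* (j :+ (k :+ (l :+ con 0ℚ))) :+ con 0ℚ)))))) refl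

    spread-periodic : ∀ {p} → Periodic p u → Periodic p spread
    spread-periodic per a = cong (1/6 *_) (cong₂ _+_ (cong₂ _+_ (per a) (periodic-shift per 9 a))
      (cong (2ℚ *_) (cong₂ _+_ (periodic-shift per 4 a) (periodic-shift per 1 a))))

    deficit-periodic : ∀ {p} → Periodic p u → Periodic p deficit
    deficit-periodic per a = combine₃ (spread-periodic per a) (per a) (η-periodic per a)
      where
      combine₃ : ∀ {s s′ v v′ h h′} → s ≡ s′ → v ≡ v′ → h ≡ h′ →
        4ℚ * (s * s) - v * v - 4ℚ * (h * s) + 2ℚ * h + h * h ≡ 4ℚ * (s′ * s′) - v′ * v′ - 4ℚ * (h′ * s′) + 2ℚ * h′ + h′ * h′
      combine₃ refl refl refl = refl

    deficit-≤ : 𝔼 deficit ≤ ½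
    deficit-≤ = subst (_≤ ½) (sym (grid-mean (deficit-periodic u-per) (deficit-periodic u-per-12))) (deficit-mean-≤ density)

    private
      AA BB uu gg TT TuTu TgTg AT ηT ηTu ηη : ℚ
      AA = 𝔼 λ a → A a * A a
      BB = 𝔼 λ a → B a * B a
      uu = 𝔼 λ a → u a * u a
      gg = 𝔼 λ a → g a * g a
      TT = 𝔼 λ a → TB a * TB a
      TuTu = 𝔼 λ a → Tu a * Tu a
      TgTg = 𝔼 λ a → Tg a * Tg a
      AT = 𝔼 λ a → A a * TB a
      ηT = 𝔼 λ a → η a * TB a
      ηTu = 𝔼 λ a → η a * Tu a
      ηη = 𝔼 λ a → η a * η a

      pythagoras : ∀ {f h k : ℕ → ℚ} → (∀ a → f a ≡ h a + k a) → 𝔼 (λ a → k a * h a) ≡ 0ℚ →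
        𝔼 (λ a → f a * f a) ≡ 𝔼 (λ a → h a * h a) + 𝔼 (λ a → k a * k a)
      pythagoras {f} {h} {k} eq orth = begin
        𝔼 (λ a → f a * f a)
          ≡⟨ mean-cong q (λ a → trans (cong (λ t → t * t) (eq a)) (expand (h a) (k a))) ⟩
        𝔼 (combine ((1ℚ , λ a → h a * h a) ∷ (1ℚ , λ a → k a * k a) ∷ (2ℚ , λ a → k a * h a) ∷ []))
          ≡⟨ mean-combine q ((1ℚ , λ a → h a * h a) ∷ (1ℚ , λ a → k a * k a) ∷ (2ℚ , λ a → k a * h a) ∷ []) ⟩
        1ℚ * hh + (1ℚ * kk + (2ℚ * 𝔼 (λ a → k a * h a) + 0ℚ))
          ≡⟨ cong (λ t → 1ℚ * hh + (1ℚ * kk + (2ℚ * t + 0ℚ))) orth ⟩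
        1ℚ * hh + (1ℚ * kk + (2ℚ * 0ℚ + 0ℚ))
          ≡⟨ tidy hh kk ⟩
        hh + kk ∎
        where
        open ≡-Reasoning
        hh = 𝔼 λ a → h a * h a
        kk = 𝔼 λ a → k a * k a
        expand : ∀ h k → (h + k) * (h + k) ≡ 1ℚ * (h * h) + (1ℚ * (k * k) + (2ℚ * (k * h) + 0ℚ))
        expand = solve 2 (λ h k → (h :+ k) :* (h :+ k)
          := con 1ℚ :* (h :* h) :+ (con 1ℚ :* (k :* k) :+ (con 2ℚ :* (k :* h) :+ con 0ℚ))) refl
        tidy : ∀ x y → 1ℚ * x + (1ℚ * y + (2ℚ * 0ℚ + 0ℚ)) ≡ x + y
        tidy = solve 2 (λ x y → con 1ℚ :* x :+ (con 1ℚ :* y :+ (con 2ℚ :* con 0ℚ :+ con 0ℚ)) := x :+ y) refl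

      TT-split : TT ≡ TuTu + TgTg
      TT-split = pythagoras {TB} {Tu} {Tg} T-split (T-orthogonal (squareMean-periodic u-per) (squareMean-periodic u-per-12))

      BB-split : BB ≡ uu + gg
      BB-split = pythagoras {B} {u} {g} split
        (trans (mean-cong q (λ a → cong (λ t → g t * u a) (sym (ℕ.+-identityʳ a)))) (orthogonal u-per u-per-12 0))

      -- η has period 12, so it sees only the part Tu of TB; the deficit is thereby a quantity of u
      -- alone.
      ηT-split : ηT ≡ ηTu
      ηT-split = begin
        ηT                                       ≡⟨ mean-cong q (λ a → trans (cong (η a *_) (T-split a)) (expand (η a) (Tu a) (Tg a))) ⟩
        𝔼 (λ a → η a * Tu a + Tg a * η a)        ≡⟨ mean-+ q _ _ ⟩
        ηTu + 𝔼 (λ a → Tg a * η a)               ≡⟨ cong (λ t → ηTu + t) (T-orthogonal (η-periodic u-per) (η-periodic u-per-12)) ⟩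
        ηTu + 0ℚ                                 ≡⟨ +-identityʳ ηTu ⟩
        ηTu                                      ∎
        where
        open ≡-Reasoning
        expand : ∀ h s t → h * (s + t) ≡ h * s + t * h
        expand = solve 3 (λ h s t → h :* (s :+ t) := h :* s :+ t :* h) refl

      deficit-terms : Combination
      deficit-terms = (4ℚ , λ a → Tu a * Tu a) ∷ (- 1ℚ , λ a → u a * u a) ∷ (- 4ℚ , λ a → η a * Tu a) ∷ (2ℚ , η) ∷ (1ℚ , λ a → η a * η a) ∷ []

      deficit-mean≡ : 𝔼 deficit ≡ combine-means q deficit-terms
      deficit-mean≡ = trans (mean-cong q (λ a → trans (expand (spread a) (u a) (η a))
        (cong (λ s → 4ℚ * (s * s) + (- 1ℚ * (u a * u a) + (- 4ℚ * (η a * s) + (2ℚ * η a + (1ℚ * (η a * η a) + 0ℚ))))) (sym (Tu≡spread a)))))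
        (mean-combine q deficit-terms)
        where
        expand : ∀ s v h → 4ℚ * (s * s) - v * v - 4ℚ * (h * s) + 2ℚ * h + h * h
          ≡ 4ℚ * (s * s) + (- 1ℚ * (v * v) + (- 4ℚ * (h * s) + (2ℚ * h + (1ℚ * (h * h) + 0ℚ))))
        expand = solve 3 (λ s v h → con 4ℚ :* (s :* s) :- v :* v :- con 4ℚ :* (h :* s) :+ con 2ℚ :* h :+ h :* h
          := con 4ℚ :* (s :* s) :+ (con (- 1ℚ) :* (v :* v) :+ (con (- 4ℚ) :* (h :* s) :+ (con 2ℚ :* h :+ (con 1ℚ :* (h :* h) :+ con 0ℚ))))) refl

      lower-terms : Combination
      lower-terms = (1ℚ , A) ∷ (- ½ , λ a → A a * A a) ∷ (- ½ , λ a → 1ℚ) ∷ (2ℚ , TB) ∷ (- 2ℚ , λ a → TB a * TB a)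
        ∷ (2ℚ , λ a → η a * TB a) ∷ (- 1ℚ , η) ∷ (- ½ , λ a → η a * η a) ∷ []

      -- With H = 2 TB this is A·H ≥ A - A²/2 - (1 - H)²/2 + η (H - 1) - η²/2; the terms in η ≥ 0 recover
      -- what the square loses where H exceeds 1.
      lower : ∀ a → combine lower-terms a ≤ 2ℚ * (A a * TB a)
      lower a = ≤-by (½ * (x * x) + A a * η a)
        (0≤-+ (0≤-* 0≤½ (0≤-square x)) (0≤-* (A-nonNeg a) (η-nonNeg a))) (expand (A a) (TB a) (η a))
        where
        x = A a + (2ℚ * TB a - 1ℚ) - η a
        expand : ∀ A t h → 1ℚ * A + (- ½ * (A * A) + (- ½ * 1ℚ + (2ℚ * t + (- 2ℚ * (t * t) + (2ℚ * (h * t) + (- 1ℚ * h + (- ½ * (h * h) + 0ℚ)))))))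
          + (½ * ((A + (2ℚ * t - 1ℚ) - h) * (A + (2ℚ * t - 1ℚ) - h)) + A * h) ≡ 2ℚ * (A * t)
        expand = solve 3 (λ A t h → con 1ℚ :* A :+ (con (- ½) :* (A :* A) :+ (con (- ½) :* con 1ℚ :+ (con 2ℚ :* t :+ (con (- 2ℚ) :* (t :* t)
          :+ (con 2ℚ :* (h :* t) :+ (con (- 1ℚ) :* h :+ (con (- ½) :* (h :* h) :+ con 0ℚ)))))))
          :+ (con ½ :* ((A :+ (con 2ℚ :* t :- con 1ℚ) :- h) :* (A :+ (con 2ℚ :* t :- con 1ℚ) :- h)) :+ A :* h) := con 2ℚ :* (A :* t)) refl

    -- The slack splits along B = u + g: the inequality on ℤ/12 pays for u, the contraction for g,
    -- and T preserves the orthogonality of the two parts. Both second moments stay explicit, to be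
    -- bounded by means once the scaling is undone.
    correlation-≥ : ⅜ - ½ * AA - ½ * BB ≤ 2ℚ * AT
    correlation-≥ = ≤-trans
      (≤-by (½ * (½ - 𝔼 deficit) + ½ * (gg - 4ℚ * TgTg))
        (0≤-+ (0≤-* 0≤½ (0≤-diff deficit-≤)) (0≤-* 0≤½ (0≤-diff squareMean-contracts)))
        balance)
      (≤-trans (mean-mono q lower) (≤-reflexive (mean-* q 2ℚ _)))
      where
      open ≡-Reasoning
      balance : ⅜ - ½ * AA - ½ * BB + (½ * (½ - 𝔼 deficit) + ½ * (gg - 4ℚ * TgTg)) ≡ 𝔼 (combine lower-terms)
      balance = begin
        ⅜ - ½ * AA - ½ * BB + (½ * (½ - 𝔼 deficit) + ½ * (gg - 4ℚ * TgTg))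
          ≡⟨ cong₂ (λ s d → ⅜ - ½ * AA - ½ * s + (½ * (½ - d) + ½ * (gg - 4ℚ * TgTg))) BB-split deficit-mean≡ ⟩
        ⅜ - ½ * AA - ½ * (uu + gg) + (½ * (½ - combine-means q deficit-terms) + ½ * (gg - 4ℚ * TgTg))
          ≡⟨ identity AA uu gg TuTu TgTg ηTu (𝔼 η) ηη ⟩
        1ℚ * ⅜ + (- ½ * AA + (- ½ * 1ℚ + (2ℚ * ⅜ + (- 2ℚ * (TuTu + TgTg) + (2ℚ * ηTu + (- 1ℚ * 𝔼 η + (- ½ * ηη + 0ℚ)))))))
          ≡⟨ cong₂ (λ s t → 1ℚ * ⅜ + (- ½ * AA + (- ½ * 1ℚ + (2ℚ * ⅜ + (- 2ℚ * s + (2ℚ * t + (- 1ℚ * 𝔼 η + (- ½ * ηη + 0ℚ))))))))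
               (sym TT-split) (sym ηT-split) ⟩
        1ℚ * ⅜ + (- ½ * AA + (- ½ * 1ℚ + (2ℚ * ⅜ + (- 2ℚ * TT + (2ℚ * ηT + (- 1ℚ * 𝔼 η + (- ½ * ηη + 0ℚ)))))))
          ≡⟨ cong₂ (λ s t → 1ℚ * s + (- ½ * AA + (- ½ * 1ℚ + (2ℚ * t + (- 2ℚ * TT + (2ℚ * ηT + (- 1ℚ * 𝔼 η + (- ½ * ηη + 0ℚ))))))))
               (sym mean-A) (sym mean-T) ⟩
        1ℚ * 𝔼 A + (- ½ * AA + (- ½ * 1ℚ + (2ℚ * 𝔼 TB + (- 2ℚ * TT + (2ℚ * ηT + (- 1ℚ * 𝔼 η + (- ½ * ηη + 0ℚ)))))))
          ≡⟨ cong (λ s → 1ℚ * 𝔼 A + (- ½ * AA + (- ½ * s + (2ℚ * 𝔼 TB + (- 2ℚ * TT + (2ℚ * ηT + (- 1ℚ * 𝔼 η + (- ½ * ηη + 0ℚ))))))))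
               (sym (mean-const q 1ℚ)) ⟩
        combine-means q lower-terms
          ≡⟨ sym (mean-combine q lower-terms) ⟩
        𝔼 (combine lower-terms) ∎
        where
        identity : ∀ AA uu gg s t x e h →
          ⅜ - ½ * AA - ½ * (uu + gg) + (½ * (½ - (4ℚ * s + (- 1ℚ * uu + (- 4ℚ * x + (2ℚ * e + (1ℚ * h + 0ℚ)))))) + ½ * (gg - 4ℚ * t))
          ≡ 1ℚ * ⅜ + (- ½ * AA + (- ½ * 1ℚ + (2ℚ * ⅜ + (- 2ℚ * (s + t) + (2ℚ * x + (- 1ℚ * e + (- ½ * h + 0ℚ)))))))
        identity = solve 8 (λ AA uu gg s t x e h →
          con ⅜ :- con ½ :* AA :- con ½ :* (uu :+ gg) :+ (con ½ :* (con ½ :- (con 4ℚ :* s :+ (con (- 1ℚ) :* uu :+ (con (- 4ℚ) :* x :+ (con 2ℚ :* e :+ (con 1ℚ :* h :+ con 0ℚ))))))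
            :+ con ½ :* (gg :- con 4ℚ :* t))
          := con 1ℚ :* con ⅜ :+ (con (- ½) :* AA :+ (con (- ½) :* con 1ℚ :+ (con 2ℚ :* con ⅜ :+ (con (- 2ℚ) :* (s :+ t)
            :+ (con 2ℚ :* x :+ (con (- 1ℚ) :* e :+ (con (- ½) :* h :+ con 0ℚ)))))))) refl

  -- Undoing the normalisation to mean 3/8.

  4/3 3/16 : ℚ
  4/3 = + 4 / 3
  3/16 = + 3 / 16

  module Scaled (q : ℕ) .{{_ : NonZero q}} {A B : ℕ → ℚ} (per-A : Periodic q A) (per-B : Periodic q B)
    {M α : ℚ} (A-nonNeg : ∀ n → 0ℚ ≤ A n) (B-nonNeg : ∀ n → 0ℚ ≤ B n) (A≤M : ∀ n → A n ≤ M) (B≤M : ∀ n → B n ≤ M)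
    (α≤A : α ≤ mean q A) (α≤B : α ≤ mean q B) (⅜≤α : ⅜ ≤ α) (⅜M≤α : ⅜ * M ≤ α) where

    open Progressions q

    private
      a b AA BB AT : ℚ
      a = 𝔼 A
      b = 𝔼 B
      AA = 𝔼 λ n → A n * A n
      BB = 𝔼 λ n → B n * B n
      AT = 𝔼 λ n → A n * squareMean B n

      normaliser : ∀ {x} → α ≤ x → ∃ λ s → 0ℚ ≤ s × s * x ≡ ⅜
      normaliser {x} α≤x = ⅜ * i , 0≤-* (nonNegative⁻¹ ⅜) (<⇒≤ (positive⁻¹ i {{1/pos⇒pos x}})) ,
        trans (*-assoc ⅜ i x) (cong (⅜ *_) (*-inverseˡ x))
        where
        0<x : 0ℚ < x
        0<x = <-≤-trans (positive⁻¹ ⅜) (≤-trans ⅜≤α α≤x)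
        instance
          x-pos = positive 0<x
          x-nonZero = pos⇒nonZero x {{positive 0<x}}
        i = 1/ x

      s t : ℚ
      s = proj₁ (normaliser α≤A)
      t = proj₁ (normaliser α≤B)
      0≤s = proj₁ (proj₂ (normaliser α≤A))
      0≤t = proj₁ (proj₂ (normaliser α≤B))
      sa≡⅜ = proj₂ (proj₂ (normaliser α≤A))
      tb≡⅜ = proj₂ (proj₂ (normaliser α≤B))

      0≤M : 0ℚ ≤ M
      0≤M = ≤-trans (A-nonNeg 0) (A≤M 0)

      square-≤ : ∀ {f : ℕ → ℚ} → (∀ n → 0ℚ ≤ f n) → (∀ n → f n ≤ M) → 𝔼 (λ n → f n * f n) ≤ M * 𝔼 f
      square-≤ {f} 0≤f f≤M = ≤-trans
        (mean-mono q (λ n → *-monoʳ-≤-nonNeg (f n) {{nonNegative (0≤f n)}} (f≤M n))) (≤-reflexive (mean-* q M f))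

      -- Because t · b = ⅜ and ⅜ · M ≤ α ≤ b, the scaled weight t · B is at most t · M ≤ 1.
      tB-unit : ∀ n → InUnit (t * B n)
      tB-unit n = 0≤-* 0≤t (B-nonNeg n) , *-cancelʳ-≤-pos ⅜ (begin
        t * B n * ⅜     ≤⟨ *-monoʳ-≤-nonNeg ⅜ (*-monoˡ-≤-nonNeg t {{nonNegative 0≤t}} (B≤M n)) ⟩
        t * M * ⅜       ≡⟨ trans (*-assoc t M ⅜) (cong (t *_) (*-comm M ⅜)) ⟩
        t * (⅜ * M)     ≤⟨ *-monoˡ-≤-nonNeg t {{nonNegative 0≤t}} (≤-trans ⅜M≤α α≤B) ⟩
        t * b           ≡⟨ tb≡⅜ ⟩
        ⅜               ≡⟨ sym (*-identityˡ ⅜) ⟩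
        1ℚ * ⅜          ∎)
        where open ≤-Reasoning

      open Core q {λ n → s * A n} {λ n → t * B n}
        (λ n → cong (s *_) (per-A n)) (λ n → cong (t *_) (per-B n))
        (λ n → 0≤-* 0≤s (A-nonNeg n)) tB-unit
        (trans (mean-* q s A) sa≡⅜) (trans (mean-* q t B) tb≡⅜) using (correlation-≥)

      pull : ∀ k l (f h : ℕ → ℚ) → 𝔼 (λ n → k * f n * (l * h n)) ≡ k * l * 𝔼 (λ n → f n * h n)
      pull k l f h = trans (mean-cong q (λ n → swap k (f n) l (h n))) (mean-* q (k * l) _)
        where
        swap : ∀ k x l y → k * x * (l * y) ≡ k * l * (x * y)
        swap = solve 4 (λ k x l y → k :* x :* (l :* y) := k :* l :* (x :* y)) refl

      normalised : ⅜ - ½ * (s * s * AA) - ½ * (t * t * BB) ≤ 2ℚ * (s * t * AT)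
      normalised = subst₂ _≤_
        (cong₂ (λ x y → ⅜ - ½ * x - ½ * y) (pull s s A A) (pull t t B B))
        (cong (2ℚ *_) (trans (mean-cong q (λ n → cong (s * A n *_) (mean-* q t _))) (pull s t A (squareMean B))))
        correlation-≥

      0≤a : 0ℚ ≤ a
      0≤a = mean-nonNeg q A-nonNeg

      0≤b : 0ℚ ≤ b
      0≤b = mean-nonNeg q B-nonNeg

      -- Multiplication by a · b clears the denominators of s = ⅜/a and t = ⅜/b, and 32/9 normalises
      -- the coefficient of `AT` to 1. The second moments enter through A² ≤ M A and B² ≤ M B.
      unscaled : 4/3 * (a * b - 3/16 * M * (a + b)) ≤ AT
      unscaled = ≤-by (32/9 * (a * b * (2ℚ * (s * t * AT) - (⅜ - ½ * (s * s * AA) - ½ * (t * t * BB)))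
          + ½ * (s * s * (a * b) * (M * a - AA) + t * t * (a * b) * (M * b - BB))))
        (0≤-* (nonNegative⁻¹ 32/9) (0≤-+ (0≤-* (0≤-* 0≤a 0≤b) (0≤-diff normalised))
          (0≤-* 0≤½ (0≤-+ (0≤-* (0≤-* (0≤-* 0≤s 0≤s) (0≤-* 0≤a 0≤b)) (0≤-diff (square-≤ A-nonNeg A≤M)))
            (0≤-* (0≤-* (0≤-* 0≤t 0≤t) (0≤-* 0≤a 0≤b)) (0≤-diff (square-≤ B-nonNeg B≤M)))))))
        (trans (cancel a b s t M AA BB AT) (trans (cong₂ (λ x y → residue a b M AT x y) sa≡⅜ tb≡⅜) (tidy a b M AT)))
        where
        32/9 : ℚ
        32/9 = + 32 / 9
        residue : (a b M AT x y : ℚ) → ℚ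
        residue a b M AT x y = 4/3 * (a * b - 3/16 * M * (a + b))
          + 32/9 * (2ℚ * (x * y * AT) - ⅜ * (a * b) + ½ * M * (x * x * b + y * y * a))
        cancel : ∀ a b s t M AA BB AT → 4/3 * (a * b - 3/16 * M * (a + b))
          + 32/9 * (a * b * (2ℚ * (s * t * AT) - (⅜ - ½ * (s * s * AA) - ½ * (t * t * BB)))
            + ½ * (s * s * (a * b) * (M * a - AA) + t * t * (a * b) * (M * b - BB)))
          ≡ residue a b M AT (s * a) (t * b)
        cancel = solve 8 (λ a b s t M AA BB AT → con 4/3 :* (a :* b :- con 3/16 :* M :* (a :+ b))
          :+ con 32/9 :* (a :* b :* (con 2ℚ :* (s :* t :* AT) :- (con ⅜ :- con ½ :* (s :* s :* AA) :- con ½ :* (t :* t :* BB)))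
            :+ con ½ :* (s :* s :* (a :* b) :* (M :* a :- AA) :+ t :* t :* (a :* b) :* (M :* b :- BB)))
          := con 4/3 :* (a :* b :- con 3/16 :* M :* (a :+ b))
            :+ con 32/9 :* (con 2ℚ :* (s :* a :* (t :* b) :* AT) :- con ⅜ :* (a :* b)
              :+ con ½ :* M :* (s :* a :* (s :* a) :* b :+ t :* b :* (t :* b) :* a))) refl
        tidy : ∀ a b M AT → residue a b M AT ⅜ ⅜ ≡ AT
        tidy = solve 4 (λ a b M AT → con 4/3 :* (a :* b :- con 3/16 :* M :* (a :+ b))
          :+ con 32/9 :* (con 2ℚ :* (con ⅜ :* con ⅜ :* AT) :- con ⅜ :* (a :* b)
            :+ con ½ :* M :* (con ⅜ :* con ⅜ :* b :+ con ⅜ :* con ⅜ :* a)) := AT) refl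

    -- With m = 3/16 · M the expression a b - m (a + b) increases in both variables above m, so a
    -- and b may be lowered to α. There it is α (α - ⅜ M), and 4/3 · α ≥ 4/3 · ⅜ = ½: the origin of
    -- ε/2.
    correlation-lower-bound : ½ * (α - ⅜ * M) ≤ 𝔼 (λ n → A n * squareMean B n)
    correlation-lower-bound = ≤-trans
      (≤-by (4/3 * ((a - α) * (b - m) + (b - α) * (α - m) + (α - ⅜) * (α - ⅜ * M)))
        (0≤-* (nonNegative⁻¹ 4/3) (0≤-+ (0≤-+ (0≤-* (0≤-diff α≤A) (0≤-diff (≤-trans m≤α α≤B)))
          (0≤-* (0≤-diff α≤B) (0≤-diff m≤α))) (0≤-* (0≤-diff ⅜≤α) (0≤-diff ⅜M≤α))))
        (identity a b α M))
      unscaled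
      where
      m = 3/16 * M
      m≤α : m ≤ α
      m≤α = ≤-trans (≤-by m (0≤-* (nonNegative⁻¹ 3/16) 0≤M) (double M)) ⅜M≤α
        where
        double : ∀ M → 3/16 * M + 3/16 * M ≡ ⅜ * M
        double = solve 1 (λ M → con 3/16 :* M :+ con 3/16 :* M := con ⅜ :* M) refl
      identity : ∀ a b α M → ½ * (α - ⅜ * M)
        + 4/3 * ((a - α) * (b - 3/16 * M) + (b - α) * (α - 3/16 * M) + (α - ⅜) * (α - ⅜ * M))
        ≡ 4/3 * (a * b - 3/16 * M * (a + b))
      identity = solve 4 (λ a b α M → con ½ :* (α :- con ⅜ :* M)
        :+ con 4/3 :* ((a :- α) :* (b :- con 3/16 :* M) :+ (b :- α) :* (α :- con 3/16 :* M) :+ (α :- con ⅜) :* (α :- con ⅜ :* M))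
        := con 4/3 :* (a :* b :- con 3/16 :* M :* (a :+ b))) refl

open import Defs
open RationalCorrelation using (2ℚ; 3ℚ; ⅜; ≤-by; 0≤-diff; 0≤-+; 0≤-*; suc/1; 1/q*q; 0≤1/; 0≤n/1; sum; sum-reverse; sum-rotate; mean-+; mean-*; mean-const; mean-cong; mean-mono; mean-swap; Periodic; periodic-shift; periodic-product; module Progressions; module Scaled)

-- Rational sums over `Fin` and summation over fibres.

∑ℚ : ∀ {n} → (Fin n → ℚ) → ℚ
∑ℚ = foldr ℚ._+_ 0ℚ

seq-∑ : ∀ {n} (f : Fin n → ℝ) k → seq (∑ f) k ≡ ∑ℚ (λ t → seq (f t) k)
seq-∑ {zero}  f k = refl
seq-∑ {suc n} f k = cong (λ s → seq (f Fin.zero) k ℚ.+ s) (seq-∑ (λ t → f (Fin.suc t)) k)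

∑ℚ-cong : ∀ {n} {f g : Fin n → ℚ} → (∀ t → f t ≡ g t) → ∑ℚ f ≡ ∑ℚ g
∑ℚ-cong {zero}  eq = refl
∑ℚ-cong {suc n} eq = cong₂ ℚ._+_ (eq Fin.zero) (∑ℚ-cong (λ t → eq (Fin.suc t)))

∑ℚ-toℕ : ∀ n (h : ℕ → ℚ) → ∑ℚ {n} (λ t → h (toℕ t)) ≡ sum n h
∑ℚ-toℕ zero    h = refl
∑ℚ-toℕ (suc n) h = cong (λ s → h 0 ℚ.+ s) (∑ℚ-toℕ n (λ i → h (suc i)))

∑ℚ-+ : ∀ {n} (f g : Fin n → ℚ) → ∑ℚ (λ t → f t ℚ.+ g t) ≡ ∑ℚ f ℚ.+ ∑ℚ g
∑ℚ-+ {zero}  f g = refl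
∑ℚ-+ {suc n} f g = trans (cong (λ s → f Fin.zero ℚ.+ g Fin.zero ℚ.+ s) (∑ℚ-+ (λ t → f (Fin.suc t)) (λ t → g (Fin.suc t))))
  (interchange (f Fin.zero) (g Fin.zero) (∑ℚ λ t → f (Fin.suc t)) (∑ℚ λ t → g (Fin.suc t)))
  where
  interchange : ∀ a b c d → a ℚ.+ b ℚ.+ (c ℚ.+ d) ≡ a ℚ.+ c ℚ.+ (b ℚ.+ d)
  interchange = solve 4 (λ a b c d → a :+ b :+ (c :+ d) := a :+ c :+ (b :+ d)) refl

∑ℚ-zero : ∀ n → ∑ℚ {n} (λ _ → 0ℚ) ≡ 0ℚ
∑ℚ-zero zero    = refl
∑ℚ-zero (suc n) = trans (ℚ.+-identityˡ _) (∑ℚ-zero n)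

∑ℚ-delta : ∀ {n} (x : Fin n) (φ : Fin n → ℚ) → ∑ℚ (λ t → if does (x Fin.≟ t) then φ t else 0ℚ) ≡ φ x
∑ℚ-delta {suc n} Fin.zero    φ = trans (cong (λ s → φ Fin.zero ℚ.+ s) (∑ℚ-zero n)) (ℚ.+-identityʳ (φ Fin.zero))
∑ℚ-delta {suc n} (Fin.suc x) φ = trans (ℚ.+-identityˡ _)
  (∑ℚ-delta x (λ t → φ (Fin.suc t)))

-- Weighting φ by the size of the fibres of σ sums φ ∘ σ; each list element adds a delta at its
-- image.
∑ℚ-count : ∀ {m n} (σ : Fin m → Fin n) (φ : Fin n → ℚ) (xs : List (Fin m)) →
  ∑ℚ (λ t → φ t ℚ.* (+ length (filter (λ x → σ x Fin.≟ t) xs) / 1)) ≡ List.foldr (λ x s → φ (σ x) ℚ.+ s) 0ℚ xs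
∑ℚ-count {n = n} σ φ []       = trans (∑ℚ-cong (λ t → ℚ.*-zeroʳ (φ t))) (∑ℚ-zero n)
∑ℚ-count σ φ (x ∷ xs) = begin
  ∑ℚ (λ t → φ t ℚ.* (+ length (filter (λ x → σ x Fin.≟ t) (x ∷ xs)) / 1))
    ≡⟨ ∑ℚ-cong step ⟩
  ∑ℚ (λ t → (if does (σ x Fin.≟ t) then φ t else 0ℚ) ℚ.+ φ t ℚ.* (+ length (filter (λ x → σ x Fin.≟ t) xs) / 1))
    ≡⟨ ∑ℚ-+ (λ t → if does (σ x Fin.≟ t) then φ t else 0ℚ) _ ⟩
  ∑ℚ (λ t → if does (σ x Fin.≟ t) then φ t else 0ℚ) ℚ.+ ∑ℚ (λ t → φ t ℚ.* (+ length (filter (λ x → σ x Fin.≟ t) xs) / 1))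
    ≡⟨ cong₂ ℚ._+_ (∑ℚ-delta (σ x) φ) (∑ℚ-count σ φ xs) ⟩
  φ (σ x) ℚ.+ List.foldr (λ x s → φ (σ x) ℚ.+ s) 0ℚ xs ∎
  where
  open ≡-Reasoning
  step : ∀ t → φ t ℚ.* (+ length (filter (λ x → σ x Fin.≟ t) (x ∷ xs)) / 1) ≡
    (if does (σ x Fin.≟ t) then φ t else 0ℚ) ℚ.+ φ t ℚ.* (+ length (filter (λ x → σ x Fin.≟ t) xs) / 1)
  step t with does (σ x Fin.≟ t)
  ... | true  = trans (cong (φ t ℚ.*_) (suc/1 (length (filter (λ x → σ x Fin.≟ t) xs))))
                  (distrib (φ t) (+ length (filter (λ x → σ x Fin.≟ t) xs) / 1))
    where
    distrib : ∀ p l → p ℚ.* (1ℚ ℚ.+ l) ≡ p ℚ.+ p ℚ.* l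
    distrib = solve 2 (λ p l → p :* (con 1ℚ :+ l) := p :+ p :* l) refl
  ... | false = sym (ℚ.+-identityˡ _)

foldr-tabulate : ∀ {A : Set} n (g : Fin n → A) (h : A → ℚ) → List.foldr (λ x s → h x ℚ.+ s) 0ℚ (List.tabulate g) ≡ ∑ℚ (λ i → h (g i))
foldr-tabulate zero    g h = refl
foldr-tabulate (suc n) g h = cong (λ s → h (g Fin.zero) ℚ.+ s) (foldr-tabulate n (λ i → g (Fin.suc i)) h)

-- Residues as periodic functions on ℕ, and the sum over squares.

module Residues (q : ℕ) .{{_ : NonZero q}} where

  mod-cong : ∀ {m n} → m % q ≡ n % q → m mod q ≡ n mod q
  mod-cong {m} {n} eq = Fin.toℕ-injective
    (trans (Fin.toℕ-fromℕ< (m%n<n m q)) (trans eq (sym (Fin.toℕ-fromℕ< (m%n<n n q)))))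

  toℕ-mod : ∀ m → toℕ (m mod q) ≡ m % q
  toℕ-mod m = Fin.toℕ-fromℕ< (m%n<n m q)

  mod-toℕ : ∀ (t : Fin q) → toℕ t mod q ≡ t
  mod-toℕ t = Fin.toℕ-injective (trans (toℕ-mod (toℕ t)) (m<n⇒m%n≡m (Fin.toℕ<n t)))

  ∑ℚ-mod : ∀ (f : Fin q → ℚ) → ∑ℚ f ≡ sum q (λ i → f (i mod q))
  ∑ℚ-mod f = trans (∑ℚ-cong (λ t → cong f (sym (mod-toℕ t)))) (∑ℚ-toℕ q (λ i → f (i mod q)))

  -- reflect f n = f (-n), so that a sum over a + b = x² becomes one over pairs n, n + x².
  lift reflect : (Fin q → ℚ) → ℕ → ℚ
  lift f n = f (n mod q)
  reflect f n = f ((n ℕ.* (q ℕ.∸ 1)) mod q)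

  lift-periodic : ∀ f → Periodic q (lift f)
  lift-periodic f n = cong f (mod-cong {n ℕ.+ q} {n} ([m+n]%n≡m%n n q))

  reflect-periodic : ∀ f → Periodic q (reflect f)
  reflect-periodic f n = cong f (mod-cong {(n ℕ.+ q) ℕ.* (q ℕ.∸ 1)} {n ℕ.* (q ℕ.∸ 1)}
    (trans (cong (_% q) (move n q (q ℕ.∸ 1))) ([m+kn]%n≡m%n (n ℕ.* (q ℕ.∸ 1)) (q ℕ.∸ 1) q)))
    where
    move : ∀ n q r → (n ℕ.+ q) ℕ.* r ≡ n ℕ.* r ℕ.+ r ℕ.* q
    move = ℕ-Ring.solve-∀

  reflect-complement : ∀ f (t : Fin q) → reflect f (q ℕ.∸ toℕ t) ≡ f t
  reflect-complement f t = cong f (trans (mod-cong {s ℕ.* (q ℕ.∸ 1)} {toℕ t} residue) (mod-toℕ t))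
    where
    s = q ℕ.∸ toℕ t
    open ≡-Reasoning
    regroup : ∀ s r t → s ℕ.* r ℕ.+ (s ℕ.+ t) ≡ t ℕ.+ s ℕ.* (1 ℕ.+ r)
    regroup = ℕ-Ring.solve-∀
    residue : (s ℕ.* (q ℕ.∸ 1)) % q ≡ toℕ t % q
    residue = begin
      -- Adding q, written as s + t, completes s (q - 1) to s q + t.
      (s ℕ.* (q ℕ.∸ 1)) % q                         ≡⟨ sym ([m+n]%n≡m%n (s ℕ.* (q ℕ.∸ 1)) q) ⟩
      (s ℕ.* (q ℕ.∸ 1) ℕ.+ q) % q                   ≡⟨ cong (λ r → (s ℕ.* (q ℕ.∸ 1) ℕ.+ r) % q) (sym (ℕ.m∸n+n≡m (ℕ.<⇒≤ (Fin.toℕ<n t)))) ⟩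
      (s ℕ.* (q ℕ.∸ 1) ℕ.+ (s ℕ.+ toℕ t)) % q       ≡⟨ cong (_% q) (regroup s (q ℕ.∸ 1) (toℕ t)) ⟩
      (toℕ t ℕ.+ s ℕ.* (1 ℕ.+ (q ℕ.∸ 1))) % q       ≡⟨ cong (λ r → (toℕ t ℕ.+ s ℕ.* r) % q) (ℕ.suc-pred q) ⟩
      (toℕ t ℕ.+ s ℕ.* q) % q                       ≡⟨ [m+kn]%n≡m%n (toℕ t) s q ⟩
      toℕ t % q                                     ∎

  -- q ∸ t runs through q, ..., 1; the period identifies q with 0.
  reflected-sum : ∀ {Φ} → Periodic q Φ → ∑ℚ {q} (λ t → Φ (q ℕ.∸ toℕ t)) ≡ sum q Φ
  reflected-sum {Φ} per = trans (∑ℚ-toℕ q (λ i → Φ (q ℕ.∸ i))) (trans (sum-reverse q Φ) (sum-rotate q per))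

  sum-reflect : ∀ f → ∑ℚ f ≡ sum q (reflect f)
  sum-reflect f = trans (∑ℚ-cong (λ t → sym (reflect-complement f t))) (reflected-sum (reflect-periodic f))

  open Progressions q

  -- Substituting n = q ∸ y, which represents -y, turns x² - y into n + x².
  convolution-at-square : ∀ a b x → ∑ℚ (λ y → a y ℚ.* b (square x ⊖ y)) ≡
    sum q (λ n → reflect a n ℚ.* lift b (n ℕ.+ toℕ x ℕ.* toℕ x))
  convolution-at-square a b x = trans
    (∑ℚ-cong (λ y → cong₂ ℚ._*_ (sym (reflect-complement a y)) (cong b (mod-cong (residue y)))))
    (reflected-sum (periodic-product (reflect-periodic a) (periodic-shift (lift-periodic b) (toℕ x ℕ.* toℕ x))))
    where
    open ≡-Reasoning
    X = toℕ x ℕ.* toℕ x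
    residue : ∀ y → (toℕ (square x) ℕ.+ (q ℕ.∸ toℕ y)) % q ≡ (q ℕ.∸ toℕ y ℕ.+ X) % q
    residue y = begin
      (toℕ (X mod q) ℕ.+ s) % q            ≡⟨ cong (λ r → (r ℕ.+ s) % q) (toℕ-mod X) ⟩
      (X % q ℕ.+ s) % q                    ≡⟨ %-distribˡ-+ (X % q) s q ⟩
      (X % q % q ℕ.+ s % q) % q            ≡⟨ cong (λ r → (r ℕ.+ s % q) % q) (m%n%n≡m%n X q) ⟩
      (X % q ℕ.+ s % q) % q                ≡⟨ sym (%-distribˡ-+ X s q) ⟩
      (X ℕ.+ s) % q                        ≡⟨ cong (_% q) (ℕ.+-comm X s) ⟩
      (s ℕ.+ X) % q                        ∎
      where s = q ℕ.∸ toℕ y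

  -- The square-root count turns the sum over t into one over x with t = x². The 1/q of the
  -- convolution makes the inner sum a mean, and the factor q makes the outer one a mean as well.
  correlation-sum : ∀ (a b : Fin q → ℚ) →
    ∑ℚ (λ t → + 1 / q ℚ.* ∑ℚ (λ y → a y ℚ.* b (t ⊖ y)) ℚ.* (+ length (filter (λ x → square x Fin.≟ t) (allFin q)) / 1))
    ≡ (+ q / 1) ℚ.* 𝔼 (λ n → reflect a n ℚ.* squareMean (lift b) n)
  correlation-sum a b = begin
    ∑ℚ (λ t → φ t ℚ.* (+ length (filter (λ x → square x Fin.≟ t) (allFin q)) / 1))
      ≡⟨ ∑ℚ-count square φ (allFin q) ⟩
    List.foldr (λ x s → φ (square x) ℚ.+ s) 0ℚ (allFin q)
      ≡⟨ foldr-tabulate q (λ x → x) (λ x → φ (square x)) ⟩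
    ∑ℚ (λ x → φ (square x))
      ≡⟨ ∑ℚ-cong (λ x → cong (+ 1 / q ℚ.*_) (convolution-at-square a b x)) ⟩
    ∑ℚ {q} (λ x → ψ (toℕ x))
      ≡⟨ ∑ℚ-toℕ q ψ ⟩
    sum q ψ
      ≡⟨ sym (trans (sym (ℚ.*-assoc (+ q / 1) (+ 1 / q) (sum q ψ)))
           (trans (cong (ℚ._* sum q ψ) (trans (ℚ.*-comm (+ q / 1) (+ 1 / q)) (1/q*q q))) (ℚ.*-identityˡ (sum q ψ)))) ⟩
    (+ q / 1) ℚ.* 𝔼 ψ
      ≡⟨ cong ((+ q / 1) ℚ.*_) (mean-swap q q _) ⟩
    (+ q / 1) ℚ.* 𝔼 (λ n → 𝔼 λ x → reflect a n ℚ.* lift b (n ℕ.+ x ℕ.* x))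
      ≡⟨ cong ((+ q / 1) ℚ.*_) (mean-cong q (λ n → mean-* q (reflect a n) _)) ⟩
    (+ q / 1) ℚ.* 𝔼 (λ n → reflect a n ℚ.* squareMean (lift b) n) ∎
    where
    open ≡-Reasoning
    φ : Fin q → ℚ
    φ t = + 1 / q ℚ.* ∑ℚ (λ y → a y ℚ.* b (t ⊖ y))
    ψ : ℕ → ℚ
    ψ x = 𝔼 λ n → reflect a n ℚ.* lift b (n ℕ.+ x ℕ.* x)

-- The bound when the hypotheses hold up to an error δ.

5ℚ : ℚ
5ℚ = + 5 / 1

module Approximate (q : ℕ) .{{_ : NonZero q}} (a b : Fin q → ℚ) (ε δ : ℚ) (0≤δ : 0ℚ ℚ.≤ δ) (δ≤½ : δ ℚ.≤ ½) (δ≤ε : δ ℚ.≤ ε)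
  (a-lower : ∀ t → 0ℚ ℚ.≤ a t ℚ.+ δ) (a-upper : ∀ t → a t ℚ.≤ 1ℚ ℚ.+ δ)
  (b-lower : ∀ t → 0ℚ ℚ.≤ b t ℚ.+ δ) (b-upper : ∀ t → b t ℚ.≤ 1ℚ ℚ.+ δ)
  (a-dense : (⅜ ℚ.+ ε) ℚ.* (+ q / 1) ℚ.≤ ∑ℚ a ℚ.+ δ) (b-dense : (⅜ ℚ.+ ε) ℚ.* (+ q / 1) ℚ.≤ ∑ℚ b ℚ.+ δ) where

  open Residues q
  open Progressions q

  private
    -- Adding δ restores nonnegativity and raises the upper bound to 1 + 2δ. The means rise by δ
    -- too, which covers the error δ/q in the density.
    A B : ℕ → ℚ
    A n = reflect a n ℚ.+ δ
    B n = lift b n ℚ.+ δ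

    M : ℚ
    M = 1ℚ ℚ.+ δ ℚ.+ δ

    mean-+δ : ∀ f → 𝔼 (λ n → f n ℚ.+ δ) ≡ 𝔼 f ℚ.+ δ
    mean-+δ f = trans (mean-+ q f _) (cong (λ t → 𝔼 f ℚ.+ t) (mean-const q δ))

    1/q≤1 : + 1 / q ℚ.≤ 1ℚ
    1/q≤1 = subst (ℚ._≤ 1ℚ) (ℚ.*-identityʳ (+ 1 / q)) (subst ((+ 1 / q) ℚ.* 1ℚ ℚ.≤_) (1/q*q q)
      (ℚ.*-monoˡ-≤-nonNeg (+ 1 / q) {{ℚ.nonNegative (0≤1/ q)}} (1≤q q)))
      where
      1≤q : ∀ q .{{_ : NonZero q}} → 1ℚ ℚ.≤ + q / 1
      1≤q (suc p) = ≤-by (+ p / 1) (0≤n/1 p) (sym (suc/1 p))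

    dense : ∀ f → (⅜ ℚ.+ ε) ℚ.* (+ q / 1) ℚ.≤ sum q f ℚ.+ δ → ⅜ ℚ.+ ε ℚ.≤ 𝔼 (λ n → f n ℚ.+ δ)
    dense f le = begin
      ⅜ ℚ.+ ε                                          ≡⟨ sym (ℚ.*-identityʳ (⅜ ℚ.+ ε)) ⟩
      (⅜ ℚ.+ ε) ℚ.* 1ℚ                                 ≡⟨ cong ((⅜ ℚ.+ ε) ℚ.*_) (sym (1/q*q q)) ⟩
      (⅜ ℚ.+ ε) ℚ.* (+ 1 / q ℚ.* (+ q / 1))            ≡⟨ swap (⅜ ℚ.+ ε) (+ 1 / q) (+ q / 1) ⟩
      + 1 / q ℚ.* ((⅜ ℚ.+ ε) ℚ.* (+ q / 1))            ≤⟨ ℚ.*-monoˡ-≤-nonNeg (+ 1 / q) {{ℚ.nonNegative (0≤1/ q)}} le ⟩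
      + 1 / q ℚ.* (sum q f ℚ.+ δ)                      ≡⟨ ℚ.*-distribˡ-+ (+ 1 / q) (sum q f) δ ⟩
      𝔼 f ℚ.+ + 1 / q ℚ.* δ                            ≤⟨ ℚ.+-monoʳ-≤ (𝔼 f) (ℚ.*-monoʳ-≤-nonNeg δ {{ℚ.nonNegative 0≤δ}} 1/q≤1) ⟩
      𝔼 f ℚ.+ 1ℚ ℚ.* δ                                 ≡⟨ cong (λ t → 𝔼 f ℚ.+ t) (ℚ.*-identityˡ δ) ⟩
      𝔼 f ℚ.+ δ                                        ≡⟨ sym (mean-+δ f) ⟩
      𝔼 (λ n → f n ℚ.+ δ)                              ∎
      where
      open ℚ.≤-Reasoning
      swap : ∀ x y z → x ℚ.* (y ℚ.* z) ≡ y ℚ.* (x ℚ.* z)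
      swap = solve 3 (λ x y z → x :* (y :* z) := y :* (x :* z)) refl

    0≤ε : 0ℚ ℚ.≤ ε
    0≤ε = ℚ.≤-trans 0≤δ δ≤ε

    ⅜≤⅜+ε : ⅜ ℚ.≤ ⅜ ℚ.+ ε
    ⅜≤⅜+ε = ≤-by ε 0≤ε refl

    ⅜M≤⅜+ε : ⅜ ℚ.* M ℚ.≤ ⅜ ℚ.+ ε
    ⅜M≤⅜+ε = ≤-by ((ε ℚ.- δ) ℚ.+ + 1 / 4 ℚ.* δ)
      (0≤-+ (0≤-diff δ≤ε) (0≤-* (ℚ.nonNegative⁻¹ (+ 1 / 4)) 0≤δ)) (value ε δ)
      where
      value : ∀ ε δ → ⅜ ℚ.* (1ℚ ℚ.+ δ ℚ.+ δ) ℚ.+ ((ε ℚ.- δ) ℚ.+ + 1 / 4 ℚ.* δ) ≡ ⅜ ℚ.+ ε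
      value = solve 2 (λ ε δ → con ⅜ :* (con 1ℚ :+ δ :+ δ) :+ ((ε :- δ) :+ con (+ 1 / 4) :* δ) := con ⅜ :+ ε) refl

    shifted : ½ ℚ.* (⅜ ℚ.+ ε ℚ.- ⅜ ℚ.* M) ℚ.≤ 𝔼 (λ n → A n ℚ.* squareMean B n)
    shifted = Scaled.correlation-lower-bound q {A} {B}
      (λ n → cong (ℚ._+ δ) (reflect-periodic a n)) (λ n → cong (ℚ._+ δ) (lift-periodic b n))
      (λ n → a-lower _) (λ n → b-lower _)
      (λ n → ℚ.+-monoˡ-≤ δ (a-upper _)) (λ n → ℚ.+-monoˡ-≤ δ (b-upper _))
      (dense (reflect a) (subst (λ s → (⅜ ℚ.+ ε) ℚ.* (+ q / 1) ℚ.≤ s ℚ.+ δ) (sum-reflect a) a-dense))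
      (dense (lift b) (subst (λ s → (⅜ ℚ.+ ε) ℚ.* (+ q / 1) ℚ.≤ s ℚ.+ δ) (∑ℚ-mod b) b-dense))
      ⅜≤⅜+ε ⅜M≤⅜+ε

    S : ℚ
    S = 𝔼 (λ n → reflect a n ℚ.* squareMean (lift b) n)

    T-upper : ∀ n → squareMean (lift b) n ℚ.≤ 1ℚ ℚ.+ δ
    T-upper n = subst (squareMean (lift b) n ℚ.≤_) (mean-const q (1ℚ ℚ.+ δ)) (mean-mono q (λ x → b-upper _))

    -- (x + δ)(t + δ) exceeds x t by δ ((x + δ) + t), and the two summands are at most M and 1 + δ.
    unshift : 𝔼 (λ n → A n ℚ.* squareMean B n) ℚ.≤ S ℚ.+ δ ℚ.* (M ℚ.+ (1ℚ ℚ.+ δ))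
    unshift = ℚ.≤-trans (mean-mono q pointwise) (ℚ.≤-reflexive
      (trans (mean-+ q _ _) (cong (λ t → S ℚ.+ t) (mean-const q (δ ℚ.* (M ℚ.+ (1ℚ ℚ.+ δ)))))))
      where
      value : ∀ x δ t p r → (x ℚ.+ δ) ℚ.* (t ℚ.+ δ) ℚ.+ δ ℚ.* ((p ℚ.- (x ℚ.+ δ)) ℚ.+ (r ℚ.- t)) ≡ x ℚ.* t ℚ.+ δ ℚ.* (p ℚ.+ r)
      value = solve 5 (λ x δ t p r → (x :+ δ) :* (t :+ δ) :+ δ :* ((p :- (x :+ δ)) :+ (r :- t)) := x :* t :+ δ :* (p :+ r)) refl
      pointwise : ∀ n → A n ℚ.* squareMean B n ℚ.≤ reflect a n ℚ.* squareMean (lift b) n ℚ.+ δ ℚ.* (M ℚ.+ (1ℚ ℚ.+ δ))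
      pointwise n = subst (λ t → A n ℚ.* t ℚ.≤ reflect a n ℚ.* squareMean (lift b) n ℚ.+ δ ℚ.* (M ℚ.+ (1ℚ ℚ.+ δ)))
        (sym (mean-+δ (λ x → lift b (n ℕ.+ x ℕ.* x))))
        (≤-by (δ ℚ.* ((M ℚ.- A n) ℚ.+ (1ℚ ℚ.+ δ ℚ.- squareMean (lift b) n)))
          (0≤-* 0≤δ (0≤-+ (0≤-diff (ℚ.+-monoˡ-≤ δ (a-upper _))) (0≤-diff (T-upper n))))
          (value (reflect a n) δ (squareMean (lift b) n) M (1ℚ ℚ.+ δ)))

  -- The shift costs δ (2 + 3δ), and M in place of 1 costs ½ · ¾ δ; for δ ≤ ½ the sum stays below
  -- 5δ, by the margin 9/8 + 3 (½ - δ) per unit of δ.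
  approximate-bound : ½ ℚ.* ε ℚ.≤ 𝔼 (λ n → reflect a n ℚ.* squareMean (lift b) n) ℚ.+ 5ℚ ℚ.* δ
  approximate-bound = ≤-by
    ((S ℚ.+ δ ℚ.* (M ℚ.+ (1ℚ ℚ.+ δ)) ℚ.- ½ ℚ.* (⅜ ℚ.+ ε ℚ.- ⅜ ℚ.* M)) ℚ.+ δ ℚ.* (+ 9 / 8 ℚ.+ 3ℚ ℚ.* (½ ℚ.- δ)))
    (0≤-+ (0≤-diff (ℚ.≤-trans shifted unshift))
      (0≤-* 0≤δ (0≤-+ (ℚ.nonNegative⁻¹ (+ 9 / 8)) (0≤-* (ℚ.nonNegative⁻¹ 3ℚ) (0≤-diff δ≤½)))))
    (value S ε δ)
    where
    value : ∀ S ε δ → ½ ℚ.* ε ℚ.+ ((S ℚ.+ δ ℚ.* (1ℚ ℚ.+ δ ℚ.+ δ ℚ.+ (1ℚ ℚ.+ δ)) ℚ.- ½ ℚ.* (⅜ ℚ.+ ε ℚ.- ⅜ ℚ.* (1ℚ ℚ.+ δ ℚ.+ δ)))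
      ℚ.+ δ ℚ.* (+ 9 / 8 ℚ.+ 3ℚ ℚ.* (½ ℚ.- δ))) ≡ S ℚ.+ 5ℚ ℚ.* δ
    value = solve 3 (λ S ε δ → con ½ :* ε :+ ((S :+ δ :* (con 1ℚ :+ δ :+ δ :+ (con 1ℚ :+ δ)) :- con ½ :* (con ⅜ :+ ε :- con ⅜ :* (con 1ℚ :+ δ :+ δ)))
      :+ δ :* (con (+ 9 / 8) :+ con 3ℚ :* (con ½ :- δ))) := S :+ con 5ℚ :* δ) refl

-- Passage to the real weights.

eventually-all : ∀ {q} {P : Fin q → ℕ → Set} → (∀ t → ∃ λ N → ∀ n → N ℕ.≤ n → P t n) → ∃ λ N → ∀ n → N ℕ.≤ n → ∀ t → P t n
eventually-all {zero}  ev = 0 , λ n _ ()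
eventually-all {suc q} ev with ev Fin.zero | eventually-all (λ t → ev (Fin.suc t))
... | N , p | N′ , p′ = N ℕ.⊔ N′ , λ where
  n N≤n Fin.zero    → p n (ℕ.m⊔n≤o⇒m≤o N N′ N≤n)
  n N≤n (Fin.suc t) → p′ n (ℕ.m⊔n≤o⇒n≤o N N′ N≤n) t

-- 4 N² ≤ 5 N² makes every approximant of √5 at least 2, so the step from ε/2 to ε/√5 is valid at
-- each index.
recip-√5-≤-½ : ∀ n → seq (recip (√ 5) (√-pos 5)) n ℚ.≤ ½
recip-√5-≤-½ n = ≤-by (½ ℚ.* i ℚ.* (p ℚ.- 2ℚ)) (0≤-* (0≤-* (ℚ.nonNegative⁻¹ ½) (ℚ.<⇒≤ (inv-pos p 0<p)))
  (0≤-diff (ℚ.≤-trans 2≤√5 (ℚ.p≤p⊔q (seq (√ 5) n) 1ℚ))))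
  (trans (value i p) (cong (½ ℚ.*_) (inv-inverse p 0<p)))
  where
  -- The 1ℚ is the positivity witness of `√-pos`, by which `recip` truncates.
  p = seq (√ 5) n ℚ.⊔ 1ℚ
  0<p = 0<⊔ (seq (√ 5) n) (proj₁ (proj₂ (√-pos 5)))
  i = inv p 0<p
  value : ∀ i p → i ℚ.+ ½ ℚ.* i ℚ.* (p ℚ.- 2ℚ) ≡ ½ ℚ.* (p ℚ.* i)
  value = solve 2 (λ i p → i :+ con ½ :* i :* (p :- con 2ℚ) := con ½ :* (p :* i)) refl
  N = suc n
  f = ⌊√ 5 ℕ.* (N ℕ.* N) ⌋
  four : ∀ N → 4 ℕ.* (N ℕ.* N) ≡ 2 ℕ.* N ℕ.* (2 ℕ.* N)
  four = ℕ-Ring.solve-∀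
  2N≤f : 2 ℕ.* N ℕ.≤ f
  2N≤f with 2 ℕ.* N ℕ.≤? f
  ... | yes le = le
  ... | no ¬le with () ← ℕ.<⇒≱ (⌊√⌋-upper (5 ℕ.* (N ℕ.* N))) (ℕ.≤-trans (ℕ.*-mono-≤ (ℕ.≰⇒> ¬le) (ℕ.≰⇒> ¬le))
      (subst (ℕ._≤ 5 ℕ.* (N ℕ.* N)) (four N) (ℕ.*-monoˡ-≤ (N ℕ.* N) (ℕ.n≤1+n 4))))
  2≤√5 : 2ℚ ℚ.≤ seq (√ 5) n
  2≤√5 = ℚ.toℚᵘ-cancel-≤ (ℚᵘ.≤-respʳ-≃ (ℚᵘ.≃-sym (ℚ.toℚᵘ-fromℚᵘ (ℚᵘ.mkℚᵘ (+ f) n)))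
    (ℚᵘ.*≤* (subst₂ ℤ._≤_ (ℤ.pos-* 2 N) (trans (cong +_ (sym (ℕ.*-identityʳ f))) (ℤ.pos-* f 1)) (ℤ.+≤+ 2N≤f))))

module _ (ε : ℝ) (0<ε : 0ℝ < ε) (q : ℕ) .{{_ : NonZero q}} (wA wB : ℤ/ q → ℝ)
  (wA-unit : ∀ t → 0ℝ ≤ wA t × wA t ≤ 1ℝ) (wB-unit : ∀ t → 0ℝ ≤ wB t × wB t ≤ 1ℝ)
  (wA-dense : (fromℚ (+ 3 / 8) + ε) * fromℕ q ≤ ∑ wA) (wB-dense : (fromℚ (+ 3 / 8) + ε) * fromℕ q ≤ ∑ wB)
  (δ : ℚ) (0<δ : 0ℚ ℚ.< δ) where

  private
    ε₀ = proj₁ 0<ε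
    0<ε₀ = proj₁ (proj₂ 0<ε)

    -- The factor 1/5 cancels the constant of `approximate-bound`, and 1/q the factor q between mean
    -- and sum.
    δ/5q : ℚ
    δ/5q = + 1 / 5 ℚ.* (+ 1 / q) ℚ.* δ

    0<1/q : ∀ q .{{_ : NonZero q}} → 0ℚ ℚ.< + 1 / q
    0<1/q q = ℚ.positive⁻¹ (+ 1 / q) {{ℚ.normalize-pos 1 q}}

    *-pos : ∀ {p r} → 0ℚ ℚ.< p → 0ℚ ℚ.< r → 0ℚ ℚ.< p ℚ.* r
    *-pos {p} {r} 0<p 0<r = ℚ.positive⁻¹ (p ℚ.* r) {{ℚ.pos*pos⇒pos p {{ℚ.positive 0<p}} r {{ℚ.positive 0<r}}}}

    0<δ/5q : 0ℚ ℚ.< δ/5q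
    0<δ/5q = *-pos (*-pos (ℚ.positive⁻¹ (+ 1 / 5)) (0<1/q q)) 0<δ

    ⊓-pos : ∀ {p r} → 0ℚ ℚ.< p → 0ℚ ℚ.< r → 0ℚ ℚ.< p ℚ.⊓ r
    ⊓-pos {p} {r} 0<p 0<r = [ (λ eq → subst (0ℚ ℚ.<_) (sym eq) 0<p) , (λ eq → subst (0ℚ ℚ.<_) (sym eq) 0<r) ]′ (ℚ.⊓-sel p r)

    -- ε₀ is an eventual rational lower bound of ε and gives δ₀ ≤ ε at late indices, ½ is the range
    -- of `approximate-bound`, and `δ/5q` keeps the final error below δ.
    δ₀ : ℚ
    δ₀ = ε₀ ℚ.⊓ (½ ℚ.⊓ δ/5q)

    0<δ₀ : 0ℚ ℚ.< δ₀
    0<δ₀ = ⊓-pos 0<ε₀ (⊓-pos (ℚ.positive⁻¹ ½) 0<δ/5q)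

    δ₀≤ε₀ : δ₀ ℚ.≤ ε₀
    δ₀≤ε₀ = ℚ.p⊓q≤p ε₀ _

    δ₀≤½ : δ₀ ℚ.≤ ½
    δ₀≤½ = ℚ.≤-trans (ℚ.p⊓q≤q ε₀ _) (ℚ.p⊓q≤p ½ δ/5q)

    δ₀≤δ/5q : δ₀ ℚ.≤ δ/5q
    δ₀≤δ/5q = ℚ.≤-trans (ℚ.p⊓q≤q ε₀ _) (ℚ.p⊓q≤q ½ δ/5q)

    finish : ∀ n S → ½ ℚ.* seq ε n ℚ.≤ S ℚ.+ 5ℚ ℚ.* δ₀ → ε₀ ℚ.≤ seq ε n →
      seq (c ε * fromℕ q) n ℚ.≤ (+ q / 1) ℚ.* S ℚ.+ δ
    finish n S le ε₀≤ = begin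
      e ℚ.* r ℚ.* (+ q / 1)                       ≤⟨ ℚ.*-monoʳ-≤-nonNeg (+ q / 1) {{Q}} (ℚ.*-monoˡ-≤-nonNeg e {{ℚ.nonNegative 0≤e}} (recip-√5-≤-½ n)) ⟩
      e ℚ.* ½ ℚ.* (+ q / 1)                       ≡⟨ trans (ℚ.*-comm _ (+ q / 1)) (cong ((+ q / 1) ℚ.*_) (ℚ.*-comm e ½)) ⟩
      (+ q / 1) ℚ.* (½ ℚ.* e)                     ≤⟨ ℚ.*-monoˡ-≤-nonNeg (+ q / 1) {{Q}} (ℚ.≤-trans le
                                                       (ℚ.+-monoʳ-≤ S (ℚ.*-monoˡ-≤-nonNeg 5ℚ δ₀≤δ/5q))) ⟩
      (+ q / 1) ℚ.* (S ℚ.+ 5ℚ ℚ.* δ/5q)           ≡⟨ expand (+ q / 1) (+ 1 / q) S δ ⟩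
      (+ q / 1) ℚ.* S ℚ.+ (+ 1 / q ℚ.* (+ q / 1)) ℚ.* δ  ≡⟨ cong (λ t → (+ q / 1) ℚ.* S ℚ.+ t) (trans (cong (ℚ._* δ) (1/q*q q)) (ℚ.*-identityˡ δ)) ⟩
      (+ q / 1) ℚ.* S ℚ.+ δ                       ∎
      where
      open ℚ.≤-Reasoning
      e = seq ε n
      r = seq (recip (√ 5) (√-pos 5)) n
      Q = ℚ.nonNegative (0≤n/1 q)
      0≤e : 0ℚ ℚ.≤ e
      0≤e = ℚ.≤-trans (ℚ.<⇒≤ 0<ε₀) ε₀≤
      expand : ∀ Q i S δ → Q ℚ.* (S ℚ.+ 5ℚ ℚ.* (+ 1 / 5 ℚ.* i ℚ.* δ)) ≡ Q ℚ.* S ℚ.+ (i ℚ.* Q) ℚ.* δ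
      expand = solve 4 (λ Q i S δ → Q :* (S :+ con 5ℚ :* (con (+ 1 / 5) :* i :* δ)) := Q :* S :+ (i :* Q) :* δ) refl

    correlation-seq : ∀ n → seq (∑ (λ t → (wA ⋆ wB) t * squareRootCount q t)) n ≡
      (+ q / 1) ℚ.* Progressions.𝔼 q (λ m → Residues.reflect q (λ t → seq (wA t) n) m
        ℚ.* Progressions.squareMean q (Residues.lift q (λ t → seq (wB t) n)) m)
    correlation-seq n = begin
      seq (∑ (λ t → (wA ⋆ wB) t * squareRootCount q t)) n
        ≡⟨ seq-∑ (λ t → (wA ⋆ wB) t * squareRootCount q t) n ⟩
      ∑ℚ (λ t → + 1 / q ℚ.* seq (∑ λ a → wA a * wB (t ⊖ a)) n ℚ.* count t)
        ≡⟨ ∑ℚ-cong {f = λ t → + 1 / q ℚ.* seq (∑ λ a → wA a * wB (t ⊖ a)) n ℚ.* count t}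
             {g = λ t → + 1 / q ℚ.* ∑ℚ (λ a → seq (wA a) n ℚ.* seq (wB (t ⊖ a)) n) ℚ.* count t}
             (λ t → cong (λ s → + 1 / q ℚ.* s ℚ.* count t) (seq-∑ (λ a → wA a * wB (t ⊖ a)) n)) ⟩
      ∑ℚ (λ t → + 1 / q ℚ.* ∑ℚ (λ a → seq (wA a) n ℚ.* seq (wB (t ⊖ a)) n) ℚ.* count t)
        ≡⟨ Residues.correlation-sum q (λ t → seq (wA t) n) (λ t → seq (wB t) n) ⟩
      _ ∎
      where
      open ≡-Reasoning
      count : ℤ/ q → ℚ
      count t = + length (filter (λ x → square x Fin.≟ t) (allFin q)) / 1

    Dense : (ℤ/ q → ℝ) → ℕ → Set
    Dense w n = (⅜ ℚ.+ seq ε n) ℚ.* (+ q / 1) ℚ.≤ ∑ℚ (λ t → seq (w t) n) ℚ.+ δ₀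

    dense-seq : ∀ w n → seq ((fromℚ (+ 3 / 8) + ε) * fromℕ q) n ℚ.≤ seq (∑ w) n ℚ.+ δ₀ → Dense w n
    dense-seq w n = subst (λ s → (⅜ ℚ.+ seq ε n) ℚ.* (+ q / 1) ℚ.≤ s ℚ.+ δ₀) (seq-∑ w n)

    Bounds : (ℤ/ q → ℝ) → ℕ → Set
    Bounds w n = ∀ t → 0ℚ ℚ.≤ seq (w t) n ℚ.+ δ₀ × seq (w t) n ℚ.≤ 1ℚ ℚ.+ δ₀

    eventually-bounds : ∀ w → (∀ t → 0ℝ ≤ w t × w t ≤ 1ℝ) → ∃ λ N → ∀ n → N ℕ.≤ n → Bounds w n
    eventually-bounds w unit = eventually-all (λ t →
      let N , p = proj₁ (unit t) δ₀ 0<δ₀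
          N′ , p′ = proj₂ (unit t) δ₀ 0<δ₀
      in N ℕ.⊔ N′ , λ n N≤n → p n (ℕ.m⊔n≤o⇒m≤o N N′ N≤n) , p′ n (ℕ.m⊔n≤o⇒n≤o N N′ N≤n))

    at-index : ∀ n → ε₀ ℚ.≤ seq ε n → Bounds wA n → Bounds wB n → Dense wA n → Dense wB n →
      seq (c ε * fromℕ q) n ℚ.≤ seq (∑ (λ t → (wA ⋆ wB) t * squareRootCount q t)) n ℚ.+ δ
    at-index n ε₀≤ bA bB dA dB = subst (λ s → seq (c ε * fromℕ q) n ℚ.≤ s ℚ.+ δ) (sym (correlation-seq n))
      (finish n _ (Approximate.approximate-bound q (λ t → seq (wA t) n) (λ t → seq (wB t) n) (seq ε n) δ₀
        (ℚ.<⇒≤ 0<δ₀) δ₀≤½ (ℚ.≤-trans δ₀≤ε₀ ε₀≤)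
        (λ t → proj₁ (bA t)) (λ t → proj₂ (bA t)) (λ t → proj₁ (bB t)) (λ t → proj₂ (bB t)) dA dB) ε₀≤)

  eventually-≤ : ∃ λ N → ∀ n → N ℕ.≤ n →
    seq (c ε * fromℕ q) n ℚ.≤ seq (∑ (λ t → (wA ⋆ wB) t * squareRootCount q t)) n ℚ.+ δ
  eventually-≤ = combine (proj₂ (proj₂ 0<ε)) (eventually-bounds wA wA-unit) (eventually-bounds wB wB-unit)
    (wA-dense δ₀ 0<δ₀) (wB-dense δ₀ 0<δ₀)
    where
    combine : (∃ λ N → ∀ n → N ℕ.≤ n → 0ℚ ℚ.+ ε₀ ℚ.≤ seq ε n) →
      (∃ λ N → ∀ n → N ℕ.≤ n → Bounds wA n) → (∃ λ N → ∀ n → N ℕ.≤ n → Bounds wB n) →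
      (∃ λ N → ∀ n → N ℕ.≤ n → seq ((fromℚ (+ 3 / 8) + ε) * fromℕ q) n ℚ.≤ seq (∑ wA) n ℚ.+ δ₀) →
      (∃ λ N → ∀ n → N ℕ.≤ n → seq ((fromℚ (+ 3 / 8) + ε) * fromℕ q) n ℚ.≤ seq (∑ wB) n ℚ.+ δ₀) → _
    combine (N₁ , p₁) (N₂ , p₂) (N₃ , p₃) (N₄ , p₄) (N₅ , p₅) = N₁ ℕ.⊔ (N₂ ℕ.⊔ (N₃ ℕ.⊔ (N₄ ℕ.⊔ N₅))) , λ n N≤n →
      let N₂≤n = ℕ.m⊔n≤o⇒n≤o N₁ _ N≤n
          N₃≤n = ℕ.m⊔n≤o⇒n≤o N₂ _ N₂≤n
          N₄≤n = ℕ.m⊔n≤o⇒n≤o N₃ _ N₃≤n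
      in at-index n (subst (ℚ._≤ seq ε n) (ℚ.+-identityˡ ε₀) (p₁ n (ℕ.m⊔n≤o⇒m≤o N₁ _ N≤n)))
           (p₂ n (ℕ.m⊔n≤o⇒m≤o N₂ _ N₂≤n)) (p₃ n (ℕ.m⊔n≤o⇒m≤o N₃ _ N₃≤n))
           (dense-seq wA n (p₄ n (ℕ.m⊔n≤o⇒m≤o N₄ N₅ N₄≤n))) (dense-seq wB n (p₅ n (ℕ.m⊔n≤o⇒n≤o N₄ N₅ N₄≤n)))

theorem3p1 : (ε : ℝ) → 0ℝ < ε →
    (q : ℕ) .{{_ : NonZero q}} →
    (wA wB : ℤ/ q → ℝ) →
    (∀ t → 0ℝ ≤ wA t × wA t ≤ 1ℝ) →
    (∀ t → 0ℝ ≤ wB t × wB t ≤ 1ℝ) →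
    (fromℚ (+ 3 / 8) + ε) * fromℕ q ≤ ∑ wA →
    (fromℚ (+ 3 / 8) + ε) * fromℕ q ≤ ∑ wB →
    c ε * fromℕ q ≤ ∑ (λ t → (wA ⋆ wB) t * squareRootCount q t)
theorem3p1 ε 0<ε q wA wB wA-unit wB-unit wA-dense wB-dense = eventually-≤ ε 0<ε q wA wB wA-unit wB-unit wA-dense wB-dense
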